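{- Let $h\ge 1$ and let $m_i\ge 3$ be integers for $1\le i\le h-1$. Set $T^z=T^z_{2,m_1,\ldots,m_{h-1}}$ for $z=1,2$. Then $$\mathrm{rn}(T^z)=\begin{cases}\displaystyle\sum_{i=1}^{h-1}\bigl(4(h-i)-2\bigr)\Bigl(\prod_{j=1}^{i}(m_j-1)\Bigr)+\prod_{i=1}^{h-1}(m_i-1)+4h-1, & \text{if } z=1,\\[2ex] \displaystyle\sum_{i=1}^{h-1}\bigl(4(h-i)-2\bigr)\Bigl(\prod_{j=1}^{i}(m_j-1)\Bigr)+2\prod_{i=1}^{h-1}(m_i-1)+6h-3, & \text{if } z=2.\end{cases}$$
   Context: A radio labelling of a graph $G$ is a map $f: V(G)\to\{0,1,2,\ldots\}$ with $|f(u)-f(v)| \ge \mathrm{diam}(G)+1-d(u,v)$ for all distinct $u,v\in V(G)$. Its span is $\max\{|f(u)-f(v)|: u,v\in V(G)\}$, and the radio number $\mathrm{rn}(G)$ is the minimum span of a radio labelling of $G$. The center $L_0$ of a tree $T$ is the set of vertices of minimum eccentricity; it is one vertex or two adjacent vertices according as $\mathrm{diam}(T)$ is even or odd. The height is $h=\lfloor\mathrm{diam}(T)/2\rfloor$, and $L_i$ is the set of vertices at distance $i$ from $L_0$ (minimum distance to a vertex of $L_0$), $0\le i\le h$. $T$ is level-wise regular if for each $0\le i\le h$ all vertices in $L_i$ have the same degree $m_i$ (so $m_h=1$ and all leaves are in $L_h$). Up to isomorphism such a tree is determined by $(m_0,\ldots,m_{h-1})$ and $z=|L_0|\in\{1,2\}$,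 and is denoted $T^z_{m_0,m_1,\ldots,m_{h-1}}$. Its diameter is $2h$ if $z=1$ and $2h+1$ if $z=2$.
   Formalization: The case z = 1 is stated for h ≥ 2 only: for h = 1 the tree is the path on three vertices, whose radio number is 3 (label the ends 0 and 1, the centre 3), while the formula gives 4. -}

module Defs where

open import Level using (0ℓ)
open import Data.Nat using (ℕ; suc; _+_; _∸_; _≤_; _<_; ∣_-_∣; ⌊_/2⌋)
open import Data.Nat.ListAction using (sum; product)
open import Data.Fin using (Fin; zero; suc; fromℕ; inject₁)
open import Data.Fin.Subset using (Subset; _∈_; ∣_∣)
open import Data.List using (List; length; filter; map; allFin; applyUpTo)
open import Data.Product using (∃; ∃₂; _×_)
open import Function using (_⇔_)
open import Function.Definitions using (Injective)
open import Relation.Binary using (Rel; Decidable; Symmetric; Irreflexive)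
open import Relation.Binary.PropositionalEquality using (_≡_; _≢_)
open import Relation.Nullary using (¬_)

Least Greatest : (ℕ → Set) → ℕ → Set
Least    P k = P k × (∀ {j} → P j → k ≤ j)
Greatest P k = P k × (∀ {j} → P j → j ≤ k)

∑[1⋯_] ∏[1⋯_] : ℕ → (ℕ → ℕ) → ℕ
∑[1⋯ k ] f = sum     (map f (applyUpTo suc k))
∏[1⋯ k ] f = product (map f (applyUpTo suc k))

record Graph (n : ℕ) : Set₁ where
  infix 4 _~_ _~?_
  field
    _~_      : Rel (Fin n) 0ℓ
    _~?_     : Decidable _~_
    ~-sym    : Symmetric _~_
    ~-irrefl : Irreflexive _≡_ _~_

-- Minima and maxima (distance, eccentricity, diameter, span, radio number)
-- are functional relations "k is the ...", each inhabited for at most one k.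
module _ {n : ℕ} (G : Graph n) where
  open Graph G

  degree : Fin n → ℕ
  degree u = length (filter (u ~?_) (allFin n))

  data Walk : Fin n → Fin n → ℕ → Set where
    []  : ∀ {u} → Walk u u 0
    _∷_ : ∀ {u v w k} → u ~ v → Walk v w k → Walk u w (suc k)

  Connected : Set
  Connected = ∀ u v → ∃ λ k → Walk u v k

  Cycle : Set
  Cycle = ∃₂ λ k (c : Fin (3 + k) → Fin n) →
    Injective _≡_ _≡_ c ×
    (∀ (i : Fin (2 + k)) → c (inject₁ i) ~ c (suc i)) ×
    c (fromℕ (2 + k)) ~ c zero

  IsTree : Set
  IsTree = Connected × ¬ Cycle

  Distance : Fin n → Fin n → ℕ → Set
  Distance u v = Least (Walk u v)

  Eccentricity : Fin n → ℕ → Set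
  Eccentricity u = Greatest λ d → ∃ λ v → Distance u v d

  Diameter : ℕ → Set
  Diameter = Greatest λ d → ∃₂ λ u v → Distance u v d

  Central : Fin n → Set
  Central u = ∃ λ e → Eccentricity u e × (∀ v {e′} → Eccentricity v e′ → e ≤ e′)

  CenterSize : ℕ → Set
  CenterSize z = ∃ λ (L₀ : Subset n) → (∀ v → v ∈ L₀ ⇔ Central v) × ∣ L₀ ∣ ≡ z

  Height : ℕ → Set
  Height h = ∃ λ D → Diameter D × ⌊ D /2⌋ ≡ h

  Level : ℕ → Fin n → Set
  Level i v = Least (λ d → ∃ λ u → Central u × Distance u v d) i

  LevelwiseRegular : Set
  LevelwiseRegular = ∀ {h} → Height h → ∀ {i} → i ≤ h →
    ∀ {u v} → Level i u → Level i v → degree u ≡ degree v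

  -- The graph is (up to isomorphism) the tree T^z_{m 0, ..., m (h-1)};
  -- the values m i with h ≤ i play no role.
  record IsLevelwiseRegularTree (z h : ℕ) (m : ℕ → ℕ) : Set where
    field
      isTree           : IsTree
      levelwiseRegular : LevelwiseRegular
      centerSize       : CenterSize z
      height           : Height h
      levelDegree      : ∀ {i} → i < h → ∀ {v} → Level i v → degree v ≡ m i

  -- Truncated subtraction is exact here: d ≤ D.
  IsRadioLabelling : (Fin n → ℕ) → Set
  IsRadioLabelling f = ∀ {D} → Diameter D → ∀ {u v d} → u ≢ v → Distance u v d →
    D + 1 ∸ d ≤ ∣ f u - f v ∣

  Span : (Fin n → ℕ) → ℕ → Set
  Span f = Greatest λ s → ∃₂ λ u v → s ≡ ∣ f u - f v ∣

  RadioNumber : ℕ → Set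
  RadioNumber = Least λ s → ∃ λ f → IsRadioLabelling f × Span f s

{-# OPTIONS --safe #-}
module Submission where

-- Let L v be the distance from v to the centre.  In a labelling f, put the vertices in the order of
-- their labels.  Neighbours u, v in this order satisfy |f u − f v| ≥ 2h + 1 − L u − L v, and summing
-- this gives the basic lower bound.  It is not attained: if y is a leaf between x and z, then two of
-- x, y, z lie on the same side of the centre, and unless x or z is central the two gaps at y exceed
-- their bounds by at least 1 (one central vertex) or 2 (two).  Every gap serves two leaves, so half
-- of the sum of these excesses over the leaves is lost, up to what happens at both ends and next to
-- the centre.
-- For the converse, alternate between the two sides, listing each side from the leaves upwards and
-- each level by mixed-radix codes whose least significant digit belongs to the branching closest to
-- the root.  Two vertices with last common ancestor at depth φ then have positions differing by a
-- multiple of the number of vertices at depth φ, which grows faster than φ; hence vertices on the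
-- same side whose distance is small are far apart in the list.

open import Data.Nat hiding (_≟_)
import Data.Nat as ℕ
open import Data.Nat.Divisibility using (_∣_; divides; ∣-refl; ∣-trans; m∣m*n; ∣m∣n⇒∣m+n; ∣m⇒∣m*n; _∣0)
open import Data.Nat.ListAction using (sum; product)
open import Data.Nat.ListAction.Properties using (sum-↭; sum-++; product-++)
open import Data.Nat.Properties hiding (_≟_)
open import Data.Nat.Tactic.RingSolver using (solve)
open import Data.Empty using (⊥; ⊥-elim)
open import Data.Fin using (Fin; toℕ; fromℕ; inject₁) renaming (zero to fzero; suc to fsuc)
open import Data.Fin.Properties using (_≟_; any?; toℕ<n; toℕ-injective; toℕ-fromℕ; toℕ-inject₁)
open import Data.Fin.Subset using (⁅_⁆; _∈_; ∣_∣) renaming (_-_ to _∖_)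
open import Data.Fin.Subset.Properties using (x∈⁅x⁆; x∈⁅y⁆⇒x≡y; p⊆q⇒∣p∣≤∣q∣; ∣⁅x⁆∣≡1; x∈p⇒∣p-x∣<∣p∣; x∈p∧x≢y⇒x∈p-y)
open import Data.Product hiding (map; swap)
open import Data.Sum using (_⊎_; inj₁; inj₂; swap)
open import Data.Unit using (⊤; tt)
open import Function using (_∘_; id)
open import Function.Bundles using (Equivalence)
open import Relation.Nullary
open import Relation.Nullary.Decidable using (_×-dec_; map′)
open import Relation.Unary using (Decidable)
open import Relation.Binary.Definitions using (tri<; tri≈; tri>)
open import Relation.Binary.PropositionalEquality hiding ([_])
import Relation.Binary.Construct.On as On

-- The two halves of the converse meet in one comparison. Two vertices of one side with last common
-- ancestor at depth φ are closer by 2φ than the sum of their depths, and every item listed between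
-- them raises the label by at least 2. So about φ items between them suffice, which is why it is
-- enough that widths outgrow depths.
--
-- The constants are decided at the ends of the order. A leaf next to a central vertex in the order
-- is exempt from the excess. With one centre, put first, a single leaf is exempt; the bound on
-- twice the span is then odd, and rounding up takes the saving back. With two centres, one at each
-- end, a leaf can be saved at either end, and the saving stays. Hence the order there begins with
-- `c₁`, `A₀` and ends with `B₀`, `c₀`: the leaf `B₀` is moved from the front of its side behind all
-- others, and the spacing of that side has to be controlled around a cycle.
--
-- The end corrections presuppose that the neighbours of the centre are not leaves. For `h = 1` they
-- are, and the tree is a path; with two centres, the bound without any excess takes over.

module Arithmetic where

  open import Data.List using ([]; _∷_)

  -- Linear arithmetic by certificate: the hypotheses add up to p ≤ q, s is the slack,
  -- and what remains is a semiring identity.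
  lin : ∀ {a b p q} s → p ≤ q → a + q + s ≡ b + p → a ≤ b
  lin {a} {b} {p} {q} s p≤q eq = +-cancelʳ-≤ q a b (begin
    a + q     ≤⟨ m≤m+n (a + q) s ⟩
    a + q + s ≡⟨ eq ⟩
    b + p     ≤⟨ +-monoʳ-≤ b p≤q ⟩
    b + q     ∎)
    where open ≤-Reasoning

  infixr 5 _⊕_
  _⊕_ : ∀ {a b c d} → a ≤ b → c ≤ d → a + c ≤ b + d
  _⊕_ = +-mono-≤

  -- Congruences between natural numbers, without subtraction

  Congruent : ℕ → ℕ → ℕ → Set
  Congruent m a b = ∃₂ λ x y → a + x * m ≡ b + y * m

  congruent-refl : ∀ {m} a → Congruent m a a
  congruent-refl a = 0 , 0 , refl

  congruent-sym : ∀ {m a b} → Congruent m a b → Congruent m b a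
  congruent-sym (x , y , eq) = y , x , sym eq

  congruent-trans : ∀ {m a b c} → Congruent m a b → Congruent m b c → Congruent m a c
  congruent-trans {m} {a} {b} {c} (x , y , eq) (x′ , y′ , eq′) = x + x′ , y + y′ , (begin
    a + (x + x′) * m       ≡⟨ solve (a ∷ x ∷ x′ ∷ m ∷ []) ⟩
    a + x * m + x′ * m     ≡⟨ cong (_+ x′ * m) eq ⟩
    b + y * m + x′ * m     ≡⟨ solve (b ∷ y ∷ x′ ∷ m ∷ []) ⟩
    b + x′ * m + y * m     ≡⟨ cong (_+ y * m) eq′ ⟩
    c + y′ * m + y * m     ≡⟨ solve (c ∷ y ∷ y′ ∷ m ∷ []) ⟩
    c + (y + y′) * m       ∎)
    where open ≡-Reasoning

  congruent-weaken : ∀ {m m′ a b} → m ∣ m′ → Congruent m′ a b → Congruent m a b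
  congruent-weaken {m} {_} {a} {b} (divides q refl) (x , y , eq) = x * q , y * q , (begin
    a + x * q * m   ≡⟨ cong (a +_) (*-assoc x q m) ⟩
    a + x * (q * m) ≡⟨ eq ⟩
    b + y * (q * m) ≡⟨ cong (b +_) (*-assoc y q m) ⟨
    b + y * q * m   ∎)
    where open ≡-Reasoning

  congruent-+ : ∀ {m a b e f} → Congruent m a b → m ∣ e → m ∣ f → Congruent m (e + a) (f + b)
  congruent-+ {m} {a} {b} (x , y , eq) (divides q refl) (divides q′ refl) = q′ + x , q + y , (begin
    q * m + a + (q′ + x) * m   ≡⟨ solve (a ∷ q ∷ q′ ∷ x ∷ m ∷ []) ⟩
    q * m + q′ * m + (a + x * m) ≡⟨ cong (q * m + q′ * m +_) eq ⟩
    q * m + q′ * m + (b + y * m) ≡⟨ solve (b ∷ q ∷ q′ ∷ y ∷ m ∷ []) ⟩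
    q′ * m + b + (q + y) * m   ∎)
    where open ≡-Reasoning

  -- If `x ≤ y`, the right side of the equation would be strictly larger; so `y < x`, and the
  -- surplus multiple on the left makes room for one `m`. This is how congruent positions in a list
  -- become distant ones.
  congruent-< : ∀ {m a b} → Congruent m a b → a < b → a + m ≤ b
  congruent-< {m} {a} {b} (x , y , eq) a<b with x ≤? y
  ... | yes x≤y = contradiction (<-≤-trans (+-mono-<-≤ a<b (*-monoˡ-≤ m x≤y)) (≤-reflexive (sym eq))) (<-irrefl refl)
  ... | no x≰y  = +-cancelʳ-≤ (y * m) (a + m) b (begin
    a + m + y * m   ≡⟨ +-assoc a m (y * m) ⟩
    a + suc y * m   ≤⟨ +-monoʳ-≤ a (*-monoˡ-≤ m (≰⇒> x≰y)) ⟩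
    a + x * m       ≡⟨ eq ⟩
    b + y * m       ∎)
    where open ≤-Reasoning

  -- Numerical inequalities for the lower bound and for the two labellings

  chain-base : ∀ {fx fy g lx ly λy κx κy} →
    fx + g ≤ fy + (lx + ly) →
    fx + fy + (2 * g + λy + 0) + (ly + κy) + (2 * ly + κy) ≤
    2 * fy + (4 * ly + 2 * κy + 0) + (lx + κx) + λy + g
  chain-base {fx} {fy} {g} {lx} {ly} {λy} {κx} {κy} pair =
    lin κx pair (solve (fx ∷ fy ∷ g ∷ lx ∷ ly ∷ λy ∷ κx ∷ κy ∷ []))

  chain-step : ∀ {fx fy fz fl g lx ly lz e s t λy κx κy κz r} →
    fx + 2 * g + λy ≤ fz + (lx + 2 * ly + lz) + κx + κz →
    fy + fz + s + (lz + κz) + e ≤ 2 * fl + t + (ly + κy) + r + g →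
    fx + fy + (2 * g + λy + s) + (ly + κy) + e ≤
    2 * fl + (4 * ly + 2 * κy + t) + (lx + κx) + r + g
  chain-step {fx} {fy} {fz} {fl} {g} {lx} {ly} {lz} {e} {s} {t} {λy} {κx} {κy} {κz} {r} triple ih =
    lin 0 (triple ⊕ ih)
      (solve (fx ∷ fy ∷ fz ∷ fl ∷ g ∷ lx ∷ ly ∷ lz ∷ e ∷ s ∷ t ∷ λy ∷ κx ∷ κy ∷ κz ∷ r ∷ []))

  chain-end : ∀ {f₀ f₁ fl w g l₀ l₁ ll s t λ₀ λl κ₀ κ₁ κl} →
    f₀ + g ≤ f₁ + (l₀ + l₁) → fl ≤ f₀ + w →
    f₀ + f₁ + s + (l₁ + κ₁) + (2 * ll + κl) ≤ 2 * fl + t + (l₀ + κ₀) + λl + g →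
    (2 * g + λ₀ + s) + (2 * l₀ + κ₀) + (2 * ll + κl) ≤
    2 * w + (4 * l₀ + 2 * κ₀ + t) + λ₀ + λl + 2 * g
  chain-end {f₀} {f₁} {fl} {w} {g} {l₀} {l₁} {ll} {s} {t} {λ₀} {λl} {κ₀} {κ₁} {κl} pair span chain =
    lin κ₁ (pair ⊕ span ⊕ span ⊕ chain)
      (solve (f₀ ∷ f₁ ∷ fl ∷ w ∷ g ∷ l₀ ∷ l₁ ∷ ll ∷ s ∷ t ∷ λ₀ ∷ λl ∷ κ₀ ∷ κ₁ ∷ κl ∷ []))

  linear-step : ∀ b b₁ w v →
    b + 2 * b₁ + w * (v + 2) ≡ b + w * v + 2 * (b₁ + w * 1)
  linear-step b b₁ w v = solve (b ∷ b₁ ∷ w ∷ v ∷ [])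

  gap-arith : ∀ {t p t′ p′ q m} → t + q ≤ t′ → p′ ≡ p + suc m → t + 2 * p + (q + 2) + 2 * m ≤ t′ + 2 * p′
  gap-arith {t} {p} {t′} {_} {q} {m} le refl = lin 0 le (solve (t ∷ p ∷ t′ ∷ q ∷ m ∷ []))

  triple-pairs : ∀ {fx fy fz g lx ly lz l κx κz} →
    fx + g ≤ fy + (lx + ly) → fy + g ≤ fz + (ly + lz) → l ≤ κx + κz →
    fx + 2 * g + l ≤ fz + (lx + 2 * ly + lz) + κx + κz
  triple-pairs {fx} {fy} {fz} {g} {lx} {ly} {lz} {l} {κx} {κz} p q r =
    lin 0 (p ⊕ q ⊕ r) (solve (fx ∷ fy ∷ fz ∷ g ∷ lx ∷ ly ∷ lz ∷ l ∷ κx ∷ κz ∷ []))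

  -- Here `δ` is the distance from x to z. As y is a leaf, `h ≤ ly`, the two basic gaps at y add up
  -- to at most `g + 1 - lx - lz` with `g = 2h + 1`, whereas closeness of x and z makes the direct
  -- gap between them at least `g + t + 2 - lx - lz`. The difference `t + 1` is the largest excess
  -- that can be claimed.
  triple-close-xz : ∀ {fx fz h t lx ly lz l κx κz δ} →
    fx + (h + h + 1 + t) ≤ fz + δ → δ + 2 ≤ lx + lz → l ≤ suc t → h ≤ ly →
    fx + 2 * (h + h + 1) + l ≤ fz + (lx + 2 * ly + lz) + κx + κz
  triple-close-xz {fx} {fz} {h} {t} {lx} {ly} {lz} {l} {κx} {κz} {δ} p q r s =
    lin (κx + κz) (p ⊕ q ⊕ r ⊕ s ⊕ s) (solve (fx ∷ fz ∷ h ∷ t ∷ lx ∷ ly ∷ lz ∷ l ∷ κx ∷ κz ∷ δ ∷ []))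

  triple-close-xy : ∀ {fx fy fz g t lx ly lz l κx κz δ} →
    fx + (g + t) ≤ fy + δ → δ + 2 ≤ lx + ly → fy + g ≤ fz + (ly + lz) → l ≤ suc t →
    fx + 2 * g + l ≤ fz + (lx + 2 * ly + lz) + κx + κz
  triple-close-xy {fx} {fy} {fz} {g} {t} {lx} {ly} {lz} {l} {κx} {κz} {δ} p q r s =
    lin (1 + κx + κz) (p ⊕ q ⊕ r ⊕ s) (solve (fx ∷ fy ∷ fz ∷ g ∷ t ∷ lx ∷ ly ∷ lz ∷ l ∷ κx ∷ κz ∷ δ ∷ []))

  triple-close-yz : ∀ {fx fy fz g t lx ly lz l κx κz δ} →
    fx + g ≤ fy + (lx + ly) → fy + (g + t) ≤ fz + δ → δ + 2 ≤ ly + lz → l ≤ suc t →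
    fx + 2 * g + l ≤ fz + (lx + 2 * ly + lz) + κx + κz
  triple-close-yz {fx} {fy} {fz} {g} {t} {lx} {ly} {lz} {l} {κx} {κz} {δ} p q r s =
    lin (1 + κx + κz) (p ⊕ q ⊕ r ⊕ s) (solve (fx ∷ fy ∷ fz ∷ g ∷ t ∷ lx ∷ ly ∷ lz ∷ l ∷ κx ∷ κz ∷ δ ∷ []))

  drop-slack : ∀ {a b e g t} → a + (g + t) ≤ b + e → ∀ {l} → e ≤ l + t → a + g ≤ b + l
  drop-slack {a} {b} {e} {g} {t} p {l} q = lin 0 (p ⊕ q) (solve (a ∷ b ∷ e ∷ g ∷ t ∷ l ∷ []))

  weight-split : ∀ l r x → 2 * (l + r + (l + r) + 1) + x ≡ 4 * l + (4 * r + x + 2)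
  weight-split l r x = solve (l ∷ r ∷ x ∷ [])

  cancel-levels : ∀ {a b x y z c s u v} → a + b + x + y ≤ 2 * s + (a + c) + u + v + z → b + x + y ≤ 2 * s + c + u + v + z
  cancel-levels {a} {b} {x} {y} {z} {c} {s} {u} {v} p = lin 0 p (solve (a ∷ b ∷ x ∷ y ∷ z ∷ c ∷ s ∷ u ∷ v ∷ []))

  -- Label difference plus distance come to at least `2H + 2 + 2 ju + l + 2 (m - φ)`, and `2H + 3`
  -- is required. For two leaves the missing unit is the excess `l` already spent between opposite
  -- leaves.
  same-side-A : ∀ {H ju jv l Tu Tv du dv d m φ} →
    Tu + (4 * ju + l + 2) + 2 * m ≤ Tv → du + dv ≤ d + 2 * φ → φ ≤ m →
    H ≤ du + ju → H ≤ dv + jv → 1 ≤ 2 * ju + l →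
    H + 2 + ju + Tu + (suc H + suc H + 1) ≤ H + 2 + jv + Tv + d
  same-side-A {H} {ju} {jv} {l} {Tu} {Tv} {du} {dv} {d} {m} {φ} p q r s t w =
    lin 0 (p ⊕ q ⊕ r ⊕ r ⊕ s ⊕ t ⊕ w)
      (solve (H ∷ ju ∷ jv ∷ l ∷ Tu ∷ Tv ∷ du ∷ dv ∷ d ∷ m ∷ φ ∷ []))

  same-side-B : ∀ {H ju jv lu lv Tu Tv du dv d m φ} →
    Tu + (4 * ju + lu + 2) + 2 * m ≤ Tv → du + dv ≤ d + 2 * φ → φ ≤ m →
    H ≤ du + ju → H ≤ dv + jv → 1 ≤ 2 * jv + lv →
    H + 3 + 3 * ju + lu + Tu + (suc H + suc H + 1) ≤ H + 3 + 3 * jv + lv + Tv + d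
  same-side-B {H} {ju} {jv} {lu} {lv} {Tu} {Tv} {du} {dv} {d} {m} {φ} p q r s t w =
    lin 0 (p ⊕ q ⊕ r ⊕ r ⊕ s ⊕ t ⊕ w)
      (solve (H ∷ ju ∷ jv ∷ lu ∷ lv ∷ Tu ∷ Tv ∷ du ∷ dv ∷ d ∷ m ∷ φ ∷ []))

  opposite-equal : ∀ {H j l T du dv} → H ≤ du + j → H ≤ dv + j →
    H + 2 + j + T + (suc H + suc H + 1) ≤ H + 3 + 3 * j + l + T + (du + suc (suc dv))
  opposite-equal {H} {j} {l} {T} {du} {dv} p q = lin l (p ⊕ q) (solve (H ∷ j ∷ l ∷ T ∷ du ∷ dv ∷ []))

  opposite-before : ∀ {H ju jv lu lv Tu Tv du dv} → Tu + (4 * ju + lu + 2) ≤ Tv →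
    H ≤ du + ju → H ≤ dv + jv →
    H + 2 + ju + Tu + (suc H + suc H + 1) ≤ H + 3 + 3 * jv + lv + Tv + (du + suc (suc dv))
  opposite-before {H} {ju} {jv} {lu} {lv} {Tu} {Tv} {du} {dv} p q r =
    lin (2 + 2 * ju + 2 * jv + lu + lv) (p ⊕ q ⊕ r) (solve (H ∷ ju ∷ jv ∷ lu ∷ lv ∷ Tu ∷ Tv ∷ du ∷ dv ∷ []))

  opposite-after : ∀ {H ju jv lv Tu Tv du dv} → Tv + (4 * jv + lv + 2) ≤ Tu →
    H ≤ du + ju → H ≤ dv + jv →
    H + 3 + 3 * jv + lv + Tv + (suc H + suc H + 1) ≤ H + 2 + ju + Tu + (du + suc (suc dv))
  opposite-after {H} {ju} {jv} {lv} {Tu} {Tv} {du} {dv} p q r =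
    lin 0 (p ⊕ q ⊕ r) (solve (H ∷ ju ∷ jv ∷ lv ∷ Tu ∷ Tv ∷ du ∷ dv ∷ []))

  centre-A : ∀ {H j T du} → H ≤ du + j → suc H + suc H + 1 ≤ H + 2 + j + T + suc du
  centre-A {H} {j} {T} {du} p = lin T p (solve (H ∷ j ∷ T ∷ du ∷ []))

  A≤B : ∀ {H j l T} → H + 2 + j + T ≤ H + 3 + 3 * j + l + T
  A≤B {H} {j} {l} {T} = lin (1 + 2 * j + l) (z≤n {0}) (solve (H ∷ j ∷ l ∷ T ∷ []))

  top-root : ∀ {H j l T R} → T + (4 * j + l + 2) ≤ R → H ≤ j → H + 3 + 3 * j + l + T ≤ 1 + R
  top-root {H} {j} {l} {T} {R} p q = lin 0 (p ⊕ q) (solve (H ∷ j ∷ l ∷ T ∷ R ∷ []))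

  top-other : ∀ {H j l x T R′ R} → T + (4 * j + l + 2) ≤ R′ → R′ + (4 * H + x + 2) ≤ R →
    H + 3 + 3 * j + l + T ≤ 1 + R
  top-other {H} {j} {l} {x} {T} {R′} {R} p q = lin (j + 3 * H + x + 2) (p ⊕ q)
    (solve (H ∷ j ∷ l ∷ x ∷ T ∷ R′ ∷ R ∷ []))

  span-one : ∀ {H R s λx λz ex ez} →
    (4 * suc H + 0 + 2) + (R + R) + ex + ez ≤ 2 * s + 2 + λx + λz + 2 * (suc H + suc H + 1) →
    λx + λz + 3 ≤ ex + ez → suc (2 * R) ≤ 2 * s
  span-one {H} {R} {s} {λx} {λz} {ex} {ez} p q =
    lin 0 (p ⊕ q) (solve (H ∷ R ∷ s ∷ λx ∷ λz ∷ ex ∷ ez ∷ []))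

  add-ends : ∀ {a b x y} → a + 2 ≤ x → b + 1 ≤ y → a + b + 3 ≤ x + y
  add-ends {a} {b} {x} {y} p q = lin 0 (p ⊕ q) (solve (a ∷ b ∷ x ∷ y ∷ []))

  add-ends′ : ∀ {a b x y} → a + 1 ≤ x → b + 2 ≤ y → a + b + 3 ≤ x + y
  add-ends′ {a} {b} {x} {y} p q = lin 0 (p ⊕ q) (solve (a ∷ b ∷ x ∷ y ∷ []))

  -- The root of a half has only one child here, so widths lag one level behind and only `φ ≤ suc m`
  -- is available. The 2 lost thereby comes from the excess at leaves or from a positive height:
  -- `2 ≤ 2 * jv + lv`.
  edge-same-A : ∀ {H ju jv lu lv Tu Tv du dv d m φ} →
    Tu + (4 * ju + lu + 2) + 2 * m ≤ Tv → du + dv ≤ d + 2 * φ → φ ≤ suc m →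
    suc H ≤ du + ju → suc H ≤ dv + jv → 2 ≤ 2 * jv + lv →
    H + 3 * ju + lu + Tu + (suc H + suc H + 1 + 1) ≤ H + 3 * jv + lv + Tv + d
  edge-same-A {H} {ju} {jv} {lu} {lv} {Tu} {Tv} {du} {dv} {d} {m} {φ} p q r s t w =
    lin 0 (p ⊕ q ⊕ r ⊕ r ⊕ s ⊕ t ⊕ w)
      (solve (H ∷ ju ∷ jv ∷ lu ∷ lv ∷ Tu ∷ Tv ∷ du ∷ dv ∷ d ∷ m ∷ φ ∷ []))

  edge-same-B : ∀ {H ju jv lu Tu Tv du dv d m φ bu bv} →
    suc bu ≡ H + ju + Tu → suc bv ≡ H + jv + Tv →
    Tu + (4 * ju + lu + 2) + 2 * m ≤ Tv → du + dv ≤ d + 2 * φ → φ ≤ suc m →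
    suc H ≤ du + ju → suc H ≤ dv + jv → 2 ≤ 2 * ju + lu →
    bu + (suc H + suc H + 1 + 1) ≤ bv + d
  edge-same-B {H} {ju} {jv} {lu} {Tu} {Tv} {du} {dv} {d} {m} {φ} {bu} {bv} eu ev p q r s t w =
    lin 0 (≤-reflexive eu ⊕ ≤-reflexive (sym ev) ⊕ p ⊕ q ⊕ r ⊕ r ⊕ s ⊕ t ⊕ w)
      (solve (H ∷ ju ∷ jv ∷ lu ∷ Tu ∷ Tv ∷ du ∷ dv ∷ d ∷ m ∷ φ ∷ bu ∷ bv ∷ []))

  edge-opposite-before : ∀ {H ju jv lu Tu Tv du dv b} → suc b ≡ H + jv + Tv →
    Tu + (4 * ju + lu + 2) ≤ Tv → suc H ≤ du + ju → suc H ≤ dv + jv →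
    H + 3 * ju + lu + Tu + (suc H + suc H + 1 + 1) ≤ b + (du + suc dv)
  edge-opposite-before {H} {ju} {jv} {lu} {Tu} {Tv} {du} {dv} {b} e p q r =
    lin 0 (≤-reflexive (sym e) ⊕ p ⊕ q ⊕ r) (solve (H ∷ ju ∷ jv ∷ lu ∷ Tu ∷ Tv ∷ du ∷ dv ∷ b ∷ []))

  edge-opposite-equal : ∀ {H j l T du dv b} → suc b ≡ H + j + T →
    suc H ≤ du + j → suc H ≤ dv + j →
    b + (suc H + suc H + 1 + 1) ≤ H + 3 * j + l + T + (du + suc dv)
  edge-opposite-equal {H} {j} {l} {T} {du} {dv} {b} e q r =
    lin l (≤-reflexive e ⊕ q ⊕ r) (solve (H ∷ j ∷ l ∷ T ∷ du ∷ dv ∷ b ∷ []))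

  edge-opposite-after : ∀ {H ju jv lu lv Tu Tv du dv b} → suc b ≡ H + jv + Tv →
    Tv + (4 * jv + lv + 2) ≤ Tu → suc H ≤ du + ju → suc H ≤ dv + jv →
    b + (suc H + suc H + 1 + 1) ≤ H + 3 * ju + lu + Tu + (du + suc dv)
  edge-opposite-after {H} {ju} {jv} {lu} {lv} {Tu} {Tv} {du} {dv} {b} e p q r =
    lin (2 + 2 * ju + 2 * jv + lu + lv) (≤-reflexive e ⊕ p ⊕ q ⊕ r) (solve (H ∷ ju ∷ jv ∷ lu ∷ lv ∷ Tu ∷ Tv ∷ du ∷ dv ∷ b ∷ []))

  rootA-A : ∀ {H j l T du R} → T + (4 * j + l + 2) ≤ R → suc H ≤ du + j →
    H + 3 * j + l + T + (suc H + suc H + 1 + 1) ≤ 2 * H + 1 + R + du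
  rootA-A {H} {j} {l} {T} {du} {R} p q = lin 0 (p ⊕ q) (solve (H ∷ j ∷ l ∷ T ∷ du ∷ R ∷ []))

  rootB-B : ∀ {H j T dv b} → suc b ≡ H + j + T → 4 ≤ T → suc H ≤ dv + j →
    suc H + suc H + 1 + 1 ≤ b + dv
  rootB-B {H} {j} {T} {dv} {b} e p q = lin 0 (≤-reflexive (sym e) ⊕ p ⊕ q) (solve (H ∷ j ∷ T ∷ dv ∷ b ∷ []))

  rootA-B : ∀ {H j T dv b R} → suc b ≡ H + j + T → 2 * j + T ≤ R → suc H ≤ dv + j →
    b + (suc H + suc H + 1 + 1) ≤ 2 * H + 1 + R + suc dv
  rootA-B {H} {j} {T} {dv} {b} {R} e p q = lin 0 (≤-reflexive e ⊕ p ⊕ q) (solve (H ∷ j ∷ T ∷ dv ∷ b ∷ R ∷ []))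

  rootB-A : ∀ {H j l T du} → 2 ≤ 2 * j + l → suc H ≤ du + j →
    suc H + suc H + 1 + 1 ≤ H + 3 * j + l + T + suc du
  rootB-A {H} {j} {l} {T} {du} p q = lin T (p ⊕ q) (solve (H ∷ j ∷ l ∷ T ∷ du ∷ []))

  rootA-rootB : ∀ {H R} → 4 ≤ R → suc H + suc H + 1 + 1 ≤ 2 * H + 1 + R + 1
  rootA-rootB {H} {R} p = lin 2 p (solve (H ∷ R ∷ []))

  edge-top-A : ∀ {H j l T R} → T + (4 * j + l + 2) ≤ R → H + 3 * j + l + T ≤ 2 * H + 1 + R
  edge-top-A {H} {j} {l} {T} {R} p = lin (H + j + 3) p (solve (H ∷ j ∷ l ∷ T ∷ R ∷ []))

  edge-top-B : ∀ {H j T b R} → suc b ≡ H + j + T → 2 * j + T ≤ R → b ≤ 2 * H + 1 + R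
  edge-top-B {H} {j} {T} {b} {R} e p = lin (2 + H + j) (≤-reflexive e ⊕ p) (solve (H ∷ j ∷ T ∷ b ∷ R ∷ []))

  span-two : ∀ {H R s λx λz ex ez} →
    (R + (4 * suc H + 0 + 2)) + (R + (4 * suc H + 0 + 2)) + ex + ez ≤ 2 * s + 2 * (2 + 2) + λx + λz + 2 * (suc H + suc H + 1) →
    λx + 2 ≤ ex → λz + 2 ≤ ez → 2 * (2 * H + 1 + R) ≤ 2 * s
  span-two {H} {R} {s} {λx} {λz} {ex} {ez} p q r =
    lin 0 (p ⊕ q ⊕ r) (solve (H ∷ R ∷ s ∷ λx ∷ λz ∷ ex ∷ ez ∷ []))

  span-path : ∀ {s ex ez} → 8 + 8 + ex + ez ≤ 2 * s + 0 + 0 + 0 + 6 → 2 * 5 ≤ 2 * s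
  span-path {s} {ex} {ez} p = lin (ex + ez) p (solve (s ∷ ex ∷ ez ∷ []))

  split-weight : ∀ w j x → w * (4 * j + x + 2) ≡ w * (4 * j + 2) + w * x
  split-weight w j x = solve (w ∷ j ∷ x ∷ [])

  total-one : ∀ s p H → s + p + 4 * suc H ≡ 1 + (1 + (s + 1 * p + (4 * H + 2)))
  total-one s p H = solve (s ∷ p ∷ H ∷ [])

  total-two : ∀ s p H → s + 2 * p + 6 * suc H ≡ 3 + (2 * H + 1 + (s + 2 * p + (4 * H + 2)))
  total-two s p H = solve (s ∷ p ∷ H ∷ [])

open Arithmetic

open import Defs
open import Data.List using (List; []; _∷_; [_]; _++_; map; filter; length; allFin; applyUpTo)
open import Data.List.Properties using (length-tabulate; applyUpTo-∷ʳ; map-++)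
open import Data.List.Membership.Propositional using () renaming (_∈_ to _∈ˡ_)
open import Data.List.Membership.Propositional.Properties using (∈-allFin; ∈-filter⁺; ∈-filter⁻)
import Data.List.Membership.Setoid.Properties as Membership
open import Data.List.Relation.Unary.All using (All; []; _∷_)
import Data.List.Relation.Unary.All as All
open import Data.List.Relation.Unary.AllPairs using ([]; _∷_)
open import Data.List.Relation.Unary.Any using (here; there; index) renaming (any? to anyˡ?)
open import Data.List.Relation.Unary.Linked using (Linked; []; _∷_)
open import Data.List.Relation.Unary.Unique.Propositional using (Unique)
open import Data.List.Relation.Unary.Unique.Propositional.Properties using (allFin⁺; filter⁺)
open import Data.List.Relation.Binary.Permutation.Propositional using (_↭_; ↭⇒↭ₛ; ↭-sym)
open import Data.List.Relation.Binary.Permutation.Propositional.Properties using (map⁺; ↭-length)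
import Data.List.Relation.Binary.Permutation.Setoid.Properties as Permutation
import Data.List.Sort as Sort

-- Finite sums

𝟙 : ∀ {P : Set} → Dec P → ℕ
𝟙 (yes _) = 1
𝟙 (no _)  = 0

𝟙-yes : ∀ {P : Set} (P? : Dec P) → P → 𝟙 P? ≡ 1
𝟙-yes (yes _) p = refl
𝟙-yes (no ¬p) p = contradiction p ¬p

𝟙-no : ∀ {P : Set} (P? : Dec P) → ¬ P → 𝟙 P? ≡ 0
𝟙-no (yes p) ¬p = contradiction p ¬p
𝟙-no (no _)  _  = refl

module _ {A : Set} where

  sumOver : List A → (A → ℕ) → ℕ
  sumOver []       f = 0
  sumOver (x ∷ xs) f = f x + sumOver xs f

  sumOver≡sum : ∀ xs f → sumOver xs f ≡ sum (map f xs)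
  sumOver≡sum []       f = refl
  sumOver≡sum (x ∷ xs) f = cong (f x +_) (sumOver≡sum xs f)

  sumOver-↭ : ∀ {xs ys} f → xs ↭ ys → sumOver xs f ≡ sumOver ys f
  sumOver-↭ {xs} {ys} f p = trans (sumOver≡sum xs f) (trans (sum-↭ (map⁺ f p)) (sym (sumOver≡sum ys f)))

  sumOver-cong : ∀ xs {f g} → (∀ x → f x ≡ g x) → sumOver xs f ≡ sumOver xs g
  sumOver-cong []       eq = refl
  sumOver-cong (x ∷ xs) eq = cong₂ _+_ (eq x) (sumOver-cong xs eq)

  sumOver-+ : ∀ xs f g → sumOver xs (λ x → f x + g x) ≡ sumOver xs f + sumOver xs g
  sumOver-+ []       f g = refl
  sumOver-+ (x ∷ xs) f g = begin
    f x + g x + sumOver xs (λ y → f y + g y)    ≡⟨ cong (f x + g x +_) (sumOver-+ xs f g) ⟩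
    f x + g x + (sumOver xs f + sumOver xs g)   ≡⟨ +-assoc (f x) (g x) _ ⟩
    f x + (g x + (sumOver xs f + sumOver xs g)) ≡⟨ cong (f x +_) (x∙yz≈y∙xz (g x) (sumOver xs f) _) ⟩
    f x + (sumOver xs f + (g x + sumOver xs g)) ≡⟨ +-assoc (f x) (sumOver xs f) _ ⟨
    f x + sumOver xs f + (g x + sumOver xs g)   ∎
    where
      open ≡-Reasoning
      open import Algebra.Properties.CommutativeSemigroup +-commutativeSemigroup using (x∙yz≈y∙xz)

  sumOver-*ʳ : ∀ xs f k → sumOver xs (λ x → f x * k) ≡ sumOver xs f * k
  sumOver-*ʳ []       f k = refl
  sumOver-*ʳ (x ∷ xs) f k = trans (cong (f x * k +_) (sumOver-*ʳ xs f k)) (sym (*-distribʳ-+ k (f x) _))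

  sumOver-*ˡ : ∀ xs k f → sumOver xs (λ x → k * f x) ≡ k * sumOver xs f
  sumOver-*ˡ xs k f = trans (sumOver-cong xs (λ x → *-comm k (f x))) (trans (sumOver-*ʳ xs f k) (*-comm _ k))

  sumOver-0 : ∀ xs → sumOver xs (λ _ → 0) ≡ 0
  sumOver-0 []       = refl
  sumOver-0 (_ ∷ xs) = sumOver-0 xs

  length-filter : ∀ {P : A → Set} (P? : Decidable P) xs → length (filter P? xs) ≡ sumOver xs (𝟙 ∘ P?)
  length-filter P? []       = refl
  length-filter P? (x ∷ xs) with P? x
  ... | yes _ = cong suc (length-filter P? xs)
  ... | no _  = length-filter P? xs

sumOver-swap : ∀ {A B : Set} (xs : List A) (ys : List B) (f : A → B → ℕ) →
  sumOver xs (λ x → sumOver ys (f x)) ≡ sumOver ys (λ y → sumOver xs (λ x → f x y))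
sumOver-swap []       ys f = sym (sumOver-0 ys)
sumOver-swap (x ∷ xs) ys f = trans (cong (sumOver ys (f x) +_) (sumOver-swap xs ys f)) (sym (sumOver-+ ys _ _))

module _ {n : ℕ} where

  sumOver-∉ : ∀ q (xs : List (Fin n)) → All (q ≢_) xs → sumOver xs (λ x → 𝟙 (x ≟ q)) ≡ 0
  sumOver-∉ q []       _          = refl
  sumOver-∉ q (x ∷ xs) (q≢x ∷ ps) = cong₂ _+_ (𝟙-no (x ≟ q) (q≢x ∘ sym)) (sumOver-∉ q xs ps)

  sumOver-∈ : ∀ q {xs : List (Fin n)} → Unique xs → q ∈ˡ xs → sumOver xs (λ x → 𝟙 (x ≟ q)) ≡ 1
  sumOver-∈ q {x ∷ xs} (x∉ ∷ u) (here refl) = cong₂ _+_ (𝟙-yes (x ≟ x) refl) (sumOver-∉ q xs x∉)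
  sumOver-∈ q {x ∷ xs} (x∉ ∷ u) (there q∈) =
    cong₂ _+_ (𝟙-no (x ≟ q) (All.lookup x∉ q∈)) (sumOver-∈ q u q∈)

  ∑ : (Fin n → ℕ) → ℕ
  ∑ = sumOver (allFin n)

  ∑-single : ∀ q → ∑ (λ x → 𝟙 (x ≟ q)) ≡ 1
  ∑-single q = sumOver-∈ q (allFin⁺ n) (∈-allFin q)

  ∑-single-* : ∀ q (g : Fin n → ℕ) → ∑ (λ x → 𝟙 (x ≟ q) * g x) ≡ g q
  ∑-single-* q g = begin
    ∑ (λ x → 𝟙 (x ≟ q) * g x) ≡⟨ sumOver-cong (allFin n) pointwise ⟩
    ∑ (λ x → 𝟙 (x ≟ q) * g q) ≡⟨ sumOver-*ʳ (allFin n) _ (g q) ⟩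
    ∑ (λ x → 𝟙 (x ≟ q)) * g q ≡⟨ cong (_* g q) (∑-single q) ⟩
    1 * g q                   ≡⟨ *-identityˡ (g q) ⟩
    g q                       ∎
    where
      open ≡-Reasoning
      pointwise : ∀ x → 𝟙 (x ≟ q) * g x ≡ 𝟙 (x ≟ q) * g q
      pointwise x with x ≟ q
      ... | yes refl = refl
      ... | no _     = refl

below : ℕ → (ℕ → ℕ) → ℕ
below zero    f = 0
below (suc k) f = below k f + f k

below-cong : ∀ k {f g} → (∀ i → i < k → f i ≡ g i) → below k f ≡ below k g
below-cong zero    eq = refl
below-cong (suc k) eq = cong₂ _+_ (below-cong k λ i i<k → eq i (m≤n⇒m≤1+n i<k)) (eq k ≤-refl)

below-mono : ∀ {j k} f → j ≤ k → below j f ≤ below k f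
below-mono {zero}  f _ = z≤n
below-mono {suc j} {suc k} f (s≤s j≤k) with m≤n⇒m<n∨m≡n j≤k
... | inj₁ j<k = ≤-trans (below-mono f j<k) (m≤m+n _ (f k))
... | inj₂ refl = ≤-refl

below-swap : ∀ {A : Set} (xs : List A) k (f : A → ℕ → ℕ) →
  sumOver xs (λ x → below k (f x)) ≡ below k (λ i → sumOver xs (λ x → f x i))
below-swap xs zero    f = sumOver-0 xs
below-swap xs (suc k) f = trans (sumOver-+ xs _ _) (cong (_+ sumOver xs (λ x → f x k)) (below-swap xs k f))

below-0 : ∀ k {f} → (∀ i → i < k → f i ≡ 0) → below k f ≡ 0
below-0 zero    eq = refl
below-0 (suc k) eq = cong₂ _+_ (below-0 k λ i i<k → eq i (m≤n⇒m≤1+n i<k)) (eq k ≤-refl)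

below-single : ∀ k {f} j → j < k → (∀ i → i < k → i ≢ j → f i ≡ 0) → below k f ≡ f j
below-single (suc k) {f} j j<1+k eq with j ℕ.≟ k
... | yes refl = cong (_+ f k) (below-0 k λ i i<k → eq i (m≤n⇒m≤1+n i<k) (<⇒≢ i<k))
... | no j≢k = trans
  (cong₂ _+_ (below-single k j (≤∧≢⇒< (≤-pred j<1+k) j≢k) λ i i<k → eq i (m≤n⇒m≤1+n i<k)) (eq k ≤-refl (j≢k ∘ sym)))
  (+-identityʳ _)

-- Walks and distances

least : ∀ {P : ℕ → Set} → Decidable P → ∀ k → P k → ∃ (Least P)
least P? k pk with P? 0
... | yes p0 = 0 , p0 , λ _ → z≤n
least P? zero pk    | no ¬p0 = contradiction pk ¬p0
least {P} P? (suc k) pk | no ¬p0 with least {P ∘ suc} (P? ∘ suc) k pk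
... | m , pm , min = suc m , pm , λ { {zero} p → contradiction p ¬p0 ; {suc j} p → s≤s (min p) }

module Walks {n : ℕ} (G : Graph n) where
  open Graph G

  walk? : ∀ u v k → Dec (Walk G u v k)
  walk? u v zero with u ≟ v
  ... | yes refl = yes []
  ... | no u≢v   = no λ { [] → u≢v refl }
  walk? u v (suc k) = map′ (λ { (_ , e , w) → e ∷ w }) (λ { (e ∷ w) → _ , e , w })
    (any? λ x → (u ~? x) ×-dec walk? x v k)

  _++ʷ_ : ∀ {u v w k l} → Walk G u v k → Walk G v w l → Walk G u w (k + l)
  []      ++ʷ q = q
  (e ∷ p) ++ʷ q = e ∷ (p ++ʷ q)

  snoc : ∀ {u v w k} → Walk G u v k → v ~ w → Walk G u w (suc k)
  snoc []      e = e ∷ []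
  snoc (f ∷ p) e = f ∷ snoc p e

  reverse : ∀ {u v k} → Walk G u v k → Walk G v u k
  reverse []      = []
  reverse (e ∷ p) = snoc (reverse p) (~-sym e)

  vertex : ∀ {u v k} → Walk G u v k → ℕ → Fin n
  vertex {u} _       zero    = u
  vertex {u} []      (suc i) = u
  vertex     (_ ∷ p) (suc i) = vertex p i

  vertex-last : ∀ {u v k} (p : Walk G u v k) → vertex p k ≡ v
  vertex-last []      = refl
  vertex-last (_ ∷ p) = vertex-last p

  vertex-~ : ∀ {u v k} (p : Walk G u v k) {i} → i < k → vertex p i ~ vertex p (suc i)
  vertex-~ (e ∷ [])    {zero}  _         = e
  vertex-~ (e ∷ (_ ∷ _)) {zero}  _         = e
  vertex-~ (_ ∷ p)     {suc i} (s≤s i<k) = vertex-~ p i<k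

  NonBacktracking : ∀ {u v k} → Walk G u v k → Set
  NonBacktracking []                          = ⊤
  NonBacktracking (_ ∷ [])                    = ⊤
  NonBacktracking (_∷_ {u} _ (_∷_ {_} {w} e p)) = u ≢ w × NonBacktracking (e ∷ p)

  nb-tail : ∀ {u x v k} (e : u ~ x) (p : Walk G x v k) → NonBacktracking (e ∷ p) → NonBacktracking p
  nb-tail e []      _        = tt
  nb-tail e (_ ∷ _) (_ , nb) = nb

  vertex-nb : ∀ {u v k} (p : Walk G u v k) → NonBacktracking p →
    ∀ i → 2 + i ≤ k → vertex p i ≢ vertex p (2 + i)
  vertex-nb (_ ∷ (_ ∷ []))    (u≢w , _) zero    _         = u≢w
  vertex-nb (_ ∷ (_ ∷ (_ ∷ _))) (u≢w , _) zero    _         = u≢w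
  vertex-nb (_ ∷ p)         nb        (suc i) (s≤s 2+i≤k) = vertex-nb p (nb-tail _ p nb) i 2+i≤k

  module _ (x : ℕ → Fin n) (ℓ : ℕ)
    (adj : ∀ {i} → i < ℓ → x i ~ x (suc i))
    (nb  : ∀ i → 2 + i ≤ ℓ → x i ≢ x (2 + i)) where

    private
      Repeat : ℕ → ℕ → Set
      Repeat i g = ∃₂ λ (a b : Fin g) → toℕ a < toℕ b × x (i + toℕ a) ≡ x (i + toℕ b)

      repeat? : ∀ i g → Dec (Repeat i g)
      repeat? i g = any? λ a → any? λ b → (toℕ a <? toℕ b) ×-dec (x (i + toℕ a) ≟ x (i + toℕ b))

      injective : ∀ i g → ¬ Repeat i g → ∀ {a b : Fin g} → x (i + toℕ a) ≡ x (i + toℕ b) → a ≡ b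
      injective i g ¬rep {a} {b} eq with <-cmp (toℕ a) (toℕ b)
      ... | tri< a<b _ _ = contradiction (a , b , a<b , eq) ¬rep
      ... | tri≈ _ a≡b _ = toℕ-injective a≡b
      ... | tri> _ _ b<a = contradiction (b , a , b<a , sym eq) ¬rep

    -- A shortest segment between two equal vertices is a cycle.
    closed⇒Cycle : ∀ bound i g → g ≤ bound → 0 < g → i + g ≤ ℓ → x i ≡ x (i + g) → Cycle G
    closed⇒Cycle zero i (suc g) () _ _ _
    closed⇒Cycle (suc bound) i g g≤ 0<g i+g≤ℓ eq with repeat? i g
    ... | yes (a , b , a<b , eq′) =
      closed⇒Cycle bound (i + toℕ a) (toℕ b ∸ toℕ a)
        (≤-trans (m∸n≤m (toℕ b) (toℕ a)) (≤-pred (≤-trans (toℕ<n b) g≤)))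
        (m<n⇒0<n∸m a<b)
        (subst (_≤ ℓ) (sym shift) (≤-trans (+-monoʳ-≤ i (<⇒≤ (toℕ<n b))) i+g≤ℓ))
        (trans eq′ (cong x (sym shift)))
      where
        shift : i + toℕ a + (toℕ b ∸ toℕ a) ≡ i + toℕ b
        shift = trans (+-assoc i _ _) (cong (i +_) (m+[n∸m]≡n (<⇒≤ a<b)))
    closed⇒Cycle (suc bound) i (suc zero) _ _ i+1≤ℓ eq | no _ =
      ⊥-elim (~-irrefl (trans eq (cong x (+-comm i 1))) (adj (subst (_≤ ℓ) (+-comm i 1) i+1≤ℓ)))
    closed⇒Cycle (suc bound) i (suc (suc zero)) _ _ i+2≤ℓ eq | no _ =
      ⊥-elim (nb i (subst (_≤ ℓ) (+-comm i 2) i+2≤ℓ) (trans eq (cong x (+-comm i 2))))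
    closed⇒Cycle (suc bound) i (suc (suc (suc k))) _ _ i+g≤ℓ eq | no ¬rep =
      k , (λ t → x (i + toℕ t)) , injective i _ ¬rep , step , close
      where
        inside : ∀ {t} → t < 3 + k → i + t < ℓ
        inside t< = ≤-trans (+-monoʳ-< i t<) i+g≤ℓ
        step : ∀ (t : Fin (2 + k)) → x (i + toℕ (inject₁ t)) ~ x (i + toℕ (fsuc t))
        step t rewrite toℕ-inject₁ t | +-suc i (toℕ t) = adj (inside (m≤n⇒m≤1+n (toℕ<n t)))
        close : x (i + toℕ (fromℕ (2 + k))) ~ x (i + 0)
        close rewrite toℕ-fromℕ k =
          subst (x (i + (2 + k)) ~_)
            (trans (cong x (sym (+-suc i (2 + k)))) (trans (sym eq) (cong x (sym (+-identityʳ i)))))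
            (adj (inside ≤-refl))

  nbClosedWalk⇒Cycle : ∀ {u k} (p : Walk G u u (suc k)) → NonBacktracking p → Cycle G
  nbClosedWalk⇒Cycle p nb = closed⇒Cycle (vertex p) _ (vertex-~ p) (vertex-nb p nb)
    _ 0 _ ≤-refl (s≤s z≤n) ≤-refl (sym (vertex-last p))

module Metric {n : ℕ} (G : Graph n) (connected : Connected G) where
  open Graph G
  open Walks G

  private
    distance : ∀ u v → ∃ (Distance G u v)
    distance u v = least (walk? u v) _ (proj₂ (connected u v))

  abstract
    d : Fin n → Fin n → ℕ
    d u v = proj₁ (distance u v)

    d-Distance : ∀ u v → Distance G u v (d u v)
    d-Distance u v = proj₂ (distance u v)

  d-walk : ∀ u v → Walk G u v (d u v)
  d-walk u v = proj₁ (d-Distance u v)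

  d-min : ∀ {u v k} → Walk G u v k → d u v ≤ k
  d-min {u} {v} = proj₂ (d-Distance u v)

  Distance⇒≡d : ∀ {u v k} → Distance G u v k → k ≡ d u v
  Distance⇒≡d (w , min) = ≤-antisym (min (d-walk _ _)) (d-min w)

  d-refl : ∀ u → d u u ≡ 0
  d-refl u = n≤0⇒n≡0 (d-min [])

  d-sym : ∀ u v → d u v ≡ d v u
  d-sym u v = ≤-antisym (d-min (reverse (d-walk v u))) (d-min (reverse (d-walk u v)))

  d-triangle : ∀ u v w → d u w ≤ d u v + d v w
  d-triangle u v w = d-min (d-walk u v ++ʷ d-walk v w)

  d≡0⇒≡ : ∀ {u v} → d u v ≡ 0 → u ≡ v
  d≡0⇒≡ {u} {v} eq with d u v | d-walk u v
  d≡0⇒≡ refl | .0 | [] = refl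

  d-~ : ∀ {u v} r → u ~ v → d u r ≤ suc (d v r)
  d-~ {u} {v} r e = d-min (e ∷ d-walk v r)

  ~⇒d≡1 : ∀ {u v} → u ~ v → d u v ≡ 1
  ~⇒d≡1 {u} {v} e = ≤-antisym (d-min (e ∷ [])) (n≢0⇒n>0 λ eq → ~-irrefl (d≡0⇒≡ eq) e)

  step : ∀ {u r} → u ≢ r → ∃ λ v → u ~ v × d u r ≡ suc (d v r)
  step {u} {r} u≢r with d u r in eq | d-walk u r
  ... | .0       | []    = contradiction refl u≢r
  ... | .(suc _) | _∷_ {v = v} e p =
    v , e , ≤-antisym (subst (_≤ suc (d v r)) eq (d-~ r e)) (s≤s (d-min p))

  geodesic-nb : ∀ {u r k} (p : Walk G u r k) → k ≡ d u r → NonBacktracking p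
  geodesic-nb []           _  = tt
  geodesic-nb (_ ∷ [])     _  = tt
  geodesic-nb {u} {r} (_∷_ {v = v} {k = suc k} e (f ∷ p)) eq = u≢w , geodesic-nb (f ∷ p) eq′
    where
      u≢w : _ ≢ _
      u≢w refl = 1+n≰n (≤-trans (≤-trans (n≤1+n _) (≤-reflexive eq)) (d-min p))
      eq′ : suc k ≡ d v r
      eq′ = ≤-antisym (≤-pred (≤-trans (≤-reflexive eq) (d-~ r e))) (d-min (f ∷ p))

-- Distances in trees

module TreeMetric {n : ℕ} (G : Graph n) (connected : Connected G) (acyclic : ¬ Cycle G) where
  open Graph G
  open Walks G
  open Metric G connected public

  private
    -- Prolong a walk at its start p towards the root r as long as it stays non-backtracking.
    climb : ∀ {r} t {p x k} → d p r ≡ t → (e : p ~ x) (w : Walk G x r k) →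
      NonBacktracking (e ∷ w) → d p r ≤ d x r → ⊥
    climb {r} zero {p} eq e w nb _ with d≡0⇒≡ {p} {r} eq
    ... | refl = acyclic (nbClosedWalk⇒Cycle (e ∷ w) nb)
    climb {r} (suc t) {p} {x} eq e w nb le with p ≟ r
    ... | yes refl = acyclic (nbClosedWalk⇒Cycle (e ∷ w) nb)
    ... | no p≢r with step p≢r
    ...   | q , p~q , dp = climb t (suc-injective (trans (sym dp) eq)) (~-sym p~q) (e ∷ w)
            (q≢x , nb) (≤-trans (n≤1+n _) (≤-reflexive (sym dp)))
      where
        q≢x : q ≢ x
        q≢x refl = 1+n≰n (≤-trans (≤-reflexive (sym dp)) le)

  -- If `p` and `q` differed, the walk from `p` over `v` and `q` along a geodesic to `r` would be
  -- non-backtracking, and `climb` would close it. All later use of acyclicity passes through this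
  -- lemma.
  parent-unique : ∀ {r v p q} → v ~ p → d p r ≤ d v r → v ~ q → d v r ≡ suc (d q r) → p ≡ q
  parent-unique {r} {v} {p} {q} v~p le v~q dv with p ≟ q
  ... | yes p≡q = p≡q
  ... | no p≢q = ⊥-elim (climb _ refl (~-sym v~p) (v~q ∷ d-walk q r)
                   (p≢q , geodesic-nb (v~q ∷ d-walk q r) (sym dv)) le)

  away : ∀ {r v p q} → v ~ p → d v r ≡ suc (d p r) → v ~ q → q ≢ p → d q r ≡ suc (d v r)
  away {r} {v} {p} {q} v~p dv v~q q≢p with d q r ≤? d v r
  ... | yes le = contradiction (parent-unique v~q le v~p dv) q≢p
  ... | no ¬le = ≤-antisym (d-~ r (~-sym v~q)) (≰⇒> ¬le)

  nearer : ∀ {u v} r → u ~ v → d u r ≡ suc (d v r) ⊎ d v r ≡ suc (d u r)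
  nearer {u} {v} r u~v with u ≟ r
  ... | yes refl = inj₂ (trans (~⇒d≡1 (~-sym u~v)) (cong suc (sym (d-refl u))))
  ... | no u≢r with step u≢r
  ...   | q , u~q , du with v ≟ q
  ...     | yes refl = inj₁ du
  ...     | no v≢q   = inj₂ (away u~q du u~v v≢q)

  -- Induction along a geodesic from `c` to `x`. Once a step has led away from `w`, every further
  -- step does, because the only neighbour nearer to `w` is the vertex just left.
  d-through : ∀ t {c q x w} → c ~ q → d c x ≡ suc t → d q x ≡ t → d q w ≡ suc (d c w) →
    d x w ≡ d c w + suc t
  d-through zero {c} {q} {x} {w} c~q _ dq dw with d≡0⇒≡ {q} {x} dq
  ... | refl = trans dw (sym (+-comm (d c w) 1))
  d-through (suc t) {c} {q} {x} {w} c~q dc dq dw with q ≟ x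
  ... | yes refl = contradiction (trans (sym dq) (d-refl q)) 1+n≢0
  ... | no q≢x with step q≢x
  ...   | q′ , q~q′ , dq′ = trans
            (d-through t q~q′ dq (suc-injective (trans (sym dq′) dq)) (away (~-sym c~q) dw q~q′ q′≢c))
            (trans (cong (_+ suc t) dw) (sym (+-suc (d c w) (suc t))))
    where
      q′≢c : q′ ≢ c
      q′≢c refl = m≢1+n+m t (suc-injective (trans (sym dq) (trans dq′ (cong suc dc))))

  through : ∀ {c q x w} → c ~ q → d c x ≡ suc (d q x) → d q w ≡ suc (d c w) →
    d w x ≡ d c w + d c x
  through {c} {q} {x} {w} c~q dc dq = begin
    d w x             ≡⟨ d-sym w x ⟩
    d x w             ≡⟨ d-through (d q x) c~q dc refl dq ⟩
    d c w + suc (d q x) ≡⟨ cong (d c w +_) dc ⟨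
    d c w + d c x     ∎
    where open ≡-Reasoning

  on-path : ∀ i x y → i ≤ d x y → ∃ λ c → d c x ≡ i × i + d c y ≡ d x y
  on-path zero    x y _   = x , d-refl x , refl
  on-path (suc i) x y i<D with on-path i x y (<⇒≤ i<D)
  ... | c , dx , dy with step c≢y
    where
      c≢y : c ≢ y
      c≢y refl = <⇒≢ i<D (trans (sym (+-identityʳ i)) (trans (cong (i +_) (sym (d-refl c))) dy))
  ...   | c′ , c~c′ , dc = c′ , ≤-antisym upper lower , trans (sym (+-suc i (d c′ y))) split
    where
      split : i + suc (d c′ y) ≡ d x y
      split = trans (cong (i +_) (sym dc)) dy
      upper : d c′ x ≤ suc i
      upper = ≤-trans (d-~ x (~-sym c~c′)) (s≤s (≤-reflexive dx))
      lower : suc i ≤ d c′ x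
      lower = +-cancelʳ-≤ (d c′ y) (suc i) (d c′ x) (begin
        suc i + d c′ y  ≡⟨ +-suc i (d c′ y) ⟨
        i + suc (d c′ y) ≡⟨ split ⟩
        d x y           ≤⟨ d-triangle x c′ y ⟩
        d x c′ + d c′ y ≡⟨ cong (_+ d c′ y) (d-sym x c′) ⟩
        d c′ x + d c′ y ∎)
        where open ≤-Reasoning

  -- Since `c` lies between `x` and `y`, the first steps from `c` towards them differ. The first
  -- step towards `w` therefore differs from at least one of the two, and `c` separates `w` from
  -- that end.
  fork : ∀ {c x y} → d c x + d c y ≡ d x y → ∀ w →
    d w x ≡ d c w + d c x ⊎ d w y ≡ d c w + d c y
  fork {c} {x} {y} path w with c ≟ w
  ... | yes refl = inj₁ (cong (_+ d c x) (sym (d-refl c)))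
  ... | no c≢w with c ≟ x
  ...   | yes refl = inj₁ (trans (d-sym w c) (trans (sym (+-identityʳ _)) (cong (d c w +_) (sym (d-refl c)))))
  ...   | no c≢x with c ≟ y
  ...     | yes refl = inj₂ (trans (d-sym w c) (trans (sym (+-identityʳ _)) (cong (d c w +_) (sym (d-refl c)))))
  ...     | no c≢y with step c≢w | step c≢x | step c≢y
  ...       | q , c~q , dq | qx , c~qx , dx | qy , c~qy , dy with qx ≟ q
  ...         | no qx≢q = inj₁ (through c~qx dx (away c~q dq c~qx qx≢q))
  ...         | yes refl = inj₂ (through c~qy dy (away c~q dq c~qy qy≢q))
    where
      qy≢q : qy ≢ q
      qy≢q refl = 1+n≰n (begin
        suc (d q x + d q y) ≤⟨ n≤1+n _ ⟩
        suc (suc (d q x + d q y)) ≡⟨ cong suc (+-suc (d q x) (d q y)) ⟨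
        suc (d q x) + suc (d q y) ≡⟨ cong₂ _+_ dx dy ⟨
        d c x + d c y       ≡⟨ path ⟩
        d x y               ≤⟨ d-triangle x q y ⟩
        d x q + d q y       ≡⟨ cong (_+ d q y) (d-sym x q) ⟩
        d q x + d q y       ∎)
        where open ≤-Reasoning

-- Centres of trees

⌊/2⌋≡⇒ : ∀ D {h} → ⌊ D /2⌋ ≡ h → D ≡ h + h ⊎ D ≡ suc (h + h)
⌊/2⌋≡⇒ zero          refl = inj₁ refl
⌊/2⌋≡⇒ (suc zero)    refl = inj₂ refl
⌊/2⌋≡⇒ (suc (suc D)) refl with ⌊/2⌋≡⇒ D refl
... | inj₁ eq = inj₁ (cong suc (trans (cong suc eq) (sym (+-suc _ _))))
... | inj₂ eq = inj₂ (cong (suc ∘ suc) (trans eq (sym (+-suc _ _))))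

module Center {n : ℕ} (G : Graph n) (connected : Connected G) (acyclic : ¬ Cycle G) where
  open Graph G
  open TreeMetric G connected acyclic

  record UniqueCentre (h D : ℕ) : Set where
    field
      c        : Fin n
      D≡       : D ≡ h + h
      bounded  : ∀ v → d c v ≤ h
      central  : Central G c
      only     : ∀ {v} → Central G v → v ≡ c

  record CentralEdge (h D : ℕ) : Set where
    field
      c₀ c₁    : Fin n
      edge     : c₀ ~ c₁
      D≡       : D ≡ suc (h + h)
      bounded₀ : ∀ v → d c₀ v ≤ suc h
      bounded₁ : ∀ v → d c₁ v ≤ suc h
      central₀ : Central G c₀
      central₁ : Central G c₁
      only     : ∀ {v} → Central G v → v ≡ c₀ ⊎ v ≡ c₁

  module _ {D} (diam : Diameter G D) where

    private
      x y : Fin n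
      x = proj₁ (proj₁ diam)
      y = proj₁ (proj₂ (proj₁ diam))

      D≡dxy : D ≡ d x y
      D≡dxy = Distance⇒≡d (proj₂ (proj₂ (proj₁ diam)))

    d≤D : ∀ u v → d u v ≤ D
    d≤D u v = proj₂ diam (u , v , d-Distance u v)

    private
      ecc≥ : ∀ {u e} → Eccentricity G u e → ∀ v → d u v ≤ e
      ecc≥ {u} (_ , max) v = max (v , d-Distance u v)

      room : ∀ {c w z a b} → d w z ≡ d c w + d c z → d c z ≡ a → b + a ≡ D → d c w ≤ b
      room {c} {w} {z} {a} {b} eq refl b+a≡D = +-cancelʳ-≤ a (d c w) b (begin
        d c w + a ≡⟨ eq ⟨
        d w z     ≤⟨ d≤D w z ⟩
        D         ≡⟨ b+a≡D ⟨
        b + a     ∎)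
        where open ≤-Reasoning

      -- By `fork`, the branch from `c` to `w` prolongs one of the two parts of the diametral path,
      -- and no path in the tree is longer than `D`.
      bound : ∀ {c a b} → d c x ≡ a → d c y ≡ b → a + b ≡ D → ∀ w → d c w ≤ a ⊔ b
      bound {c} {a} {b} dx dy a+b≡D w with fork {c} {x} {y} (trans (cong₂ _+_ dx dy) (trans a+b≡D D≡dxy)) w
      ... | inj₁ eq = ≤-trans (room eq dx (trans (+-comm b a) a+b≡D)) (m≤n⊔m a b)
      ... | inj₂ eq = ≤-trans (room eq dy a+b≡D) (m≤m⊔n a b)

      half≤ecc : ∀ {h v e} → h + h ≤ D → Eccentricity G v e → h ≤ e
      half≤ecc {h} {v} {e} hh≤D ecc with h ≤? e
      ... | yes h≤e = h≤e
      ... | no h≰e  = contradiction (begin-strict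
                D             ≡⟨ D≡dxy ⟩
                d x y         ≤⟨ d-triangle x v y ⟩
                d x v + d v y ≡⟨ cong (_+ d v y) (d-sym x v) ⟩
                d v x + d v y ≤⟨ +-mono-≤ (ecc≥ ecc x) (ecc≥ ecc y) ⟩
                e + e         <⟨ +-mono-< (≰⇒> h≰e) (≰⇒> h≰e) ⟩
                h + h         ≤⟨ hh≤D ⟩
                D             ∎) (<-irrefl refl)
                where open ≤-Reasoning

      half<ecc : ∀ {h v e} → suc (h + h) ≤ D → Eccentricity G v e → suc h ≤ e
      half<ecc {h} {v} {e} hh≤D ecc with suc h ≤? e
      ... | yes h≤e = h≤e
      ... | no h≰e  = contradiction (begin-strict
                D             ≡⟨ D≡dxy ⟩
                d x y         ≤⟨ d-triangle x v y ⟩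
                d x v + d v y ≡⟨ cong (_+ d v y) (d-sym x v) ⟩
                d v x + d v y ≤⟨ +-mono-≤ (ecc≥ ecc x) (ecc≥ ecc y) ⟩
                e + e         ≤⟨ +-mono-≤ (≤-pred (≰⇒> h≰e)) (≤-pred (≰⇒> h≰e)) ⟩
                h + h         <⟨ hh≤D ⟩
                D             ∎) (<-irrefl refl)
                where open ≤-Reasoning

      eccentricity : ∀ {c e} w → d c w ≡ e → (∀ v → d c v ≤ e) → Eccentricity G c e
      eccentricity {c} w refl bd = (w , d-Distance c w) ,
        λ { (v , dist) → subst (_≤ _) (sym (Distance⇒≡d dist)) (bd v) }

      central-ecc≤ : ∀ {u c e} → Central G u → Eccentricity G c e → ∀ v → d u v ≤ e
      central-ecc≤ (e , ecc , min) ecc′ v = ≤-trans (ecc≥ ecc v) (min _ ecc′)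

    -- The centre is the midpoint of a diametral path. By `fork` another vertex `v` is at distance
    -- `d c v + h` from one end of that path, which exceeds the eccentricity `h` of `c`.
    uniqueCentre : ∀ {h} → D ≡ h + h → UniqueCentre h D
    uniqueCentre {h} D≡ with on-path h x y (subst (h ≤_) (trans (sym D≡) D≡dxy) (m≤m+n h h))
    ... | c , dx , h+dy = record
      { c = c ; D≡ = D≡ ; bounded = bd
      ; central = h , ecc , λ v → half≤ecc (≤-reflexive (sym D≡))
      ; only = only }
      where
        dy : d c y ≡ h
        dy = +-cancelˡ-≡ h _ _ (trans h+dy (trans (sym D≡dxy) D≡))
        bd : ∀ w → d c w ≤ h
        bd w = ≤-trans (bound dx dy (sym D≡) w) (≤-reflexive (⊔-idem h))
        ecc : Eccentricity G c h
        ecc = eccentricity x dx bd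
        only : ∀ {v} → Central G v → v ≡ c
        only {v} cv = sym (d≡0⇒≡ (n≤0⇒n≡0 dcv≤0))
          where
            dcv≤0 : d c v ≤ 0
            dcv≤0 with fork {c} {x} {y} (trans (cong (_+ d c y) dx) h+dy) v
            ... | inj₁ eq = +-cancelʳ-≤ h (d c v) 0
              (≤-trans (≤-reflexive (trans (cong (d c v +_) (sym dx)) (sym eq))) (central-ecc≤ cv ecc x))
            ... | inj₂ eq = +-cancelʳ-≤ h (d c v) 0
              (≤-trans (≤-reflexive (trans (cong (d c v +_) (sym dy)) (sym eq))) (central-ecc≤ cv ecc y))

    -- The middle edge of a diametral path has `x` on the side of `c` and `y` on the side of `c′`. A
    -- vertex `v` on the side of `c′` is at distance `d c′ v + suc h` from `x`, so it can be central
    -- only if it is `c′`; likewise with `y` on the side of `c`.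
    centralEdge : ∀ {h} → D ≡ suc (h + h) → CentralEdge h D
    centralEdge {h} D≡ with on-path h x y (subst (h ≤_) (trans (sym D≡) D≡dxy) (m≤n⇒m≤1+n (m≤m+n h h)))
    ... | c , dx , h+dy with step c≢y
      where
        dy : d c y ≡ suc h
        dy = +-cancelˡ-≡ h _ _ (trans h+dy (trans (sym D≡dxy) (trans D≡ (sym (+-suc h h)))))
        c≢y : c ≢ y
        c≢y refl = 1+n≢0 (trans (sym dy) (d-refl c))
    ...   | c′ , c~c′ , dc = record
      { c₀ = c ; c₁ = c′ ; edge = c~c′ ; D≡ = D≡
      ; bounded₀ = bd ; bounded₁ = bd′
      ; central₀ = suc h , ecc , λ v → half<ecc (≤-reflexive (sym D≡))
      ; central₁ = suc h , ecc′ , λ v → half<ecc (≤-reflexive (sym D≡))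
      ; only = only }
      where
        dy : d c y ≡ suc h
        dy = +-cancelˡ-≡ h _ _ (trans h+dy (trans (sym D≡dxy) (trans D≡ (sym (+-suc h h)))))
        dy′ : d c′ y ≡ h
        dy′ = suc-injective (trans (sym dc) dy)
        dx′ : d c′ x ≡ suc h
        dx′ = ≤-antisym (≤-trans (d-~ x (~-sym c~c′)) (s≤s (≤-reflexive dx)))
          (+-cancelʳ-≤ h (suc h) (d c′ x) (begin
            suc h + h       ≡⟨ trans (sym D≡) D≡dxy ⟩
            d x y           ≤⟨ d-triangle x c′ y ⟩
            d x c′ + d c′ y ≡⟨ cong₂ _+_ (d-sym x c′) dy′ ⟩
            d c′ x + h      ∎))
          where open ≤-Reasoning
        bd : ∀ w → d c w ≤ suc h
        bd w = ≤-trans (bound dx dy (trans (+-suc h h) (sym D≡)) w) (≤-reflexive (m≤n⇒m⊔n≡n (n≤1+n h)))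
        bd′ : ∀ w → d c′ w ≤ suc h
        bd′ w = ≤-trans (bound dx′ dy′ (sym D≡) w) (≤-reflexive (m≥n⇒m⊔n≡m (n≤1+n h)))
        ecc : Eccentricity G c (suc h)
        ecc = eccentricity y dy bd
        ecc′ : Eccentricity G c′ (suc h)
        ecc′ = eccentricity x dx′ bd′
        only : ∀ {v} → Central G v → v ≡ c ⊎ v ≡ c′
        only {v} cv with nearer v c~c′
        ... | inj₁ eq = inj₂ (sym (d≡0⇒≡ (n≤0⇒n≡0 (+-cancelʳ-≤ (suc h) (d c′ v) 0
                (≤-trans (≤-reflexive (trans (cong (d c′ v +_) (sym dx′)) (sym (through (~-sym c~c′) (trans dx′ (cong suc (sym dx))) eq))))
                  (central-ecc≤ cv ecc′ x))))))
        ... | inj₂ eq = inj₁ (sym (d≡0⇒≡ (n≤0⇒n≡0 (+-cancelʳ-≤ (suc h) (d c v) 0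
                (≤-trans (≤-reflexive (trans (cong (d c v +_) (sym dy)) (sym (through c~c′ dc eq))))
                  (central-ecc≤ cv ecc y))))))

  -- `Height` forgets the parity of the diameter; the number of central vertices recovers it.
  centreSize1 : ∀ {h} → Height G h → CenterSize G 1 → ∃ λ D → Diameter G D × UniqueCentre h D
  centreSize1 {h} (D , diam , D/2) (L₀ , L₀⇔ , size) with ⌊/2⌋≡⇒ D D/2
  ... | inj₁ eq = D , diam , uniqueCentre diam {h} eq
  ... | inj₂ eq = contradiction (begin-strict
        ∣ ⁅ c₁ ⁆ ∣ ≤⟨ p⊆q⇒∣p∣≤∣q∣ sub ⟩
        ∣ L₀ ∖ c₀ ∣ <⟨ x∈p⇒∣p-x∣<∣p∣ (Equivalence.from (L₀⇔ c₀) central₀) ⟩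
        ∣ L₀ ∣     ≡⟨ trans size (sym (∣⁅x⁆∣≡1 c₁)) ⟩
        ∣ ⁅ c₁ ⁆ ∣ ∎) (<-irrefl refl)
    where
      open CentralEdge (centralEdge diam {h} eq)
      open ≤-Reasoning
      sub : ∀ {v} → v ∈ ⁅ c₁ ⁆ → v ∈ L₀ ∖ c₀
      sub {v} v∈ rewrite x∈⁅y⁆⇒x≡y c₁ v∈ =
        x∈p∧x≢y⇒x∈p-y (Equivalence.from (L₀⇔ c₁) central₁) (λ e → ~-irrefl (sym e) edge)

  centreSize2 : ∀ {h} → Height G h → CenterSize G 2 → ∃ λ D → Diameter G D × CentralEdge h D
  centreSize2 {h} (D , diam , D/2) (L₀ , L₀⇔ , size) with ⌊/2⌋≡⇒ D D/2
  ... | inj₂ eq = D , diam , centralEdge diam {h} eq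
  ... | inj₁ eq = contradiction (begin-strict
        ∣ ⁅ c ⁆ ∣ ≡⟨ ∣⁅x⁆∣≡1 c ⟩
        1         <⟨ n<1+n 1 ⟩
        2         ≡⟨ size ⟨
        ∣ L₀ ∣    ≤⟨ p⊆q⇒∣p∣≤∣q∣ sub ⟩
        ∣ ⁅ c ⁆ ∣ ∎) (<-irrefl refl)
    where
      open UniqueCentre (uniqueCentre diam {h} eq)
      open ≤-Reasoning
      sub : ∀ {v} → v ∈ L₀ → v ∈ ⁅ c ⁆
      sub {v} v∈ with only (Equivalence.to (L₀⇔ v) v∈)
      ... | refl = x∈⁅x⁆ c

-- Half-trees

-- The number of vertices at depth t of a rooted tree whose vertices at depth i have k i children.
width : (ℕ → ℕ) → ℕ → ℕ
width k zero    = 1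
width k (suc t) = width k t * k t

width-∣ : ∀ k {s t} → s ≤ t → width k s ∣ width k t
width-∣ k {s} {zero} z≤n = ∣-refl
width-∣ k {s} {suc t} s≤1+t with m≤n⇒m<n∨m≡n s≤1+t
... | inj₁ (s≤s s≤t) = ∣-trans (width-∣ k s≤t) (m∣m*n (k t))
... | inj₂ refl      = ∣-refl

-- Stated as an inequality so that two applications give equality of the most significant digits of
-- equal codes.
quotient-unique : ∀ {w c c′ r r′} → c < w → c′ < w → c + w * r ≡ c′ + w * r′ → r ≤ r′
quotient-unique {w} {c} {c′} {r} {r′} c< c′< eq = ≮⇒≥ λ r′<r → <-irrefl refl (begin-strict
  c′ + w * r′ <⟨ +-monoˡ-< (w * r′) c′< ⟩
  w + w * r′  ≡⟨ *-suc w r′ ⟨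
  w * suc r′  ≤⟨ *-monoʳ-≤ w r′<r ⟩
  w * r       ≤⟨ m≤n+m (w * r) c ⟩
  c + w * r   ≡⟨ eq ⟩
  c′ + w * r′ ∎)
  where open ≤-Reasoning

-- The half of a tree on the side of a after deleting the edge from p to a, rooted at a.
module HalfTree {n : ℕ} (G : Graph n) (connected : Connected G) (acyclic : ¬ Cycle G)
  (p a : Fin n) (p~a : Graph._~_ G p a) (k : ℕ → ℕ) (H : ℕ) where

  open Graph G
  open TreeMetric G connected acyclic

  depth : Fin n → ℕ
  depth v = d v a

  Inside : Fin n → Set
  Inside v = d v p ≡ suc (depth v)

  inside? : ∀ v → Dec (Inside v)
  inside? v = d v p ℕ.≟ suc (depth v)

  root-inside : Inside a
  root-inside = trans (~⇒d≡1 (~-sym p~a)) (cong suc (sym (d-refl a)))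

  depth≡0 : ∀ {v} → depth v ≡ 0 → v ≡ a
  depth≡0 = d≡0⇒≡

  inside-≢ : ∀ {v} → Inside v → v ≢ p
  inside-≢ {v} iv refl = 1+n≢0 (trans (sym iv) (d-refl v))

  outside : ∀ {w} → ¬ Inside w → depth w ≡ suc (d w p)
  outside {w} ¬iw with nearer w p~a
  ... | inj₁ eq = contradiction (trans (d-sym w p) (trans eq (cong suc (d-sym a w)))) ¬iw
  ... | inj₂ eq = trans (d-sym w a) (trans eq (cong suc (d-sym p w)))

  across : ∀ {v w} → Inside v → ¬ Inside w → d v w ≡ depth v + depth w
  across {v} {w} iv ¬iw = begin
    d v w         ≡⟨ through (~-sym p~a) (trans (d-sym a w) (trans (outside ¬iw) (cong suc (d-sym w p))))
                       (trans (d-sym p v) (trans iv (cong suc (d-sym v a)))) ⟩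
    d a v + d a w ≡⟨ cong₂ _+_ (d-sym a v) (d-sym a w) ⟩
    d v a + d w a ∎
    where open ≡-Reasoning

  -- By `across` and `outside`, an edge leaving the half has length `depth v + suc (d w p)`. As this
  -- is 1, both terms vanish.
  exit : ∀ {v w} → Inside v → v ~ w → ¬ Inside w → v ≡ a × w ≡ p
  exit {v} {w} iv v~w ¬iw = depth≡0 (m+n≡0⇒m≡0 (depth v) sum≡0) , d≡0⇒≡ (m+n≡0⇒n≡0 (depth v) sum≡0)
    where
      sum≡0 : depth v + d w p ≡ 0
      sum≡0 = suc-injective (trans (sym (+-suc (depth v) (d w p)))
        (trans (cong (depth v +_) (sym (outside ¬iw))) (trans (sym (across iv ¬iw)) (~⇒d≡1 v~w))))

  -- The tree is rooted at `p`, outside the half, so that `a` has a parent like every other inside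
  -- vertex and the degree is always one more than the number of children. The value at `p` itself
  -- is arbitrary.
  parent : Fin n → Fin n
  parent v with v ≟ p
  ... | yes _  = p
  ... | no v≢p = proj₁ (step v≢p)

  parent-spec : ∀ {v} → v ≢ p → v ~ parent v × d v p ≡ suc (d (parent v) p)
  parent-spec {v} v≢p with v ≟ p
  ... | yes v≡p = contradiction v≡p v≢p
  ... | no v≢p′ = proj₂ (step v≢p′)

  Child : Fin n → Fin n → Set
  Child v w = v ~ w × d w p ≡ suc (d v p)

  child? : ∀ v w → Dec (Child v w)
  child? v w = (v ~? w) ×-dec (d w p ℕ.≟ suc (d v p))

  child⇒parent : ∀ {v w} → Child v w → v ≡ parent w
  child⇒parent {v} {w} (v~w , dw) = parent-unique (~-sym v~w) (≤-trans (n≤1+n _) (≤-reflexive (sym dw)))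
    (proj₁ ps) (proj₂ ps)
    where
      w≢p : w ≢ p
      w≢p refl = 1+n≢0 (trans (sym dw) (d-refl w))
      ps = parent-spec w≢p

  parent⇒child : ∀ {w} → w ≢ p → Child (parent w) w
  parent⇒child w≢p = ~-sym (proj₁ (parent-spec w≢p)) , proj₂ (parent-spec w≢p)

  child-inside : ∀ {v w} → Inside v → Child v w → Inside w
  child-inside {v} {w} iv (v~w , dw) with inside? w
  ... | yes iw = iw
  ... | no ¬iw with exit iv v~w ¬iw
  ...   | _ , refl = contradiction (trans (sym dw) (d-refl w)) 1+n≢0

  child-depth : ∀ {v w} → Inside v → Inside w → Child v w → depth w ≡ suc (depth v)
  child-depth iv iw (_ , dw) = suc-injective (trans (sym iw) (trans dw (cong suc iv)))

  parent-inside : ∀ {w} → Inside w → w ≢ a → Inside (parent w)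
  parent-inside {w} iw w≢a with inside? (parent w)
  ... | yes i = i
  ... | no ¬i = contradiction (proj₁ (exit iw (proj₁ (parent-spec (inside-≢ iw))) ¬i)) w≢a

  children : Fin n → List (Fin n)
  children v = filter (child? v) (allFin n)

  degree≡ : ∀ {v} → v ≢ p → degree G v ≡ suc (length (children v))
  degree≡ {v} v≢p = begin
    degree G v                                      ≡⟨ length-filter (v ~?_) (allFin n) ⟩
    ∑ (λ w → 𝟙 (v ~? w))                            ≡⟨ sumOver-cong (allFin n) pointwise ⟩
    ∑ (λ w → 𝟙 (w ≟ parent v) + 𝟙 (child? v w))     ≡⟨ sumOver-+ (allFin n) _ _ ⟩
    ∑ (λ w → 𝟙 (w ≟ parent v)) + ∑ (λ w → 𝟙 (child? v w))
      ≡⟨ cong₂ _+_ (∑-single (parent v)) (sym (length-filter (child? v) (allFin n))) ⟩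
    suc (length (children v))                       ∎
    where
      open ≡-Reasoning
      pointwise : ∀ w → 𝟙 (v ~? w) ≡ 𝟙 (w ≟ parent v) + 𝟙 (child? v w)
      pointwise w with v ~? w | w ≟ parent v
      ... | no v≁w  | yes refl = contradiction (proj₁ (parent-spec v≢p)) v≁w
      ... | no v≁w  | no _     = refl
      ... | yes _   | yes refl = cong suc (sym (𝟙-no _
              λ (_ , eq) → m≢1+n+m (d v p) {1} (trans (proj₂ (parent-spec v≢p)) (cong suc eq))))
      ... | yes v~w | no w≢π   = sym (𝟙-yes _
              (v~w , away (proj₁ (parent-spec v≢p)) (proj₂ (parent-spec v≢p)) v~w w≢π))

  rank : Fin n → ℕ
  rank w with anyˡ? (w ≟_) (children (parent w))
  ... | yes w∈ = toℕ (index w∈)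
  ... | no _   = 0

  private
    ∈-children : ∀ {w} → w ≢ p → w ∈ˡ children (parent w)
    ∈-children w≢p = ∈-filter⁺ (child? _) (∈-allFin _) (parent⇒child w≢p)

  rank-< : ∀ {w} → w ≢ p → rank w < length (children (parent w))
  rank-< {w} w≢p with anyˡ? (w ≟_) (children (parent w))
  ... | yes w∈ = toℕ<n (index w∈)
  ... | no w∉  = contradiction (∈-children w≢p) w∉

  rank-injective : ∀ {v w} → v ≢ p → w ≢ p → parent v ≡ parent w → rank v ≡ rank w → v ≡ w
  rank-injective {v} {w} v≢p w≢p eq req with anyˡ? (v ≟_) (children (parent v)) | anyˡ? (w ≟_) (children (parent w))
  ... | no v∉  | _      = contradiction (∈-children v≢p) v∉
  ... | yes _  | no w∉  = contradiction (∈-children w≢p) w∉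
  ... | yes v∈ | yes w∈ with parent w
  rank-injective {v} {w} v≢p w≢p refl req | yes v∈ | yes w∈ | _ =
    Membership.index-injective (setoid (Fin n)) v∈ w∈ (toℕ-injective req)

  -- Mixed-radix digits with the branching at the root least significant: modulo width k s,
  -- a code is that of the ancestor at depth s.
  codeAt : ℕ → Fin n → ℕ
  codeAt zero    v = 0
  codeAt (suc t) v = codeAt t (parent v) + width k t * rank v

  code : Fin n → ℕ
  code v = codeAt (depth v) v

  module Regular
    (depth≤H : ∀ {v} → Inside v → depth v ≤ H)
    (degrees : ∀ {v} → Inside v → depth v < H → degree G v ≡ suc (k (depth v))) where

    length-children : ∀ {v} → Inside v → depth v < H → length (children v) ≡ k (depth v)
    length-children iv v<H = suc-injective (trans (sym (degree≡ (inside-≢ iv))) (degrees iv v<H))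

    private
      up : ∀ {v t} → Inside v → depth v ≡ suc t → Inside (parent v) × depth (parent v) ≡ t
      up {v} {t} iv dv = ip , suc-injective (trans (sym (child-depth ip iv (parent⇒child (inside-≢ iv)))) dv)
        where
          v≢a : v ≢ a
          v≢a refl = 1+n≢0 (trans (sym dv) (d-refl v))
          ip = parent-inside iv v≢a

    codeAt-< : ∀ t {v} → Inside v → depth v ≡ t → codeAt t v < width k t
    codeAt-< zero    _  _  = s≤s z≤n
    codeAt-< (suc t) {v} iv dv with up iv dv
    ... | ip , dp = begin-strict
      codeAt t (parent v) + width k t * rank v <⟨ +-monoˡ-< _ (codeAt-< t ip dp) ⟩
      width k t + width k t * rank v           ≡⟨ *-suc (width k t) (rank v) ⟨
      width k t * suc (rank v)                 ≤⟨ *-monoʳ-≤ (width k t) rank<k ⟩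
      width k t * k t                          ∎
      where
        open ≤-Reasoning
        rank<k : rank v < k t
        rank<k = subst (rank v <_)
          (trans (length-children ip (≤-trans (≤-reflexive (trans (cong suc dp) (sym dv))) (depth≤H iv))) (cong k dp))
          (rank-< (inside-≢ iv))

    code-< : ∀ {v} → Inside v → code v < width k (depth v)
    code-< iv = codeAt-< _ iv refl

    codeAt-injective : ∀ t {u v} → Inside u → Inside v → depth u ≡ t → depth v ≡ t →
      codeAt t u ≡ codeAt t v → u ≡ v
    codeAt-injective zero    _ _ du dv _ = trans (depth≡0 du) (sym (depth≡0 dv))
    codeAt-injective (suc t) {u} {v} iu iv du dv eq with up iu du | up iv dv
    ... | ipu , dpu | ipv , dpv = rank-injective (inside-≢ iu) (inside-≢ iv)
        (codeAt-injective t ipu ipv dpu dpv (+-cancelʳ-≡ (width k t * rank u) _ _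
          (trans eq (cong (λ r → codeAt t (parent v) + width k t * r) (sym ranks)))))
        ranks
      where
        ranks : rank u ≡ rank v
        ranks = ≤-antisym (quotient-unique (codeAt-< t ipu dpu) (codeAt-< t ipv dpv) eq)
                          (quotient-unique (codeAt-< t ipv dpv) (codeAt-< t ipu dpu) (sym eq))

    code-injective : ∀ {u v} → Inside u → Inside v → depth u ≡ depth v → code u ≡ code v → u ≡ v
    code-injective {u} {v} iu iv du≡dv eq =
      codeAt-injective (depth u) iu iv refl (sym du≡dv) (trans eq (cong (λ t → codeAt t v) (sym du≡dv)))

    code-child : ∀ {v w} → Inside v → Child v w → Congruent (width k (depth v)) (code w) (code v)
    code-child {v} {w} iv vw = 0 , rank w , (begin
      codeAt (depth w) w + 0       ≡⟨ +-identityʳ _ ⟩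
      codeAt (depth w) w           ≡⟨ cong (λ t → codeAt t w) (child-depth iv (child-inside iv vw) vw) ⟩
      codeAt (depth v) (parent w) + width k (depth v) * rank w
        ≡⟨ cong₂ (λ x y → codeAt (depth v) x + y) (sym (child⇒parent vw)) (*-comm (width k (depth v)) (rank w)) ⟩
      code v + rank w * width k (depth v) ∎)
      where open ≡-Reasoning

    -- The depth of the last common ancestor of u and v is a possible φ.
    Separated : Fin n → Fin n → ℕ → Set
    Separated u v ℓ = ∃ λ φ → φ ≤ depth u × φ ≤ depth v ×
      Congruent (width k φ) (code u) (code v) × depth u + depth v ≤ ℓ + 2 * φ

    -- Induction over arbitrary walks replaces the construction of a last common ancestor. The depth
    -- φ found for the rest of the walk is kept, except when the first step goes down to a child of
    -- depth φ; then φ drops to `depth u`.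
    separated-walk : ∀ {u v ℓ} → Inside u → Inside v → Walk G u v ℓ → Separated u v ℓ
    separated-walk {u} iu iv [] = depth u , ≤-refl , ≤-refl , congruent-refl _ ,
      ≤-reflexive (cong (depth u +_) (sym (+-identityʳ _)))
    separated-walk {u} {v} {suc ℓ} iu iv (_∷_ {v = x} e w) with inside? x
    ... | no ¬ix with exit iu e ¬ix
    -- The walk leaves the half, which it can do only from the root. Take φ to be 0: modulo
    -- `width k 0 = 1` any two codes are congruent, and the depths are distances from `u` itself.
    ...   | refl , refl = 0 , z≤n , z≤n , (code v , code u ,
              trans (cong (code u +_) (*-identityʳ (code v)))
                (trans (+-comm (code u) (code v)) (cong (code v +_) (sym (*-identityʳ (code u)))))) ,
              (begin
                d u u + d v u ≡⟨ cong₂ _+_ (d-refl u) (d-sym v u) ⟩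
                d u v ≤⟨ d-min (e ∷ w) ⟩
                suc ℓ ≡⟨ +-identityʳ (suc ℓ) ⟨
                suc ℓ + 0 ∎)
      where open ≤-Reasoning
    separated-walk {u} {v} {suc ℓ} iu iv (_∷_ {v = x} e w) | yes ix with separated-walk ix iv w | nearer p e
    ... | φ , φ≤x , φ≤v , cong-xv , len | inj₁ du = φ , ≤-trans φ≤x (≤-trans (n≤1+n _) (≤-reflexive (sym dep))) , φ≤v ,
            congruent-trans (congruent-weaken (width-∣ k φ≤x) (code-child ix xu)) cong-xv ,
            ≤-trans (≤-reflexive (cong (_+ depth v) dep)) (s≤s len)
      where
        xu : Child x u
        xu = ~-sym e , du
        dep : depth u ≡ suc (depth x)
        dep = child-depth ix iu xu
    ... | φ , φ≤x , φ≤v , cong-xv , len | inj₂ dx with φ ≤? depth u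
    ...   | yes φ≤u = φ , φ≤u , φ≤v ,
              congruent-trans (congruent-weaken (width-∣ k φ≤u) (congruent-sym (code-child iu (e , dx)))) cong-xv ,
              ≤-trans (≤-trans (+-monoˡ-≤ (depth v) (≤-trans (n≤1+n _) (≤-reflexive (sym (child-depth iu ix (e , dx))))))
                len) (n≤1+n _)
    ...   | no φ≰u = depth u , ≤-refl , ≤-trans (<⇒≤ (≰⇒> φ≰u)) φ≤v ,
              congruent-trans (congruent-sym (code-child iu (e , dx))) (congruent-weaken (width-∣ k (<⇒≤ (≰⇒> φ≰u))) cong-xv) ,
              shorter {depth v} {ℓ} φ≡ (≤-trans (≤-reflexive (cong (_+ depth v) (sym (child-depth iu ix (e , dx))))) len)
      where
        φ≡ : φ ≡ suc (depth u)
        φ≡ = ≤-antisym (≤-trans φ≤x (≤-reflexive (child-depth iu ix (e , dx)))) (≰⇒> φ≰u)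
        shorter : ∀ {b ℓ φ t} → φ ≡ suc t → suc t + b ≤ ℓ + 2 * φ → t + b ≤ suc ℓ + 2 * t
        shorter {b} {ℓ} {_} {t} refl le = ≤-pred (≤-trans le (≤-reflexive
          (trans (cong (λ s → ℓ + suc s) (+-suc t (t + 0))) (trans (+-suc ℓ _) (cong suc (+-suc ℓ _))))))

    separated : ∀ {u v} → Inside u → Inside v → Separated u v (d u v)
    separated {u} {v} iu iv = separated-walk iu iv (d-walk u v)

    At : ℕ → Fin n → Set
    At t v = Inside v × depth v ≡ t

    at? : ∀ t v → Dec (At t v)
    at? t v = inside? v ×-dec (depth v ℕ.≟ t)

    private
      child-at : ∀ {t v w} → At t v → Child v w → At (suc t) w
      child-at (iv , dv) vw = child-inside iv vw , trans (child-depth iv (child-inside iv vw) vw) (cong suc dv)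

      𝟙-*-no : ∀ {P Q : Set} (P? : Dec P) (Q? : Dec Q) → ¬ (P × Q) → 𝟙 P? * 𝟙 Q? ≡ 0
      𝟙-*-no (yes p) (yes q) ¬pq = contradiction (p , q) ¬pq
      𝟙-*-no (yes p) (no _)  _   = refl
      𝟙-*-no (no _)  _       _   = refl

      by-parent : ∀ t u → 𝟙 (at? (suc t) u) ≡ ∑ (λ v → 𝟙 (at? t v) * 𝟙 (child? v u))
      by-parent t u with at? (suc t) u
      ... | no ¬at = sym (trans
        (sumOver-cong (allFin n) λ v → 𝟙-*-no (at? t v) (child? v u) λ (atv , vu) → ¬at (child-at atv vu))
        (sumOver-0 (allFin n)))
      ... | yes (iu , du) = sym (trans (sumOver-cong (allFin n) pointwise) (∑-single (parent u)))
        where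
          pointwise : ∀ v → 𝟙 (at? t v) * 𝟙 (child? v u) ≡ 𝟙 (v ≟ parent u)
          pointwise v with v ≟ parent u
          ... | no v≢π   = 𝟙-*-no (at? t v) (child? v u) λ (_ , vu) → v≢π (child⇒parent vu)
          ... | yes refl = cong₂ _*_ (𝟙-yes (at? t v) (up iu du)) (𝟙-yes (child? v u) (parent⇒child (inside-≢ iu)))

    count : ∀ t → t ≤ H → ∑ (λ v → 𝟙 (at? t v)) ≡ width k t
    count zero _ = trans (sumOver-cong (allFin n) pointwise) (∑-single a)
      where
        pointwise : ∀ v → 𝟙 (at? 0 v) ≡ 𝟙 (v ≟ a)
        pointwise v with v ≟ a
        ... | yes refl = 𝟙-yes (at? 0 v) (root-inside , d-refl v)
        ... | no v≢a   = 𝟙-no (at? 0 v) (v≢a ∘ depth≡0 ∘ proj₂)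
    count (suc t) t<H = begin
      ∑ (λ u → 𝟙 (at? (suc t) u))                          ≡⟨ sumOver-cong (allFin n) (by-parent t) ⟩
      ∑ (λ u → ∑ (λ v → 𝟙 (at? t v) * 𝟙 (child? v u)))     ≡⟨ sumOver-swap (allFin n) (allFin n) _ ⟩
      ∑ (λ v → ∑ (λ u → 𝟙 (at? t v) * 𝟙 (child? v u)))     ≡⟨ sumOver-cong (allFin n) pointwise ⟩
      ∑ (λ v → 𝟙 (at? t v) * k t)                          ≡⟨ sumOver-*ʳ (allFin n) _ (k t) ⟩
      ∑ (λ v → 𝟙 (at? t v)) * k t                          ≡⟨ cong (_* k t) (count t (<⇒≤ t<H)) ⟩
      width k t * k t                                      ∎
      where
        open ≡-Reasoning
        pointwise : ∀ v → ∑ (λ u → 𝟙 (at? t v) * 𝟙 (child? v u)) ≡ 𝟙 (at? t v) * k t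
        pointwise v = trans (sumOver-*ˡ (allFin n) (𝟙 (at? t v)) _) siblings
          where
            siblings : 𝟙 (at? t v) * ∑ (λ u → 𝟙 (child? v u)) ≡ 𝟙 (at? t v) * k t
            siblings with at? t v
            ... | no _          = refl
            ... | yes (iv , refl) = cong (_+ 0) (trans (sym (length-filter (child? v) (allFin n))) (length-children iv t<H))

    -- This turns the vertex sums of the lower bound into the row sums of `Layout`, so that both
    -- bounds end in the same expression.
    ∑-inside : ∀ (ω : ℕ → ℕ) →
      ∑ (λ v → 𝟙 (inside? v) * ω (H ∸ depth v)) ≡ below (suc H) (λ j → width k (H ∸ j) * ω j)
    ∑-inside ω = begin
      ∑ (λ v → 𝟙 (inside? v) * ω (H ∸ depth v))                   ≡⟨ sumOver-cong (allFin n) pointwise ⟩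
      ∑ (λ v → below (suc H) (λ j → 𝟙 (at? (H ∸ j) v) * ω j))     ≡⟨ below-swap (allFin n) (suc H) _ ⟩
      below (suc H) (λ j → ∑ (λ v → 𝟙 (at? (H ∸ j) v) * ω j))
        ≡⟨ below-cong (suc H) (λ j _ → trans (sumOver-*ʳ (allFin n) _ (ω j)) (cong (_* ω j) (count (H ∸ j) (m∸n≤m H j)))) ⟩
      below (suc H) (λ j → width k (H ∸ j) * ω j)                 ∎
      where
        open ≡-Reasoning
        pointwise : ∀ v → 𝟙 (inside? v) * ω (H ∸ depth v) ≡ below (suc H) (λ j → 𝟙 (at? (H ∸ j) v) * ω j)
        pointwise v = aux (inside? v)
          where
            other : Inside v → ∀ i → i < suc H → i ≢ H ∸ depth v → 𝟙 (at? (H ∸ i) v) * ω i ≡ 0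
            other iv i (s≤s i≤H) i≢ = cong (_* ω i) (𝟙-no (at? (H ∸ i) v)
              λ (_ , eq) → i≢ (trans (sym (m∸[m∸n]≡n i≤H)) (cong (H ∸_) (sym eq))))
            aux : (iv? : Dec (Inside v)) → 𝟙 iv? * ω (H ∸ depth v) ≡ below (suc H) (λ j → 𝟙 (at? (H ∸ j) v) * ω j)
            aux (no ¬iv) = sym (below-0 (suc H) λ i _ → cong (_* ω i) (𝟙-no (at? (H ∸ i) v) (¬iv ∘ proj₁)))
            aux (yes iv) = sym (trans (below-single (suc H) (H ∸ depth v) (s≤s (m∸n≤m H (depth v))) (other iv))
              (cong (_* ω (H ∸ depth v)) (𝟙-yes (at? (H ∸ (H ∸ depth v)) v) (iv , sym (m∸[m∸n]≡n (depth≤H iv))))))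

-- Lower bound

-- `λ′ y` is the excess claimed when y stands between two other vertices, and `κ` is the exemption
-- granted by a central neighbour in the order.
module _ {n : ℕ} (G : Graph n) (f L λ′ κ : Fin n → ℕ) (g : ℕ) where

  private
    A N : Fin n → ℕ
    A v = 2 * g + λ′ v
    N v = 4 * L v + 2 * κ v

    last : Fin n → List (Fin n) → Fin n
    last x []       = x
    last x (y ∷ ys) = last y ys

    last-∈ : ∀ x ys → last x ys ∈ˡ x ∷ ys
    last-∈ x []       = here refl
    last-∈ x (y ∷ ys) = there (last-∈ y ys)

    _≼_ : Fin n → Fin n → Set
    u ≼ v = f u ≤ f v

  module _
    (pair   : ∀ {u v} → u ≢ v → f u ≤ f v → f u + g ≤ f v + (L u + L v))
    (triple : ∀ {x y z} → x ≢ y → y ≢ z → x ≢ z → f x ≤ f y → f y ≤ f z →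
              f x + 2 * g + λ′ y ≤ f z + (L x + 2 * L y + L z) + κ x + κ z) where

    private
      -- The sum of `triple` over consecutive triples telescopes and counts every inner gap twice.
      -- The last gap occurs in one triple only and is supplied once more by `pair`; `chain-end`
      -- does the same for the first gap.
      chain : ∀ x y r → Linked _≼_ (x ∷ y ∷ r) → Unique (x ∷ y ∷ r) →
        f x + f y + sumOver (y ∷ r) A + (L y + κ y) + (2 * L (last y r) + κ (last y r)) ≤
        2 * f (last y r) + sumOver (y ∷ r) N + (L x + κ x) + λ′ (last y r) + g
      chain x y [] (x≼y ∷ _) ((x≢y ∷ _) ∷ _) =
        chain-base {f x} {f y} {g} {L x} {L y} {λ′ y} {κ x} {κ y} (pair x≢y x≼y)
      chain x y (z ∷ r) (x≼y ∷ y≼z ∷ lk) ((x≢y ∷ x≢z ∷ _) ∷ (y≢z ∷ y∉) ∷ u) =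
        chain-step {f x} {f y} {f z} {f (last z r)} {g} {L x} {L y} {L z} {_} {sumOver (z ∷ r) A} {sumOver (z ∷ r) N}
          {λ′ y} {κ x} {κ y} {κ z} {λ′ (last z r)}
          (triple x≢y y≢z x≢z x≼y y≼z) (chain y z r (y≼z ∷ lk) ((y≢z ∷ y∉) ∷ u))

      open Sort (On.decTotalOrder ≤-decTotalOrder f)

      order : List (Fin n)
      order = sort (allFin n)

    -- The corrections belong to the two ends of the order: an end has one neighbour instead of two,
    -- which returns `2 * L + κ`, and it is the middle of no triple, which loses `λ′`. There is one
    -- gap fewer than vertices, hence `2 * g`.
    span-bound : 2 ≤ n → ∀ {s} → Span G f s → ∃₂ λ x z → x ≢ z ×
      ∑ A + (2 * L x + κ x) + (2 * L z + κ z) ≤ 2 * s + ∑ N + λ′ x + λ′ z + 2 * g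
    span-bound 2≤n {s} (_ , max) = from-order order (sort-↭ (allFin n)) (sort-↗ (allFin n))
        (Permutation.Unique-resp-↭ (setoid (Fin n)) (↭⇒↭ₛ (↭-sym (sort-↭ (allFin n)))) (allFin⁺ n))
      where
        short : ∀ {xs} → xs ↭ allFin n → length xs ≤ 1 → ∀ {Q : Set} → Q
        short p len≤1 = contradiction
          (≤-trans 2≤n (≤-trans (≤-reflexive (sym (trans (↭-length p) (length-tabulate {n = n} id)))) len≤1))
          λ { (s≤s ()) }
        from-order : ∀ xs → xs ↭ allFin n → Linked _≼_ xs → Unique xs → ∃₂ λ x z → x ≢ z ×
          ∑ A + (2 * L x + κ x) + (2 * L z + κ z) ≤ 2 * s + ∑ N + λ′ x + λ′ z + 2 * g
        from-order []           p _ _ = short p z≤n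
        from-order (_ ∷ [])     p _ _ = short p (s≤s z≤n)
        from-order (x ∷ y ∷ r) p lk@(x≼y ∷ _) u@((x≢y ∷ x∉) ∷ _) = x , z , All.lookup (x≢y ∷ x∉) (last-∈ y r) ,
          subst₂ (λ S T → S + (2 * L x + κ x) + (2 * L z + κ z) ≤ 2 * s + T + λ′ x + λ′ z + 2 * g)
            (sumOver-↭ A p) (sumOver-↭ N p)
            (chain-end {f x} {f y} {f z} {s} {g} {L x} {L y} {L z} {sumOver (y ∷ r) A} {sumOver (y ∷ r) N}
              {λ′ x} {λ′ z} {κ x} {κ y} {κ z} (pair x≢y x≼y) (span≥ z) (chain x y r lk u))
          where
            z = last y r
            span≥ : ∀ v → f v ≤ f x + s
            span≥ v = ≤-trans (m≤n+∣m-n∣ (f v) (f x)) (+-monoʳ-≤ (f x) (max (v , x , refl)))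

-- Enumeration of a half-tree

module Layout (k : ℕ → ℕ) (H : ℕ) where

  -- Row j holds the vertices at height j = H ∸ depth, so that leaves come first.
  row : ℕ → ℕ
  row j = width k (H ∸ j)

  rows : (ℕ → ℕ) → ℕ → ℕ
  rows w j = below j (λ i → row i * w i)

  -- The total weight of everything listed before item c of row j.
  value : (ℕ → ℕ) → ℕ → ℕ → ℕ
  value w j c = rows w j + c * w j

  position : ℕ → ℕ → ℕ
  position = value (λ _ → 1)

  data Before (j c j′ c′ : ℕ) : Set where
    earlier-row : j < j′ → Before j c j′ c′
    same-row    : j ≡ j′ → c < c′ → Before j c j′ c′

  compare-items : ∀ j c j′ c′ → Before j c j′ c′ ⊎ (j ≡ j′ × c ≡ c′) ⊎ Before j′ c′ j c
  compare-items j c j′ c′ with <-cmp j j′ | <-cmp c c′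
  ... | tri< lt _ _ | _            = inj₁ (earlier-row lt)
  ... | tri> _ _ gt | _            = inj₂ (inj₂ (earlier-row gt))
  ... | tri≈ _ eq _ | tri< lt _ _  = inj₁ (same-row eq lt)
  ... | tri≈ _ eq _ | tri≈ _ eq′ _ = inj₂ (inj₁ (eq , eq′))
  ... | tri≈ _ eq _ | tri> _ _ gt  = inj₂ (inj₂ (same-row (sym eq) gt))

  value-≤-row : ∀ w {j c} → c < row j → value w j c + w j ≤ rows w (suc j)
  value-≤-row w {j} {c} c< = begin
    rows w j + c * w j + w j   ≡⟨ +-assoc (rows w j) _ _ ⟩
    rows w j + (c * w j + w j) ≡⟨ cong (rows w j +_) (+-comm (c * w j) (w j)) ⟩
    rows w j + suc c * w j     ≤⟨ +-monoʳ-≤ (rows w j) (*-monoˡ-≤ (w j) c<) ⟩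
    rows w j + row j * w j     ∎
    where open ≤-Reasoning

  value-before : ∀ w {j c j′ c′} → c < row j → Before j c j′ c′ → value w j c + w j ≤ value w j′ c′
  value-before w {j} {c} {j′} {c′} c< (earlier-row j<j′) =
    ≤-trans (value-≤-row w c<) (≤-trans (below-mono _ j<j′) (m≤m+n _ _))
  value-before w {j} {c} {_} {c′} c< (same-row refl c<c′) = begin
    rows w j + c * w j + w j   ≡⟨ +-assoc (rows w j) _ _ ⟩
    rows w j + (c * w j + w j) ≡⟨ cong (rows w j +_) (+-comm (c * w j) (w j)) ⟩
    rows w j + suc c * w j     ≤⟨ +-monoʳ-≤ (rows w j) (*-monoˡ-≤ (w j) c<c′) ⟩
    rows w j + c′ * w j        ∎
    where open ≤-Reasoning

  position-before : ∀ {j c j′ c′} → c < row j → Before j c j′ c′ → position j c < position j′ c′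
  position-before c< b = ≤-trans (≤-reflexive (+-comm 1 _)) (value-before (λ _ → 1) c< b)

  rows-linear : ∀ w j → rows (λ i → w i + 2) j ≡ rows w j + 2 * rows (λ _ → 1) j
  rows-linear w zero    = refl
  rows-linear w (suc j) = trans (cong (_+ row j * (w j + 2)) (rows-linear w j))
    (linear-step (rows w j) (rows (λ _ → 1) j) (row j) (w j))

  value-linear : ∀ w j c → value (λ i → w i + 2) j c ≡ value w j c + 2 * position j c
  value-linear w j c = trans (cong (_+ c * (w j + 2)) (rows-linear w j))
    (linear-step (rows w j) (rows (λ _ → 1) j) c (w j))

  -- Each of the m items strictly between two items contributes at least 2.
  value-gap : ∀ w {j c j′ c′ m} → c < row j → Before j c j′ c′ → position j′ c′ ≡ position j c + suc m →
    value (λ i → w i + 2) j c + (w j + 2) + 2 * m ≤ value (λ i → w i + 2) j′ c′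
  value-gap w {j} {c} {j′} {c′} {m} c< b eq
    rewrite value-linear w j c | value-linear w j′ c′ =
    gap-arith {value w j c} {position j c} {value w j′ c′} {position j′ c′} {w j} {m} (value-before w c< b) eq

  -- Every row of depth at least φ has a multiple of `width k φ` items. Hence positions of such
  -- items are congruent as soon as their codes are.
  rows-∣ : ∀ φ j → φ ≤ H → j ≤ suc (H ∸ φ) → width k φ ∣ rows (λ _ → 1) j
  rows-∣ φ zero    _   _          = width k φ ∣0
  rows-∣ φ (suc j) φ≤H (s≤s j≤) = ∣m∣n⇒∣m+n (rows-∣ φ j φ≤H (m≤n⇒m≤1+n j≤)) (∣m⇒∣m*n 1 (width-∣ k φ≤H∸j))
    where
      φ≤H∸j : φ ≤ H ∸ j
      φ≤H∸j = ≤-trans (≤-reflexive (sym (m∸[m∸n]≡n φ≤H))) (∸-monoʳ-≤ H j≤)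

module Spread {n : ℕ} (G : Graph n) (connected : Connected G) (acyclic : ¬ Cycle G)
  (p a : Fin n) (p~a : Graph._~_ G p a) (k : ℕ → ℕ) (H : ℕ)
  (depth≤H : ∀ {v} → HalfTree.Inside G connected acyclic p a p~a k H v →
    HalfTree.depth G connected acyclic p a p~a k H v ≤ H)
  (degrees : ∀ {v} → HalfTree.Inside G connected acyclic p a p~a k H v →
    HalfTree.depth G connected acyclic p a p~a k H v < H →
    degree G v ≡ suc (k (HalfTree.depth G connected acyclic p a p~a k H v))) where

  open TreeMetric G connected acyclic
  open HalfTree G connected acyclic p a p~a k H public
  open Regular depth≤H degrees public
  open Layout k H public

  height : Fin n → ℕ
  height v = H ∸ depth v

  place : Fin n → ℕ
  place v = position (height v) (code v)

  depth+height : ∀ {v} → Inside v → depth v + height v ≡ H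
  depth+height iv = m+[n∸m]≡n (depth≤H iv)

  code-<-row : ∀ {v} → Inside v → code v < row (height v)
  code-<-row {v} iv = subst (λ t → code v < width k t) (sym (m∸[m∸n]≡n (depth≤H iv))) (code-< iv)

  height-code-injective : ∀ {u v} → Inside u → Inside v → height u ≡ height v → code u ≡ code v → u ≡ v
  height-code-injective {u} {v} iu iv hu≡hv = code-injective iu iv
    (trans (sym (m∸[m∸n]≡n (depth≤H iu))) (trans (cong (H ∸_) hu≡hv) (m∸[m∸n]≡n (depth≤H iv))))

  -- `wrapped` is the gap measured the other way round: `u` is shifted by a full turn through all
  -- vertices of depth at least `φ`, which preserves the congruence. It serves the side that is
  -- listed cyclically.
  record Spaced (u v : Fin n) : Set where
    field
      φ         : ℕ
      φ≤depth   : φ ≤ depth u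
      far       : depth u + depth v ≤ d u v + 2 * φ
      apart     : place u + width k φ ≤ place v
      wrapped   : place v + width k φ ≤ place u + rows (λ _ → 1) (suc (H ∸ φ))

  spaced : ∀ {u v} → Inside u → Inside v → Before (height u) (code u) (height v) (code v) → Spaced u v
  spaced {u} {v} iu iv b with separated iu iv
  ... | φ , φ≤u , φ≤v , codes , far = record
    { φ = φ ; φ≤depth = φ≤u ; far = far
    ; apart = congruent-< places (position-before (code-<-row iu) b)
    ; wrapped = congruent-< (subst (λ x → Congruent (width k φ) x (place u + full)) (+-identityʳ (place v))
        (subst₂ (Congruent (width k φ)) (+-comm 0 (place v)) (+-comm full (place u))
          (congruent-+ (congruent-sym places) (width k φ ∣0) (rows-∣ φ _ φ≤H ≤-refl))))
        (<-≤-trans v<full (m≤n+m full (place u))) }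
    where
      full = rows (λ _ → 1) (suc (H ∸ φ))
      φ≤H : φ ≤ H
      φ≤H = ≤-trans φ≤u (depth≤H iu)
      codes′ : Congruent (width k φ) (code u * 1) (code v * 1)
      codes′ = subst₂ (Congruent (width k φ)) (sym (*-identityʳ (code u))) (sym (*-identityʳ (code v))) codes
      height≤ : ∀ {w} → φ ≤ depth w → height w ≤ H ∸ φ
      height≤ = ∸-monoʳ-≤ H
      places : Congruent (width k φ) (place u) (place v)
      places = congruent-+ codes′ (rows-∣ φ _ φ≤H (m≤n⇒m≤1+n (height≤ φ≤u))) (rows-∣ φ _ φ≤H (m≤n⇒m≤1+n (height≤ φ≤v)))
      v<full : place v < full
      v<full = ≤-trans (≤-trans (≤-reflexive (+-comm 1 _)) (value-≤-row (λ _ → 1) {height v} (code-<-row iv)))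
        (below-mono _ (s≤s (height≤ φ≤v)))

-- Radio labellings

argmax : ∀ {n} (w : Fin (suc n) → ℕ) → ∃ λ i → ∀ j → w j ≤ w i
argmax {zero}  w = fzero , λ { fzero → ≤-refl }
argmax {suc n} w with argmax (w ∘ fsuc)
... | i , max with ≤-total (w fzero) (w (fsuc i))
...   | inj₁ le = fsuc i , λ { fzero → le ; (fsuc j) → max j }
...   | inj₂ ge = fzero , λ { fzero → ≤-refl ; (fsuc j) → ≤-trans (max j) ge }

span : ∀ {n} (G : Graph n) → Fin n → (f : Fin n → ℕ) → ∃ (Span G f)
span {suc n} G _ f with argmax (λ u → ∣ f u - f (proj₁ (argmax λ v → ∣ f u - f v ∣)) ∣)
... | u , max = _ , (u , _ , refl) ,
  λ { (u′ , v′ , refl) → ≤-trans (proj₂ (argmax λ v → ∣ f u′ - f v ∣) v′) (max u′) }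

-- Of the labelling only an upper bound on its values is asked; that its span is exactly `S` follows
-- from the lower bound.
radioNumber : ∀ {n} (G : Graph n) S → Fin n → (f : Fin n → ℕ) → IsRadioLabelling G f →
  (∀ v → f v ≤ S) → (∀ f {s} → IsRadioLabelling G f → Span G f s → S ≤ s) → RadioNumber G S
radioNumber G S v₀ f radio f≤S lower with span G v₀ f
... | s , sp@((u , v , s≡) , _) = (f , radio , subst (Span G f) (≤-antisym s≤S (lower f radio sp)) sp) ,
    λ { (f′ , radio′ , sp′) → lower f′ radio′ sp′ }
  where
    s≤S : s ≤ S
    s≤S = ≤-trans (≤-reflexive s≡) (≤-trans (∣m-n∣≤m⊔n (f u) (f v)) (⊔-lub (f≤S u) (f≤S v)))

module Radio {n : ℕ} (G : Graph n) (connected : Connected G) {D : ℕ} (diam : Diameter G D) where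
  open Metric G connected

  diameter-unique : ∀ {D′} → Diameter G D′ → D′ ≡ D
  diameter-unique (w , max) = ≤-antisym (proj₂ diam w) (max (proj₁ diam))

  module _ (f : Fin n → ℕ) where

    -- The radio condition freed of truncated subtraction and absolute difference, so that it can be
    -- fed to linear arithmetic.
    Far : Fin n → Fin n → Set
    Far u v = f u + (D + 1) ≤ f v + d u v ⊎ f v + (D + 1) ≤ f u + d u v

    private
      gap : ∀ a b {x e} → a + x ≤ b + e → x ∸ e ≤ ∣ a - b ∣
      gap a b {x} {e} le = m≤n+o⇒m∸n≤o x e (+-cancelˡ-≤ a x (e + ∣ a - b ∣) (begin
        a + x               ≤⟨ le ⟩
        b + e               ≤⟨ +-monoˡ-≤ e (m≤n+∣n-m∣ b a) ⟩
        a + ∣ a - b ∣ + e   ≡⟨ +-assoc a _ e ⟩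
        a + (∣ a - b ∣ + e) ≡⟨ cong (a +_) (+-comm _ e) ⟩
        a + (e + ∣ a - b ∣) ∎))
        where open ≤-Reasoning

    radio-labelling : (∀ {u v} → u ≢ v → Far u v) → IsRadioLabelling G f
    radio-labelling far diam′ {u} {v} u≢v dist rewrite diameter-unique diam′ | Distance⇒≡d dist with far u≢v
    ... | inj₁ le = gap (f u) (f v) le
    ... | inj₂ le = ≤-trans (gap (f v) (f u) le) (≤-reflexive (∣-∣-comm (f v) (f u)))

    radio-gap : IsRadioLabelling G f → ∀ {u v} → u ≢ v → f u ≤ f v → f u + (D + 1) ≤ f v + d u v
    radio-gap radio {u} {v} u≢v fu≤fv = begin
      f u + (D + 1)                           ≤⟨ +-monoʳ-≤ (f u) (m≤n+m∸n (D + 1) (d u v)) ⟩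
      f u + (d u v + (D + 1 ∸ d u v))         ≤⟨ +-monoʳ-≤ (f u) (+-monoʳ-≤ (d u v) (radio diam u≢v (d-Distance u v))) ⟩
      f u + (d u v + ∣ f u - f v ∣)           ≡⟨ cong (λ x → f u + (d u v + x)) (m≤n⇒∣m-n∣≡n∸m fu≤fv) ⟩
      f u + (d u v + (f v ∸ f u))             ≡⟨ cong (f u +_) (+-comm (d u v) _) ⟩
      f u + (f v ∸ f u + d u v)               ≡⟨ +-assoc (f u) _ _ ⟨
      f u + (f v ∸ f u) + d u v               ≡⟨ cong (_+ d u v) (m+[n∸m]≡n fu≤fv) ⟩
      f v + d u v                             ∎
      where open ≤-Reasoning

twoNeighbours : ∀ {n} (G : Graph n) c → degree G c ≡ 2 → let open Graph G in
  ∃₂ λ a b → a ≢ b × c ~ a × c ~ b × (∀ {w} → c ~ w → w ≡ a ⊎ w ≡ b)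
twoNeighbours {n} G c deg = from (filter (c ~?_) (allFin n)) deg (filter⁺ (c ~?_) {xs = allFin n} (allFin⁺ n))
    (λ w∈ → proj₂ (∈-filter⁻ (c ~?_) {xs = allFin n} w∈)) (λ e → ∈-filter⁺ (c ~?_) (∈-allFin _) e)
  where
    open Graph G
    from : ∀ xs → length xs ≡ 2 → Unique xs → (∀ {w} → w ∈ˡ xs → c ~ w) → (∀ {w} → c ~ w → w ∈ˡ xs) →
      ∃₂ λ a b → a ≢ b × c ~ a × c ~ b × (∀ {w} → c ~ w → w ≡ a ⊎ w ≡ b)
    from (a ∷ b ∷ []) _ ((a≢b ∷ []) ∷ _) sound complete =
      a , b , a≢b , sound (here refl) , sound (there (here refl)) , λ e → cases (complete e)
      where
        cases : ∀ {w} → w ∈ˡ a ∷ b ∷ [] → w ≡ a ⊎ w ≡ b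
        cases (here eq)         = inj₁ eq
        cases (there (here eq)) = inj₂ eq

-- Applied to a height this singles out the leaves, applied to a level the central vertices.
leaf : ℕ → ℕ
leaf zero    = 1
leaf (suc _) = 0

-- From depth `b` on the width at least doubles with each level. One central vertex needs `b = 0`;
-- with two, the root of a half has a single child and `b = 1`.
width-growth : ∀ k {b} t → (∀ i → i < t → b ≤ i → 2 ≤ k i) → (∀ i → i < b → 1 ≤ k i) → t ∸ b < width k t
width-growth k {b} zero    _ _ = ≤-trans (s≤s (≤-reflexive (0∸n≡0 b))) ≤-refl
width-growth k {b} (suc t) 2≤k 1≤k with b ≤? t
... | yes b≤t = begin
  suc (suc t ∸ b)       ≡⟨ cong suc (+-∸-assoc 1 b≤t) ⟩
  suc (suc (t ∸ b))     ≤⟨ s≤s (s≤s (m≤m+n (t ∸ b) (t ∸ b))) ⟩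
  suc (suc (t ∸ b + (t ∸ b))) ≡⟨ cong suc (+-suc (t ∸ b) (t ∸ b)) ⟨
  suc (t ∸ b) + suc (t ∸ b) ≤⟨ +-mono-≤ ih ih ⟩
  width k t + width k t ≡⟨ cong (width k t +_) (+-identityʳ _) ⟨
  2 * width k t         ≡⟨ *-comm 2 (width k t) ⟩
  width k t * 2         ≤⟨ *-monoʳ-≤ (width k t) (2≤k t ≤-refl b≤t) ⟩
  width k t * k t       ∎
  where
    open ≤-Reasoning
    ih = width-growth k {b} t (λ i i<t → 2≤k i (m≤n⇒m≤1+n i<t)) 1≤k
... | no b≰t = begin
  suc (suc t ∸ b)       ≡⟨ cong suc (m≤n⇒m∸n≡0 (≰⇒> b≰t)) ⟩
  1                     ≤⟨ *-mono-≤ (≤-trans (s≤s z≤n) ih) (1≤k t (≰⇒> b≰t)) ⟩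
  width k t * k t       ∎
  where
    open ≤-Reasoning
    ih = width-growth k {b} t (λ i i<t → 2≤k i (m≤n⇒m≤1+n i<t)) 1≤k

leaf≤1 : ∀ j → leaf j ≤ 1
leaf≤1 zero    = ≤-refl
leaf≤1 (suc _) = z≤n

leaf-pos : ∀ {j} → 0 < j → leaf j ≡ 0
leaf-pos {suc _} _ = refl

-- `weight e j + 2` is the advance of the labels over one pair of opposite vertices at height `j`,
-- with the excess `e` for leaves. The 2 is kept apart because `value-gap` counts it once per item
-- in between.
weight : ℕ → ℕ → ℕ
weight e j = 4 * j + e * leaf j

-- t = 0 for one central vertex and t = 1 for two, where opposite vertices are one step further apart.
module LowerBound {n : ℕ} (G : Graph n) (connected : Connected G) {h t e : ℕ}
  (diam : Diameter G (h + h + t)) (L : Fin n → ℕ) (1≤h : 1 ≤ h) (e≤ : e ≤ suc t)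
  (L≤h : ∀ v → L v ≤ h) where

  open Metric G connected

  Close : Fin n → Fin n → Set
  Close u v = d u v + 2 ≤ L u + L v

  κ ℓ : Fin n → ℕ
  κ v = e * leaf (L v)
  ℓ v = e * leaf (h ∸ L v)

  module _
    (near  : ∀ u v → d u v ≤ L u + L v + t)
    (close : ∀ {x y z} → L x ≢ 0 → L y ≢ 0 → L z ≢ 0 → Close x z ⊎ Close x y ⊎ Close y z) where

    private
      ω : Fin n → ℕ
      ω v = weight e (h ∸ L v) + 2

      g : ℕ
      g = h + h + 1

      e*leaf≤e : ∀ j → e * leaf j ≤ e
      e*leaf≤e j = ≤-trans (*-monoʳ-≤ e (leaf≤1 j)) (≤-reflexive (*-identityʳ e))

      κ-root : ∀ {v} → L v ≡ 0 → κ v ≡ e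
      κ-root Lv≡0 = trans (cong (λ l → e * leaf l) Lv≡0) (*-identityʳ e)

      g+t : h + h + t + 1 ≡ g + t
      g+t = trans (+-assoc (h + h) t 1) (trans (cong (h + h +_) (+-comm t 1)) (sym (+-assoc (h + h) 1 t)))

    module _ (f : Fin n → ℕ) (radio : IsRadioLabelling G f) where

      private
        gap : ∀ {u v} → u ≢ v → f u ≤ f v → f u + (g + t) ≤ f v + d u v
        gap {u} {v} u≢v le = subst (λ x → f u + x ≤ f v + d u v) g+t (Radio.radio-gap G connected diam f radio u≢v le)

        pair : ∀ {u v} → u ≢ v → f u ≤ f v → f u + g ≤ f v + (L u + L v)
        pair {u} {v} u≢v le = drop-slack {f u} {f v} {d u v} {g} {t} (gap u≢v le) {L u + L v} (near u v)

        triple : ∀ {x y z} → x ≢ y → y ≢ z → x ≢ z → f x ≤ f y → f y ≤ f z →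
          f x + 2 * g + ℓ y ≤ f z + (L x + 2 * L y + L z) + κ x + κ z
        triple {x} {y} {z} x≢y y≢z x≢z fx≤fy fy≤fz = by-cases (h ≤? L y) (L x ℕ.≟ 0) (L z ℕ.≟ 0)
          where
            pairs : ℓ y ≤ κ x + κ z → f x + 2 * g + ℓ y ≤ f z + (L x + 2 * L y + L z) + κ x + κ z
            pairs = triple-pairs {f x} {f y} {f z} {g} {L x} {L y} {L z} (pair x≢y fx≤fy) (pair y≢z fy≤fz)
            ℓ≤ : ℓ y ≤ suc t
            ℓ≤ = ≤-trans (e*leaf≤e (h ∸ L y)) e≤
            by-cases : Dec (h ≤ L y) → Dec (L x ≡ 0) → Dec (L z ≡ 0) →
              f x + 2 * g + ℓ y ≤ f z + (L x + 2 * L y + L z) + κ x + κ z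
            by-cases (no h≰Ly) _ _ = pairs (≤-trans
              (≤-reflexive (trans (cong (e *_) (leaf-pos (m<n⇒0<n∸m (≰⇒> h≰Ly)))) (*-zeroʳ e))) z≤n)
            by-cases (yes _) (yes Lx≡0) _ = pairs (≤-trans (e*leaf≤e (h ∸ L y))
              (≤-trans (≤-reflexive (sym (κ-root Lx≡0))) (m≤m+n (κ x) (κ z))))
            by-cases (yes _) (no _) (yes Lz≡0) = pairs (≤-trans (e*leaf≤e (h ∸ L y))
              (≤-trans (≤-reflexive (sym (κ-root Lz≡0))) (m≤n+m (κ z) (κ x))))
            by-cases (yes h≤Ly) (no Lx≢0) (no Lz≢0)
              with close Lx≢0 (λ Ly≡0 → <⇒≢ (≤-trans 1≤h h≤Ly) (sym Ly≡0)) Lz≢0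
            ... | inj₁ xz = triple-close-xz {f x} {f z} {h} {t} {L x} {L y} {L z} {ℓ y} {κ x} {κ z} {d x z}
                    (gap x≢z (≤-trans fx≤fy fy≤fz)) xz ℓ≤ h≤Ly
            ... | inj₂ (inj₁ xy) = triple-close-xy {f x} {f y} {f z} {g} {t} {L x} {L y} {L z} {ℓ y} {κ x} {κ z} {d x y}
                    (gap x≢y fx≤fy) xy (pair y≢z fy≤fz) ℓ≤
            ... | inj₂ (inj₂ yz) = triple-close-yz {f x} {f y} {f z} {g} {t} {L x} {L y} {L z} {ℓ y} {κ x} {κ z} {d y z}
                    (pair x≢y fx≤fy) (gap y≢z fy≤fz) yz ℓ≤

      -- Since `2 * g` is `4 * L v + 4 * (h ∸ L v) + 2`, the levels cancel from both sides of
      -- `span-bound`, and every vertex keeps the weight that the layout gives to its height.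
      weighted-span : ∀ {X K} → ∑ (λ v → weight e (h ∸ L v) + 2) ≡ X → ∑ κ ≡ K →
        2 ≤ n → ∀ {s} → Span G f s → ∃₂ λ x z → x ≢ z ×
        X + (2 * L x + κ x) + (2 * L z + κ z) ≤ 2 * s + 2 * K + ℓ x + ℓ z + 2 * (h + h + 1)
      weighted-span refl refl 2≤n {s} sp with span-bound G f L ℓ κ g pair triple 2≤n sp
      ... | x , z , x≢z , bound = x , z , x≢z ,
          cancel-levels {∑ (λ v → 4 * L v)} {∑ ω} {2 * L x + κ x} {2 * L z + κ z} {2 * g} {2 * ∑ κ} {s} {ℓ x} {ℓ z}
            (subst₂ (λ S T → S + (2 * L x + κ x) + (2 * L z + κ z) ≤ 2 * s + T + ℓ x + ℓ z + 2 * g) S≡ T≡ bound)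
        where
          pointwise : ∀ v → 2 * g + ℓ v ≡ 4 * L v + ω v
          pointwise v = subst (λ k → 2 * (k + k + 1) + ℓ v ≡ 4 * L v + ω v) (m+[n∸m]≡n (L≤h v))
            (weight-split (L v) (h ∸ L v) (ℓ v))
          S≡ : ∑ (λ v → 2 * g + ℓ v) ≡ ∑ (λ v → 4 * L v) + ∑ ω
          S≡ = trans (sumOver-cong (allFin n) pointwise) (sumOver-+ (allFin n) _ _)
          T≡ : ∑ (λ v → 4 * L v + 2 * κ v) ≡ ∑ (λ v → 4 * L v) + 2 * ∑ κ
          T≡ = trans (sumOver-+ (allFin n) _ _) (cong (∑ (λ v → 4 * L v) +_) (sumOver-*ˡ (allFin n) 2 κ))

-- One central vertex

distinct⇒2≤n : ∀ {n} {u v : Fin n} → u ≢ v → 2 ≤ n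
distinct⇒2≤n {suc zero}    {Fin.zero} {Fin.zero} u≢v = contradiction refl u≢v
distinct⇒2≤n {suc (suc n)} _   = s≤s (s≤s z≤n)

-- For positions, `m` is the number of items strictly in between, the quantity that `value-gap`
-- rewards.
split-gap : ∀ {a b w} → a < b → a + w ≤ b → ∃ λ m → b ≡ a + suc m × w ≤ suc m
split-gap {a} {b} {w} a<b le = b ∸ suc a , eq , +-cancelˡ-≤ a w _ (≤-trans le (≤-reflexive eq))
  where
    eq : b ≡ a + suc (b ∸ suc a)
    eq = trans (sym (m+[n∸m]≡n a<b)) (sym (+-suc a _))

1≤2j+leaf : ∀ j → 1 ≤ 2 * j + 1 * leaf j
1≤2j+leaf zero    = ≤-refl
1≤2j+leaf (suc j) = s≤s z≤n

module OneCentre {n : ℕ} (G : Graph n) (connected : Connected G) (acyclic : ¬ Cycle G)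
  (H : ℕ) (1≤H : 1 ≤ H) (k : ℕ → ℕ) (2≤k : ∀ i → i < H → 2 ≤ k i)
  (c : Fin n) (centre-degree : degree G c ≡ 2)
  (bounded : ∀ v → Metric.d G connected c v ≤ suc H)
  (degrees : ∀ v → Metric.d G connected c v ≢ 0 → Metric.d G connected c v < suc H →
    degree G v ≡ suc (k (Metric.d G connected c v ∸ 1)))
  (diam : Diameter G (suc H + suc H)) where

  open Graph G
  open TreeMetric G connected acyclic

  private
    nbrs = twoNeighbours G c centre-degree
    a b : Fin n
    a = proj₁ nbrs
    b = proj₁ (proj₂ nbrs)
    a≢b : a ≢ b
    a≢b = proj₁ (proj₂ (proj₂ nbrs))
    c~a : c ~ a
    c~a = proj₁ (proj₂ (proj₂ (proj₂ nbrs)))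
    c~b : c ~ b
    c~b = proj₁ (proj₂ (proj₂ (proj₂ (proj₂ nbrs))))
    a-or-b : ∀ {w} → c ~ w → w ≡ a ⊎ w ≡ b
    a-or-b = proj₂ (proj₂ (proj₂ (proj₂ (proj₂ nbrs))))

    level-inside : ∀ {x v} → d v c ≡ suc (d v x) → d c v ≡ suc (d v x)
    level-inside {x} {v} iv = trans (d-sym c v) iv

    depth≤ : ∀ {x v} → d v c ≡ suc (d v x) → d v x ≤ H
    depth≤ {x} {v} iv = ≤-pred (≤-trans (≤-reflexive (sym (level-inside iv))) (bounded v))

    deg : ∀ {x v} → d v c ≡ suc (d v x) → d v x < H → degree G v ≡ suc (k (d v x))
    deg {x} {v} iv lt = trans (degrees v (λ eq → 1+n≢0 (trans (sym (level-inside iv)) eq))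
      (≤-trans (s≤s (≤-reflexive (level-inside iv))) (s≤s lt)))
      (cong (λ l → suc (k (l ∸ 1))) (level-inside iv))

    module A = Spread G connected acyclic c a c~a k H depth≤ deg
    module B = Spread G connected acyclic c b c~b k H depth≤ deg
    open Layout k H

    data Kind (v : Fin n) : Set where
      centre : v ≡ c → Kind v
      sideA  : A.Inside v → Kind v
      sideB  : B.Inside v → Kind v

    kind : ∀ v → Kind v
    kind v with c ≟ v
    ... | yes refl = centre refl
    ... | no c≢v with step c≢v
    ...   | q , c~q , dq with a-or-b c~q
    ...     | inj₁ refl = sideA (trans (d-sym v c) (trans dq (cong suc (d-sym q v))))
    ...     | inj₂ refl = sideB (trans (d-sym v c) (trans dq (cong suc (d-sym q v))))

    disjoint : ∀ {v} → A.Inside v → ¬ B.Inside v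
    disjoint {v} iA iB = a≢b (parent-unique c~a (≤-trans (n≤1+n _) (≤-reflexive (sym (flip iA)))) c~b (flip iB))
      where
        flip : ∀ {x} → d v c ≡ suc (d v x) → d c v ≡ suc (d x v)
        flip {x} eq = trans (d-sym c v) (trans eq (cong suc (d-sym v x)))

    disjoint′ : ∀ {v} → B.Inside v → ¬ A.Inside v
    disjoint′ iB iA = disjoint iA iB

    centre-outside : ∀ {x v} → v ≡ c → ¬ (d v c ≡ suc (d v x))
    centre-outside refl eq = 1+n≢0 (trans (sym eq) (d-refl c))

    q : ℕ → ℕ
    q j = weight 1 j + 2

    R : ℕ
    R = rows q (suc H)

    valueA valueB : Fin n → ℕ
    valueA v = value q (A.height v) (A.code v)
    valueB v = value q (B.height v) (B.code v)

    -- The vertices are labelled in the order c, A₀, B₀, A₁, B₁, …; consecutive labels differ by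
    -- 2h + 1 minus both levels, and by one more between two leaves Aᵢ, Bᵢ.
    label : ∀ {v} → Kind v → ℕ
    label     (centre _) = 0
    label {v} (sideA _)  = H + 2 + A.height v + valueA v
    label {v} (sideB _)  = H + 3 + 3 * B.height v + 1 * leaf (B.height v) + valueB v

    D+1 : ℕ
    D+1 = suc H + suc H + 1

    φ<width : ∀ φ → φ ≤ H → φ < width k φ
    φ<width φ φ≤H = width-growth k {0} φ (λ i i<φ _ → 2≤k i (≤-trans i<φ φ≤H)) (λ _ ())

    forwardA : ∀ {u v} (iu : A.Inside u) (iv : A.Inside v) → Before (A.height u) (A.code u) (A.height v) (A.code v) →
      label (sideA iu) + D+1 ≤ label (sideA iv) + d u v
    forwardA {u} {v} iu iv before with A.spaced iu iv before
    ... | record { φ = φ ; φ≤depth = φ≤ ; far = far ; apart = apart }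
      with split-gap (position-before (A.code-<-row iu) before) apart
    ...   | m , eq , W≤ = same-side-A {H} {A.height u} {A.height v} {1 * leaf (A.height u)} {valueA u} {valueA v}
              {A.depth u} {A.depth v} {d u v} {m} {φ}
              (value-gap (weight 1) (A.code-<-row iu) before eq) far (≤-pred (≤-trans (φ<width φ (≤-trans φ≤ (depth≤ iu))) W≤))
              (≤-reflexive (sym (A.depth+height iu))) (≤-reflexive (sym (A.depth+height iv))) (1≤2j+leaf (A.height u))

    forwardB : ∀ {u v} (iu : B.Inside u) (iv : B.Inside v) → Before (B.height u) (B.code u) (B.height v) (B.code v) →
      label (sideB iu) + D+1 ≤ label (sideB iv) + d u v
    forwardB {u} {v} iu iv before with B.spaced iu iv before
    ... | record { φ = φ ; φ≤depth = φ≤ ; far = far ; apart = apart }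
      with split-gap (position-before (B.code-<-row iu) before) apart
    ...   | m , eq , W≤ = same-side-B {H} {B.height u} {B.height v} {1 * leaf (B.height u)} {1 * leaf (B.height v)} {valueB u} {valueB v}
              {B.depth u} {B.depth v} {d u v} {m} {φ}
              (value-gap (weight 1) (B.code-<-row iu) before eq) far (≤-pred (≤-trans (φ<width φ (≤-trans φ≤ (depth≤ iu))) W≤))
              (≤-reflexive (sym (B.depth+height iu))) (≤-reflexive (sym (B.depth+height iv))) (1≤2j+leaf (B.height v))

    d-opposite : ∀ {u v} → A.Inside u → B.Inside v → d u v ≡ A.depth u + suc (suc (B.depth v))
    d-opposite {u} {v} iu iv = trans (A.across iu (disjoint′ iv))
      (cong (A.depth u +_) (trans (A.outside (disjoint′ iv)) (cong suc iv)))

    Far′ : ∀ {u v} → Kind u → Kind v → Set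
    Far′ {u} {v} ku kv = label ku + D+1 ≤ label kv + d u v ⊎ label kv + D+1 ≤ label ku + d u v

    opposite : ∀ {u v} (iu : A.Inside u) (iv : B.Inside v) → Far′ (sideA iu) (sideB iv)
    opposite {u} {v} iu iv rewrite d-opposite iu iv with compare-items (A.height u) (A.code u) (B.height v) (B.code v)
    ... | inj₁ before = inj₁ (opposite-before {H} {A.height u} {B.height v} {1 * leaf (A.height u)} {1 * leaf (B.height v)}
            {valueA u} {valueB v} {A.depth u} {B.depth v} (value-before q (A.code-<-row iu) before)
            (≤-reflexive (sym (A.depth+height iu))) (≤-reflexive (sym (B.depth+height iv))))
    ... | inj₂ (inj₂ after) = inj₂ (opposite-after {H} {A.height u} {B.height v} {1 * leaf (B.height v)}
            {valueA u} {valueB v} {A.depth u} {B.depth v} (value-before q (B.code-<-row iv) after)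
            (≤-reflexive (sym (A.depth+height iu))) (≤-reflexive (sym (B.depth+height iv))))
    ... | inj₂ (inj₁ (heights , codes)) = inj₁ (subst₂
            (λ j x → H + 2 + j + x + D+1 ≤ H + 3 + 3 * B.height v + 1 * leaf (B.height v) + valueB v + (A.depth u + suc (suc (B.depth v))))
            (sym heights) (cong₂ (value q) (sym heights) (sym codes))
            (opposite-equal {H} {B.height v} {1 * leaf (B.height v)} {valueB v} {A.depth u} {B.depth v}
              (≤-reflexive (trans (sym (A.depth+height iu)) (cong (A.depth u +_) heights)))
              (≤-reflexive (sym (B.depth+height iv)))))

    from-centreA : ∀ {v} (iv : A.Inside v) → D+1 ≤ label (sideA iv) + d c v
    from-centreA {v} iv rewrite level-inside iv =
      centre-A {H} {A.height v} {valueA v} {A.depth v} (≤-reflexive (sym (A.depth+height iv)))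

    from-centreB : ∀ {v} (iv : B.Inside v) → D+1 ≤ label (sideB iv) + d c v
    from-centreB {v} iv rewrite level-inside iv = ≤-trans
      (centre-A {H} {B.height v} {valueB v} {B.depth v} (≤-reflexive (sym (B.depth+height iv))))
      (+-monoˡ-≤ (suc (B.depth v)) (A≤B {H} {B.height v} {1 * leaf (B.height v)} {valueB v}))

    flipped : ∀ {u v} (ku : Kind u) (kv : Kind v) → Far′ ku kv → Far′ kv ku
    flipped {u} {v} ku kv = swap ∘ subst (λ x → label ku + D+1 ≤ label kv + x ⊎ label kv + D+1 ≤ label ku + x) (d-sym u v)

    far : ∀ {u v} (ku : Kind u) (kv : Kind v) → u ≢ v → Far′ ku kv
    far (centre refl) (centre refl) u≢v = contradiction refl u≢v
    far (centre refl) (sideA iv)    _   = inj₁ (from-centreA iv)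
    far (centre refl) (sideB iv)    _   = inj₁ (from-centreB iv)
    far (sideA iu) (centre refl) _ = flipped (centre refl) (sideA iu) (inj₁ (from-centreA iu))
    far (sideB iu) (centre refl) _ = flipped (centre refl) (sideB iu) (inj₁ (from-centreB iu))
    far (sideA iu) (sideB iv) _ = opposite iu iv
    far (sideB iu) (sideA iv) _ = flipped (sideA iv) (sideB iu) (opposite iv iu)
    far {u} {v} (sideA iu) (sideA iv) u≢v with compare-items (A.height u) (A.code u) (A.height v) (A.code v)
    ... | inj₁ before           = inj₁ (forwardA iu iv before)
    ... | inj₂ (inj₂ after)     = flipped (sideA iv) (sideA iu) (inj₁ (forwardA iv iu after))
    ... | inj₂ (inj₁ (hs , cs)) = contradiction (A.height-code-injective iu iv hs cs) u≢v
    far {u} {v} (sideB iu) (sideB iv) u≢v with compare-items (B.height u) (B.code u) (B.height v) (B.code v)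
    ... | inj₁ before           = inj₁ (forwardB iu iv before)
    ... | inj₂ (inj₂ after)     = flipped (sideB iv) (sideB iu) (inj₁ (forwardB iv iu after))
    ... | inj₂ (inj₁ (hs , cs)) = contradiction (B.height-code-injective iu iv hs cs) u≢v

    top : ∀ j c′ → j ≤ H → c′ < row j → H + 3 + 3 * j + 1 * leaf j + value q j c′ ≤ 1 + R
    top j c′ j≤H c′< with m≤n⇒m<n∨m≡n j≤H
    -- Below the root, the summand `H` of the label is absorbed by the single item of the top row,
    -- of weight at least `4 * H + 2`.
    ... | inj₁ j<H = top-other {H} {j} {1 * leaf j} {1 * leaf H} {value q j c′} {rows q H} {R}
            (≤-trans (value-≤-row q {j} {c′} c′<) (below-mono _ j<H))
            (≤-reflexive (cong (rows q H +_) (sym (trans (cong (λ x → width k x * q H) (n∸n≡0 H)) (*-identityˡ (q H))))))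
    ... | inj₂ refl = top-root {H} {H} {1 * leaf H} {value q H c′} {R} (value-≤-row q {H} {c′} c′<) ≤-refl

    label≤ : ∀ {v} (kv : Kind v) → label kv ≤ 1 + R
    label≤ (centre _) = z≤n
    label≤ {v} (sideA iv) = ≤-trans (A≤B {H} {A.height v} {1 * leaf (A.height v)} {valueA v})
      (top (A.height v) (A.code v) (m∸n≤m H (A.depth v)) (A.code-<-row iv))
    label≤ {v} (sideB iv) = top (B.height v) (B.code v) (m∸n≤m H (B.depth v)) (B.code-<-row iv)

    -- Lower bound for one central vertex

    L : Fin n → ℕ
    L v = d c v

    L≢0⇒ : ∀ {v} → L v ≢ 0 → A.Inside v ⊎ B.Inside v
    L≢0⇒ {v} Lv≢0 with kind v
    ... | centre refl = contradiction (d-refl c) Lv≢0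
    ... | sideA iv = inj₁ iv
    ... | sideB iv = inj₂ iv

    diam′ : Diameter G (suc H + suc H + 0)
    diam′ = subst (Diameter G) (sym (+-identityʳ (suc H + suc H))) diam

    module LB = LowerBound G connected {suc H} {0} {1} diam′ L (s≤s z≤n) ≤-refl bounded

    close-inside : ∀ {x u v} → d u c ≡ suc (d u x) → d v c ≡ suc (d v x) → LB.Close u v
    close-inside {x} {u} {v} iu iv rewrite level-inside iu | level-inside iv = begin
      d u v + 2             ≤⟨ +-monoˡ-≤ 2 (d-triangle u x v) ⟩
      d u x + d x v + 2     ≡⟨ cong (λ y → d u x + y + 2) (d-sym x v) ⟩
      d u x + d v x + 2     ≡⟨ +-comm (d u x + d v x) 2 ⟩
      suc (suc (d u x + d v x)) ≡⟨ cong suc (+-suc (d u x) (d v x)) ⟨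
      suc (d u x) + suc (d v x) ∎
      where open ≤-Reasoning

    close : ∀ {x y z} → L x ≢ 0 → L y ≢ 0 → L z ≢ 0 → LB.Close x z ⊎ LB.Close x y ⊎ LB.Close y z
    close x≢ y≢ z≢ with L≢0⇒ x≢ | L≢0⇒ y≢ | L≢0⇒ z≢
    ... | inj₁ x | _      | inj₁ z = inj₁ (close-inside x z)
    ... | inj₂ x | _      | inj₂ z = inj₁ (close-inside x z)
    ... | inj₁ x | inj₁ y | inj₂ z = inj₂ (inj₁ (close-inside x y))
    ... | inj₁ x | inj₂ y | inj₂ z = inj₂ (inj₂ (close-inside y z))
    ... | inj₂ x | inj₁ y | inj₁ z = inj₂ (inj₂ (close-inside y z))
    ... | inj₂ x | inj₂ y | inj₁ z = inj₂ (inj₁ (close-inside x y))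

    near : ∀ u v → d u v ≤ L u + L v + 0
    near u v = ≤-trans (d-triangle u c v) (≤-reflexive (trans (cong (_+ L v) (d-sym u c)) (sym (+-identityʳ _))))

    ∑-levels : ∑ (λ v → weight 1 (suc H ∸ L v) + 2) ≡ (4 * suc H + 0 + 2) + (R + R)
    ∑-levels = begin
      ∑ (λ v → weight 1 (suc H ∸ L v) + 2)
        ≡⟨ sumOver-cong (allFin n) (λ v → pointwise (kind v)) ⟩
      ∑ (λ v → 𝟙 (v ≟ c) * (4 * suc H + 0 + 2) + (𝟙 (A.inside? v) * q (A.height v) + 𝟙 (B.inside? v) * q (B.height v)))
        ≡⟨ sumOver-+ (allFin n) _ _ ⟩
      ∑ (λ v → 𝟙 (v ≟ c) * (4 * suc H + 0 + 2)) + ∑ (λ v → 𝟙 (A.inside? v) * q (A.height v) + 𝟙 (B.inside? v) * q (B.height v))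
        ≡⟨ cong₂ _+_ (∑-single-* c (λ _ → 4 * suc H + 0 + 2)) (sumOver-+ (allFin n) _ _) ⟩
      4 * suc H + 0 + 2 + (∑ (λ v → 𝟙 (A.inside? v) * q (A.height v)) + ∑ (λ v → 𝟙 (B.inside? v) * q (B.height v)))
        ≡⟨ cong (4 * suc H + 0 + 2 +_) (cong₂ _+_ (A.∑-inside q) (B.∑-inside q)) ⟩
      4 * suc H + 0 + 2 + (R + R) ∎
      where
        open ≡-Reasoning
        pointwise : ∀ {v} → Kind v → weight 1 (suc H ∸ L v) + 2 ≡
          𝟙 (v ≟ c) * (4 * suc H + 0 + 2) + (𝟙 (A.inside? v) * q (A.height v) + 𝟙 (B.inside? v) * q (B.height v))
        pointwise {v} (centre v≡c)
          rewrite 𝟙-yes (v ≟ c) v≡c | 𝟙-no (A.inside? v) (centre-outside v≡c) | 𝟙-no (B.inside? v) (centre-outside v≡c)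
          | v≡c | d-refl c = trans (sym (+-identityʳ _)) (sym (+-identityʳ _))
        pointwise {v} (sideA iv)
          rewrite 𝟙-no (v ≟ c) (λ v≡c → centre-outside v≡c iv) | 𝟙-yes (A.inside? v) iv | 𝟙-no (B.inside? v) (disjoint iv)
          | level-inside iv = trans (sym (+-identityʳ _)) (sym (+-identityʳ _))
        pointwise {v} (sideB iv)
          rewrite 𝟙-no (v ≟ c) (λ v≡c → centre-outside v≡c iv) | 𝟙-yes (B.inside? v) iv | 𝟙-no (A.inside? v) (disjoint′ iv)
          | level-inside iv = sym (+-identityʳ _)

    ∑-κ : ∑ LB.κ ≡ 1
    ∑-κ = trans (sumOver-cong (allFin n) pointwise) (∑-single c)
      where
        pointwise : ∀ v → LB.κ v ≡ 𝟙 (v ≟ c)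
        pointwise v with v ≟ c
        ... | yes refl rewrite d-refl c = refl
        ... | no v≢c = trans (*-identityˡ _) (leaf-pos (n≢0⇒n>0 λ eq → v≢c (sym (d≡0⇒≡ eq))))

    end : ∀ v → LB.ℓ v + 1 ≤ 2 * L v + LB.κ v
    end v with L v in eq
    ... | zero = ≤-refl
    ... | suc zero = ≤-trans (≤-reflexive (cong (λ x → 1 * x + 1) (leaf-pos 1≤H))) (s≤s z≤n)
    ... | suc (suc l) = ≤-trans (+-monoˡ-≤ 1 (≤-trans (≤-reflexive (*-identityˡ _)) (leaf≤1 (H ∸ suc l))))
            (≤-trans (≤-trans (s≤s (s≤s z≤n)) (*-monoʳ-≤ 2 (s≤s (z≤n {suc l})))) (m≤m+n _ _))

    end-other : ∀ {v} → v ≢ c → LB.ℓ v + 2 ≤ 2 * L v + LB.κ v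
    end-other {v} v≢c with L v in eq
    ... | zero = contradiction (sym (d≡0⇒≡ eq)) v≢c
    -- Level 1 is tight, and `1 ≤ H` is essential: for a leaf at this level 3 would have to be at
    -- most 2.
    ... | suc zero = ≤-reflexive (cong (λ x → 1 * x + 2) (leaf-pos 1≤H))
    ... | suc (suc l) = ≤-trans (+-monoˡ-≤ 2 (≤-trans (≤-reflexive (*-identityˡ _)) (leaf≤1 (H ∸ suc l))))
            (≤-trans (≤-trans (s≤s (s≤s (s≤s z≤n))) (*-monoʳ-≤ 2 (s≤s (s≤s (z≤n {l}))))) (m≤m+n _ _))

    ends : ∀ {x z} → x ≢ z → LB.ℓ x + LB.ℓ z + 3 ≤
      (2 * L x + LB.κ x) + (2 * L z + LB.κ z)
    ends {x} {z} x≢z with x ≟ c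
    ... | no x≢c   = add-ends {LB.ℓ x} {LB.ℓ z} (end-other x≢c) (end z)
    ... | yes refl = add-ends′ {LB.ℓ c} {LB.ℓ z} (end c) (end-other (x≢z ∘ sym))

    lower : ∀ f {s} → IsRadioLabelling G f → Span G f s → 1 + R ≤ s
    lower f {s} radio sp with LB.weighted-span near close f radio ∑-levels ∑-κ (distinct⇒2≤n a≢b) sp
    -- Twice the span is at least the odd number `2 * R + 1`, so halving gains the last unit.
    ... | x , z , x≢z , bound = *-cancelˡ-< 2 R s (span-one {H} {R} {s} {LB.ℓ x} {LB.ℓ z}
            {2 * L x + LB.κ x} {2 * L z + LB.κ z} bound (ends x≢z))

  radio-number : RadioNumber G (1 + rows (λ j → weight 1 j + 2) (suc H))
  radio-number = radioNumber G (1 + R) c (λ v → label (kind v))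
    (Radio.radio-labelling G connected diam (λ v → label (kind v)) (λ {u} {v} → far (kind u) (kind v)))
    (λ v → label≤ (kind v)) lower

-- Two central vertices

2≤2j+2leaf : ∀ j → 2 ≤ 2 * j + 2 * leaf j
2≤2j+2leaf zero    = ≤-refl
2≤2j+2leaf (suc j) = ≤-trans (*-monoʳ-≤ 2 (s≤s (z≤n {j}))) (m≤m+n _ _)

-- This is where degree 2 of the two centres enters: all other vertices of a half hang on a single
-- neighbour of its root.
onlyOther : ∀ {n} (G : Graph n) (let open Graph G) {a p} → a ~ p → degree G a ≡ 2 →
  ∃ λ b → ∀ {q} → a ~ q → q ≢ p → q ≡ b
onlyOther G {a} a~p deg with twoNeighbours G a deg
... | x , y , _ , _ , _ , x-or-y with x-or-y a~p
...   | inj₁ refl = y , λ a~q q≢p → rest (x-or-y a~q) q≢p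
  where
    rest : ∀ {q} → q ≡ x ⊎ q ≡ y → q ≢ x → q ≡ y
    rest (inj₁ eq) q≢ = contradiction eq q≢
    rest (inj₂ eq) _  = eq
...   | inj₂ refl = x , λ a~q q≢p → rest (x-or-y a~q) q≢p
  where
    rest : ∀ {q} → q ≡ x ⊎ q ≡ y → q ≢ y → q ≡ x
    rest (inj₁ eq) _  = eq
    rest (inj₂ eq) q≢ = contradiction eq q≢

module TwoCentres {n : ℕ} (G : Graph n) (connected : Connected G) (acyclic : ¬ Cycle G)
  (H : ℕ) (k : ℕ → ℕ) (k0≡1 : k 0 ≡ 1) (2≤k : ∀ i → 1 ≤ i → i ≤ H → 2 ≤ k i)
  (c₀ c₁ : Fin n) (edge : Graph._~_ G c₀ c₁)
  (bounded₀ : ∀ v → Metric.d G connected c₀ v ≤ suc (suc H))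
  (bounded₁ : ∀ v → Metric.d G connected c₁ v ≤ suc (suc H))
  (degrees₀ : ∀ {v} → Metric.d G connected v c₁ ≡ suc (Metric.d G connected v c₀) →
    Metric.d G connected v c₀ < suc H → degree G v ≡ suc (k (Metric.d G connected v c₀)))
  (degrees₁ : ∀ {v} → Metric.d G connected v c₀ ≡ suc (Metric.d G connected v c₁) →
    Metric.d G connected v c₁ < suc H → degree G v ≡ suc (k (Metric.d G connected v c₁)))
  (diam : Diameter G (suc H + suc H + 1)) where

  open Graph G
  open TreeMetric G connected acyclic

  private
    depth≤ : ∀ {x y v} → (∀ w → d x w ≤ suc (suc H)) → d v x ≡ suc (d v y) → d v y ≤ suc H
    depth≤ {x} {y} {v} bd iv = ≤-pred (≤-trans (≤-reflexive (trans (sym iv) (d-sym v x))) (bd v))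

    module A = Spread G connected acyclic c₁ c₀ (~-sym edge) k (suc H) (depth≤ bounded₁) degrees₀
    module B = Spread G connected acyclic c₀ c₁ edge k (suc H) (depth≤ bounded₀) degrees₁
    open Layout k (suc H)

    inside : ∀ v → A.Inside v ⊎ B.Inside v
    inside v with nearer v edge
    ... | inj₁ eq = inj₂ (trans (d-sym v c₀) (trans eq (cong suc (d-sym c₁ v))))
    ... | inj₂ eq = inj₁ (trans (d-sym v c₁) (trans eq (cong suc (d-sym c₀ v))))

    disjoint : ∀ {v} → A.Inside v → ¬ B.Inside v
    disjoint {v} iA iB = m≢1+n+m (d v c₁) {1} (trans iA (cong suc iB))

    disjoint′ : ∀ {v} → B.Inside v → ¬ A.Inside v
    disjoint′ iB iA = disjoint iA iB

    q : ℕ → ℕ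
    q j = weight 2 j + 2

    R : ℕ
    R = rows q (suc H)

    row-positive : 0 < row 0
    row-positive = width-positive (suc H) ≤-refl
      where
        width-positive : ∀ t → t ≤ suc H → 0 < width k t
        width-positive zero    _         = s≤s z≤n
        width-positive (suc t) (s≤s t≤H) = *-mono-≤ (width-positive t (m≤n⇒m≤1+n t≤H)) (k-positive t t≤H)
          where
            k-positive : ∀ i → i ≤ H → 1 ≤ k i
            k-positive zero    _   = ≤-reflexive (sym k0≡1)
            k-positive (suc i) i≤H = ≤-trans (s≤s z≤n) (2≤k (suc i) (s≤s z≤n) i≤H)

    φ≤width : ∀ φ → φ ≤ suc H → φ ≤ width k φ
    φ≤width zero    _   = z≤n
    φ≤width (suc φ) φ≤H = width-growth k {1} (suc φ)
      (λ i i<φ 1≤i → 2≤k i 1≤i (≤-pred (≤-trans i<φ φ≤H)))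
      (λ { zero _ → ≤-reflexive (sym k0≡1) ; (suc _) (s≤s ()) })

    height≤H : ∀ {v x} → d v x ≢ 0 → suc H ∸ d v x ≤ H
    height≤H {v} {x} dv≢0 with d v x
    ... | zero  = contradiction refl dv≢0
    ... | suc t = m∸n≤m H t

    below-R : ∀ {j c} → c < row j → j ≤ H → value q j c + (weight 2 j + 2) ≤ R
    below-R {j} {c} c< j≤H = ≤-trans (value-≤-row q {j} {c} c<) (below-mono _ (s≤s j≤H))

    -- Side B is listed cyclically: its first vertex is labelled last, as if it were item (suc H , 0).
    data Listed (v : Fin n) : ℕ → ℕ → Set where
      direct  : Listed v (B.height v) (B.code v)
      wrapped : B.height v ≡ 0 → B.code v ≡ 0 → Listed v (suc H) 0

    -- After wrapping, no vertex of side B occupies the place (0 , 0). So at least one leaf item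
    -- precedes each of them, every `total` is at least 4, and `pred` in `labelB` is an exact
    -- subtraction.
    record Item (v : Fin n) : Set where
      field
        {row′ code′} : ℕ
        listed  : Listed v row′ code′
        started : Before 0 0 row′ code′

      total : ℕ
      total = value q row′ code′

    item : ∀ v → Item v
    item v with B.height v in hv | B.code v in cv
    ... | zero  | zero  = record { listed = wrapped hv cv ; started = earlier-row (s≤s z≤n) }
    ... | zero  | suc c = record { listed = subst₂ (Listed v) hv cv direct ; started = same-row refl (s≤s z≤n) }
    ... | suc j | c     = record { listed = subst₂ (Listed v) hv cv direct ; started = earlier-row (s≤s z≤n) }

    data Kind (v : Fin n) : Set where
      rootA : v ≡ c₀ → Kind v
      rootB : v ≡ c₁ → Kind v
      sideA : A.Inside v → A.depth v ≢ 0 → Kind v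
      sideB : B.Inside v → B.depth v ≢ 0 → Item v → Kind v

    kind : ∀ v → Kind v
    kind v with inside v
    kind v | inj₁ iA with A.depth v ℕ.≟ 0
    ... | yes eq = rootA (d≡0⇒≡ eq)
    ... | no ≢0  = sideA iA ≢0
    kind v | inj₂ iB with B.depth v ℕ.≟ 0
    ... | yes eq = rootB (d≡0⇒≡ eq)
    ... | no ≢0  = sideB iB ≢0 (item v)

    valueA : Fin n → ℕ
    valueA v = value q (A.height v) (A.code v)

    labelB : ∀ v → Item v → ℕ
    labelB v it = pred (H + B.height v + Item.total it)

    -- The vertices are labelled in the order c₁, A₀, B₁, A₁, B₂, …, B₀, c₀; consecutive labels differ by
    -- 2h + 1 minus both levels, and by two more between two leaves Bᵢ, Aᵢ with i > 0.
    label : ∀ {v} → Kind v → ℕ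
    label     (rootA _)      = 2 * H + 1 + R
    label     (rootB _)      = 0
    label {v} (sideA _ _)    = H + 3 * A.height v + 2 * leaf (A.height v) + valueA v
    label {v} (sideB _ _ it) = labelB v it

    4≤total : ∀ {v} (it : Item v) → 4 ≤ Item.total it
    4≤total it = value-before q {0} {0} row-positive (Item.started it)

    labelB-suc : ∀ v (it : Item v) → suc (labelB v it) ≡ H + B.height v + Item.total it
    labelB-suc v it = suc-pred (H + B.height v + Item.total it)
      ⦃ >-nonZero (≤-trans (≤-trans (s≤s z≤n) (4≤total it)) (m≤n+m _ (H + B.height v))) ⦄

    total≤R : ∀ {v} → B.Inside v → B.depth v ≢ 0 → (it : Item v) → 2 * B.height v + Item.total it ≤ R
    total≤R {v} iv dv≢0 record { listed = direct } = ≤-trans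
      (≤-trans (≤-reflexive (+-comm (2 * B.height v) _))
        (+-monoʳ-≤ (value q (B.height v) (B.code v))
          (≤-trans (*-monoˡ-≤ (B.height v) (s≤s (s≤s (z≤n {2})))) (≤-trans (m≤m+n _ _) (m≤m+n _ 2)))))
      (below-R (B.code-<-row iv) (height≤H dv≢0))
    total≤R {v} _ _ record { listed = wrapped hv _ } = ≤-reflexive (cong₂ _+_ (cong (2 *_) hv) (+-identityʳ R))

    D+1 : ℕ
    D+1 = suc H + suc H + 1 + 1

    heightsA : ∀ {v} → A.Inside v → suc H ≤ A.depth v + A.height v
    heightsA iv = ≤-reflexive (sym (A.depth+height iv))

    heightsB : ∀ {v} → B.Inside v → suc H ≤ B.depth v + B.height v
    heightsB iv = ≤-reflexive (sym (B.depth+height iv))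

    forwardA : ∀ {u v} (iu : A.Inside u) (iv : A.Inside v) u≢0 v≢0 →
      Before (A.height u) (A.code u) (A.height v) (A.code v) →
      label (sideA iu u≢0) + D+1 ≤ label (sideA iv v≢0) + d u v
    forwardA {u} {v} iu iv _ _ before with A.spaced iu iv before
    ... | record { φ = φ ; φ≤depth = φ≤ ; far = far ; apart = apart }
      with split-gap (position-before (A.code-<-row iu) before) apart
    ...   | m , eq , W≤ = edge-same-A {H} {A.height u} {A.height v} {2 * leaf (A.height u)} {2 * leaf (A.height v)} {valueA u} {valueA v}
              {A.depth u} {A.depth v} {d u v} {m} {φ}
              (value-gap (weight 2) (A.code-<-row iu) before eq) far (≤-trans (φ≤width φ (≤-trans φ≤ (depth≤ bounded₁ iu))) W≤)
              (heightsA iu) (heightsA iv) (2≤2j+2leaf (A.height v))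

    record Advance (u v : Fin n) (j c j′ c′ : ℕ) : Set where
      field
        φ m    : ℕ
        gain   : value q j c + (weight 2 (B.height u) + 2) + 2 * m ≤ value q j′ c′
        far    : B.depth u + B.depth v ≤ d u v + 2 * φ
        φ≤1+m  : φ ≤ suc m

    advance : ∀ {u v j c j′ c′} → B.Inside u → B.Inside v → B.depth v ≢ 0 → Listed u j c → Listed v j′ c′ →
      Before 0 0 j c → Before j c j′ c′ → Advance u v j c j′ c′
    advance {u} {v} iu iv v≢0 direct direct _ before with B.spaced iu iv before
    ... | record { φ = φ ; φ≤depth = φ≤ ; far = far ; apart = apart }
      with split-gap (position-before (B.code-<-row iu) before) apart
    ...   | m , eq , W≤ = record
            { φ = φ ; m = m ; gain = value-gap (weight 2) (B.code-<-row iu) before eq ; far = far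
            ; φ≤1+m = ≤-trans (φ≤width φ (≤-trans φ≤ (depth≤ bounded₀ iu))) W≤ }
    advance {u} {v} iu iv v≢0 direct (wrapped hv cv) started before
      -- Before wrapping `v` comes first, so `spaced` is applied with `u` and `v` exchanged, and its
      -- field `wrapped` measures the way from `u` onwards to the new place of `v`.
      with B.spaced iv iu (subst₂ (λ j c → Before j c (B.height u) (B.code u)) (sym hv) (sym cv) started)
    ... | record { φ = φ ; φ≤depth = φ≤ ; far = far ; wrapped = wrap } with split φ φ≤ wrap
      where
        split : ∀ φ → φ ≤ B.depth v → B.place u + width k φ ≤ B.place v + rows (λ _ → 1) (suc (suc H ∸ φ)) →
          ∃ λ m → position (suc H) 0 ≡ B.place u + suc m × φ ≤ suc m
        -- A full turn for φ = 0 would include the row of the root, which is not listed among the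
        -- items. Nothing is lost, since φ = 0 asks for no item in between.
        split zero _ _ with split-gap {w = 0} (position-before (B.code-<-row iu) before)
          (≤-trans (≤-reflexive (+-identityʳ (B.place u))) (<⇒≤ (position-before (B.code-<-row iu) before)))
        ... | m , eq , _ = m , eq , z≤n
        split (suc φ) φ≤ wrap with split-gap (position-before (B.code-<-row iu) before) (≤-trans wrap
          (≤-trans (≤-reflexive (cong (_+ rows (λ _ → 1) (suc (H ∸ φ))) (cong₂ position hv cv)))
            (≤-trans (below-mono _ (s≤s (m∸n≤m H φ))) (≤-reflexive (sym (+-identityʳ (rows (λ _ → 1) (suc H))))))))
        ... | m , eq , W≤ = m , eq , ≤-trans (φ≤width (suc φ) (≤-trans φ≤ (depth≤ bounded₀ iv))) W≤
    ...   | m , eq , φ≤1+m = record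
            { φ = φ ; m = m ; gain = value-gap (weight 2) (B.code-<-row iu) before eq
            ; far = subst₂ _≤_ (+-comm (B.depth v) (B.depth u)) (cong (_+ 2 * φ) (d-sym v u)) far
            ; φ≤1+m = φ≤1+m }
    advance iu iv v≢0 (wrapped _ _) direct _ (earlier-row lt) = contradiction (<⇒≤ lt) (<⇒≱ (s≤s (height≤H v≢0)))
    advance iu iv v≢0 (wrapped _ _) direct _ (same-row eq _)  = contradiction (≤-reflexive eq) (<⇒≱ (s≤s (height≤H v≢0)))
    advance iu iv v≢0 (wrapped _ _) (wrapped _ _) _ (earlier-row lt) = contradiction lt (<-irrefl refl)
    advance iu iv v≢0 (wrapped _ _) (wrapped _ _) _ (same-row _ ())

    forwardB : ∀ {u v} (iu : B.Inside u) (iv : B.Inside v) u≢0 v≢0 (itu : Item u) (itv : Item v) →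
      Before (Item.row′ itu) (Item.code′ itu) (Item.row′ itv) (Item.code′ itv) →
      label (sideB iu u≢0 itu) + D+1 ≤ label (sideB iv v≢0 itv) + d u v
    forwardB {u} {v} iu iv _ v≢0 itu itv before
      with advance iu iv v≢0 (Item.listed itu) (Item.listed itv) (Item.started itu) before
    ... | record { φ = φ ; m = m ; gain = gain ; far = far ; φ≤1+m = φ≤ } =
          edge-same-B {H} {B.height u} {B.height v} {2 * leaf (B.height u)} {Item.total itu} {Item.total itv}
            {B.depth u} {B.depth v} {d u v} {m} {φ} (labelB-suc u itu) (labelB-suc v itv)
            gain far φ≤ (heightsB iu) (heightsB iv) (2≤2j+2leaf (B.height u))

    d-opposite : ∀ {u v} → A.Inside u → B.Inside v → d u v ≡ A.depth u + suc (B.depth v)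
    d-opposite {u} {v} iu iv = trans (A.across iu (disjoint′ iv)) (cong (A.depth u +_) iv)

    Far′ : ∀ {u v} → Kind u → Kind v → Set
    Far′ {u} {v} ku kv = label ku + D+1 ≤ label kv + d u v ⊎ label kv + D+1 ≤ label ku + d u v

    opposite : ∀ {u v} (iu : A.Inside u) (iv : B.Inside v) u≢0 v≢0 (it : Item v) →
      Far′ (sideA iu u≢0) (sideB iv v≢0 it)
    opposite {u} {v} iu iv u≢0 _ it rewrite d-opposite iu iv
      with compare-items (A.height u) (A.code u) (Item.row′ it) (Item.code′ it)
    ... | inj₁ before = inj₁ (edge-opposite-before {H} {A.height u} {B.height v} {2 * leaf (A.height u)}
            {valueA u} {Item.total it} {A.depth u} {B.depth v} (labelB-suc v it)
            (value-before q (A.code-<-row iu) before) (heightsA iu) (heightsB iv))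
    ... | inj₂ rest = inj₂ (later (Item.listed it) (labelB-suc v it) rest)
      where
        later : ∀ {j c b} → Listed v j c → suc b ≡ H + B.height v + value q j c →
          (A.height u ≡ j × A.code u ≡ c) ⊎ Before j c (A.height u) (A.code u) →
          b + D+1 ≤ H + 3 * A.height u + 2 * leaf (A.height u) + valueA u + (A.depth u + suc (B.depth v))
        later {b = b} direct eq (inj₁ (heights , codes)) = subst₂
            (λ j x → b + D+1 ≤ H + 3 * j + 2 * leaf j + x + (A.depth u + suc (B.depth v)))
            (sym heights) (cong₂ (value q) (sym heights) (sym codes))
            (edge-opposite-equal {H} {B.height v} {2 * leaf (B.height v)} {value q (B.height v) (B.code v)} {A.depth u} {B.depth v} eq
              (≤-trans (heightsA iu) (≤-reflexive (cong (A.depth u +_) heights))) (heightsB iv))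
        later direct eq (inj₂ after) = edge-opposite-after {H} {A.height u} {B.height v} {2 * leaf (A.height u)} {2 * leaf (B.height v)}
            {valueA u} {value q (B.height v) (B.code v)} {A.depth u} {B.depth v} eq
            (value-before q (B.code-<-row iv) after) (heightsA iu) (heightsB iv)
        later (wrapped _ _) eq (inj₁ (heights , _)) = contradiction (≤-reflexive (sym heights)) (<⇒≱ (s≤s (height≤H u≢0)))
        later (wrapped _ _) eq (inj₂ (earlier-row lt)) = contradiction (<⇒≤ lt) (<⇒≱ (s≤s (height≤H u≢0)))
        later (wrapped _ _) eq (inj₂ (same-row eq′ _)) = contradiction (≤-reflexive eq′) (<⇒≱ (s≤s (height≤H u≢0)))

    flipped : ∀ {u v} (ku : Kind u) (kv : Kind v) → Far′ ku kv → Far′ kv ku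
    flipped {u} {v} ku kv = swap ∘ subst (λ x → label ku + D+1 ≤ label kv + x ⊎ label kv + D+1 ≤ label ku + x) (d-sym u v)

    A-rootA : ∀ {v} (iv : A.Inside v) v≢0 → Far′ (sideA iv v≢0) (rootA refl)
    A-rootA {v} iv v≢0 = inj₁ (rootA-A {H} {A.height v} {2 * leaf (A.height v)} {valueA v} {A.depth v} {R}
      (below-R (A.code-<-row iv) (height≤H v≢0)) (heightsA iv))

    B-rootA : ∀ {v} (iv : B.Inside v) v≢0 it → Far′ (sideB iv v≢0 it) (rootA refl)
    B-rootA {v} iv v≢0 it rewrite iv = inj₁ (rootA-B {H} {B.height v} {Item.total it} {B.depth v} {labelB v it} {R}
      (labelB-suc v it) (total≤R iv v≢0 it) (heightsB iv))

    A-rootB : ∀ {v} (iv : A.Inside v) v≢0 → Far′ (sideA iv v≢0) (rootB refl)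
    A-rootB {v} iv v≢0 rewrite iv = inj₂ (rootB-A {H} {A.height v} {2 * leaf (A.height v)} {valueA v} {A.depth v}
      (2≤2j+2leaf (A.height v)) (heightsA iv))

    B-rootB : ∀ {v} (iv : B.Inside v) v≢0 it → Far′ (sideB iv v≢0 it) (rootB refl)
    B-rootB {v} iv v≢0 it = inj₂ (rootB-B {H} {B.height v} {Item.total it} {B.depth v} (labelB-suc v it) (4≤total it) (heightsB iv))

    roots : Far′ (rootA refl) (rootB refl)
    roots rewrite ~⇒d≡1 edge = inj₂ (rootA-rootB {H} {R}
      (≤-trans (value-before q {0} {0} {suc H} {0} row-positive (earlier-row (s≤s z≤n))) (≤-reflexive (+-identityʳ R))))

    far : ∀ {u v} (ku : Kind u) (kv : Kind v) → u ≢ v → Far′ ku kv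
    far (rootA refl) (rootA refl) u≢v = contradiction refl u≢v
    far (rootB refl) (rootB refl) u≢v = contradiction refl u≢v
    far (rootA refl) (rootB refl) _ = roots
    far (rootB refl) (rootA refl) _ = flipped (rootA refl) (rootB refl) roots
    far (sideA iu u≢0) (rootA refl) _ = A-rootA iu u≢0
    far (sideA iu u≢0) (rootB refl) _ = A-rootB iu u≢0
    far (sideB iu u≢0 it) (rootA refl) _ = B-rootA iu u≢0 it
    far (sideB iu u≢0 it) (rootB refl) _ = B-rootB iu u≢0 it
    far (rootA refl) (sideA iu u≢0) _ = flipped (sideA iu u≢0) (rootA refl) (A-rootA iu u≢0)
    far (rootB refl) (sideA iu u≢0) _ = flipped (sideA iu u≢0) (rootB refl) (A-rootB iu u≢0)
    far (rootA refl) (sideB iu u≢0 it) _ = flipped (sideB iu u≢0 it) (rootA refl) (B-rootA iu u≢0 it)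
    far (rootB refl) (sideB iu u≢0 it) _ = flipped (sideB iu u≢0 it) (rootB refl) (B-rootB iu u≢0 it)
    far (sideA iu u≢0) (sideB iv v≢0 it) _ = opposite iu iv u≢0 v≢0 it
    far (sideB iu u≢0 it) (sideA iv v≢0) _ = flipped (sideA iv v≢0) (sideB iu u≢0 it) (opposite iv iu v≢0 u≢0 it)
    far {u} {v} (sideA iu u≢0) (sideA iv v≢0) u≢v with compare-items (A.height u) (A.code u) (A.height v) (A.code v)
    ... | inj₁ before           = inj₁ (forwardA iu iv u≢0 v≢0 before)
    ... | inj₂ (inj₂ after)     = flipped (sideA iv v≢0) (sideA iu u≢0) (inj₁ (forwardA iv iu v≢0 u≢0 after))
    ... | inj₂ (inj₁ (hs , cs)) = contradiction (A.height-code-injective iu iv hs cs) u≢v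
    far {u} {v} (sideB iu u≢0 itu) (sideB iv v≢0 itv) u≢v
      with compare-items (Item.row′ itu) (Item.code′ itu) (Item.row′ itv) (Item.code′ itv)
    ... | inj₁ before       = inj₁ (forwardB iu iv u≢0 v≢0 itu itv before)
    ... | inj₂ (inj₂ after) = flipped (sideB iv v≢0 itv) (sideB iu u≢0 itu) (inj₁ (forwardB iv iu v≢0 u≢0 itv itu after))
    ... | inj₂ (inj₁ (rs , cs)) = contradiction (same (Item.listed itu) (Item.listed itv) rs cs) u≢v
      where
        same : ∀ {j c j′ c′} → Listed u j c → Listed v j′ c′ → j ≡ j′ → c ≡ c′ → u ≡ v
        same direct          direct            hs cs = B.height-code-injective iu iv hs cs
        same direct          (wrapped _ _)     hs _  = contradiction (≤-reflexive (sym hs)) (<⇒≱ (s≤s (height≤H u≢0)))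
        same (wrapped _ _)   direct            hs _  = contradiction (≤-reflexive hs) (<⇒≱ (s≤s (height≤H v≢0)))
        same (wrapped hu cu) (wrapped hv cv)   _  _  = B.height-code-injective iu iv (trans hu (sym hv)) (trans cu (sym cv))

    label≤ : ∀ {v} (kv : Kind v) → label kv ≤ 2 * H + 1 + R
    label≤ (rootA _) = ≤-refl
    label≤ (rootB _) = z≤n
    label≤ {v} (sideA iv v≢0) = edge-top-A {H} {A.height v} {2 * leaf (A.height v)} {valueA v} {R}
      (below-R (A.code-<-row iv) (height≤H v≢0))
    label≤ {v} (sideB iv v≢0 it) = edge-top-B {H} {B.height v} {Item.total it} {labelB v it} {R}
      (labelB-suc v it) (total≤R iv v≢0 it)

  f : Fin n → ℕ
  f v = label (kind v)

  f-radio : IsRadioLabelling G f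
  f-radio = Radio.radio-labelling G connected diam f (λ {u} {v} → far (kind u) (kind v))

  f≤ : ∀ v → f v ≤ 2 * H + 1 + rows (λ j → weight 2 j + 2) (suc H)
  f≤ v = label≤ (kind v)

  -- Lower bound for two central vertices

  private
    L : Fin n → ℕ
    L v = d v c₀ ⊓ d v c₁

    L-A : ∀ {v} → A.Inside v → L v ≡ A.depth v
    L-A iv = m≤n⇒m⊓n≡m (≤-trans (n≤1+n _) (≤-reflexive (sym iv)))

    L-B : ∀ {v} → B.Inside v → L v ≡ B.depth v
    L-B iv = m≥n⇒m⊓n≡n (≤-trans (n≤1+n _) (≤-reflexive (sym iv)))

    L≤h : ∀ v → L v ≤ suc H
    L≤h v with inside v
    ... | inj₁ iv = ≤-trans (≤-reflexive (L-A iv)) (depth≤ bounded₁ iv)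
    ... | inj₂ iv = ≤-trans (≤-reflexive (L-B iv)) (depth≤ bounded₀ iv)

    near : ∀ u v → d u v ≤ L u + L v + 1
    near u v with inside u | inside v
    ... | inj₁ iu | inj₁ iv rewrite L-A iu | L-A iv =
          ≤-trans (≤-trans (d-triangle u c₀ v) (≤-reflexive (cong (d u c₀ +_) (d-sym c₀ v)))) (m≤m+n _ 1)
    ... | inj₂ iu | inj₂ iv rewrite L-B iu | L-B iv =
          ≤-trans (≤-trans (d-triangle u c₁ v) (≤-reflexive (cong (d u c₁ +_) (d-sym c₁ v)))) (m≤m+n _ 1)
    ... | inj₁ iu | inj₂ iv rewrite L-A iu | L-B iv = ≤-reflexive (trans (d-opposite iu iv)
          (trans (+-suc (d u c₀) (d v c₁)) (+-comm 1 _)))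
    ... | inj₂ iu | inj₁ iv rewrite L-B iu | L-A iv = ≤-reflexive (trans (d-sym u v) (trans (d-opposite iv iu)
          (trans (+-suc (d v c₀) (d u c₁)) (trans (cong suc (+-comm (d v c₀) (d u c₁))) (+-comm 1 _)))))

    onlyA : ∃ λ b → ∀ {w} → c₀ ~ w → w ≢ c₁ → w ≡ b
    onlyA = onlyOther G edge (trans (degrees₀ A.root-inside (subst (_< suc H) (sym (d-refl c₀)) (s≤s z≤n)))
      (cong suc (trans (cong k (d-refl c₀)) k0≡1)))

    onlyB : ∃ λ b → ∀ {w} → c₁ ~ w → w ≢ c₀ → w ≡ b
    onlyB = onlyOther G (~-sym edge) (trans (degrees₁ B.root-inside (subst (_< suc H) (sym (d-refl c₁)) (s≤s z≤n)))
      (cong suc (trans (cong k (d-refl c₁)) k0≡1)))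

    -- A shortest path from `r` to `v` cannot begin towards `p`, which is farther from `v`, so it
    -- begins with `b`. Two vertices of one half can thus meet at `b` instead of `r`, which saves 2.
    via : ∀ {r p b v} → (∀ {w} → r ~ w → w ≢ p → w ≡ b) → d v p ≡ suc (d v r) → d v r ≢ 0 → d v r ≡ suc (d v b)
    via {r} {p} {b} {v} only iv v≢0 with step r≢v
      where
        r≢v : r ≢ v
        r≢v refl = v≢0 (d-refl r)
    ... | w , r~w , dw with only r~w w≢p
      where
        w≢p : w ≢ p
        w≢p refl = m≢1+n+m (d v r) {1} (trans (d-sym v r) (trans dw (cong suc (trans (d-sym w v) iv))))
    ...   | refl = trans (d-sym v r) (trans dw (cong suc (d-sym w v)))

    short : ∀ {u v r b} → d u r ≡ suc (d u b) → d v r ≡ suc (d v b) → d u v + 2 ≤ d u r + d v r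
    short {u} {v} {r} {b} du dv rewrite du | dv = begin
      d u v + 2             ≤⟨ +-monoˡ-≤ 2 (d-triangle u b v) ⟩
      d u b + d b v + 2     ≡⟨ cong (λ y → d u b + y + 2) (d-sym b v) ⟩
      d u b + d v b + 2     ≡⟨ +-comm (d u b + d v b) 2 ⟩
      suc (suc (d u b + d v b)) ≡⟨ cong suc (+-suc (d u b) (d v b)) ⟨
      suc (d u b) + suc (d v b) ∎
      where open ≤-Reasoning

    closeA : ∀ {u v} → A.Inside u → A.Inside v → L u ≢ 0 → L v ≢ 0 → d u v + 2 ≤ L u + L v
    closeA iu iv u≢ v≢ rewrite L-A iu | L-A iv = short (via (proj₂ onlyA) iu u≢) (via (proj₂ onlyA) iv v≢)

    closeB : ∀ {u v} → B.Inside u → B.Inside v → L u ≢ 0 → L v ≢ 0 → d u v + 2 ≤ L u + L v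
    closeB iu iv u≢ v≢ rewrite L-B iu | L-B iv = short (via (proj₂ onlyB) iu u≢) (via (proj₂ onlyB) iv v≢)

    close : ∀ {x y z} → L x ≢ 0 → L y ≢ 0 → L z ≢ 0 →
      d x z + 2 ≤ L x + L z ⊎ d x y + 2 ≤ L x + L y ⊎ d y z + 2 ≤ L y + L z
    close {x} {y} {z} x≢ y≢ z≢ with inside x | inside y | inside z
    ... | inj₁ ix | _       | inj₁ iz = inj₁ (closeA ix iz x≢ z≢)
    ... | inj₂ ix | _       | inj₂ iz = inj₁ (closeB ix iz x≢ z≢)
    ... | inj₁ ix | inj₁ iy | inj₂ _  = inj₂ (inj₁ (closeA ix iy x≢ y≢))
    ... | inj₂ ix | inj₂ iy | inj₁ _  = inj₂ (inj₁ (closeB ix iy x≢ y≢))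
    ... | inj₁ _  | inj₂ iy | inj₂ iz = inj₂ (inj₂ (closeB iy iz y≢ z≢))
    ... | inj₂ _  | inj₁ iy | inj₁ iz = inj₂ (inj₂ (closeA iy iz y≢ z≢))

    ∑-levels : ∀ e → ∑ (λ v → weight e (suc H ∸ L v) + 2) ≡
      rows (λ j → weight e j + 2) (suc (suc H)) + rows (λ j → weight e j + 2) (suc (suc H))
    ∑-levels e = begin
      ∑ (λ v → weight e (suc H ∸ L v) + 2)
        ≡⟨ sumOver-cong (allFin n) (λ v → pointwise (inside v)) ⟩
      ∑ (λ v → 𝟙 (A.inside? v) * ω (A.height v) + 𝟙 (B.inside? v) * ω (B.height v))
        ≡⟨ sumOver-+ (allFin n) _ _ ⟩
      ∑ (λ v → 𝟙 (A.inside? v) * ω (A.height v)) + ∑ (λ v → 𝟙 (B.inside? v) * ω (B.height v))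
        ≡⟨ cong₂ _+_ (A.∑-inside ω) (B.∑-inside ω) ⟩
      rows ω (suc (suc H)) + rows ω (suc (suc H)) ∎
      where
        open ≡-Reasoning
        ω : ℕ → ℕ
        ω j = weight e j + 2
        pointwise : ∀ {v} → A.Inside v ⊎ B.Inside v → ω (suc H ∸ L v) ≡
          𝟙 (A.inside? v) * ω (A.height v) + 𝟙 (B.inside? v) * ω (B.height v)
        pointwise {v} (inj₁ iv) rewrite 𝟙-yes (A.inside? v) iv | 𝟙-no (B.inside? v) (disjoint iv) | L-A iv =
          trans (sym (+-identityʳ _)) (sym (+-identityʳ _))
        pointwise {v} (inj₂ iv) rewrite 𝟙-yes (B.inside? v) iv | 𝟙-no (A.inside? v) (disjoint′ iv) | L-B iv =
          sym (+-identityʳ _)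

    c₀≢c₁ : c₀ ≢ c₁
    c₀≢c₁ eq = ~-irrefl eq edge

    L≡0⇒ : ∀ {v} → L v ≡ 0 → v ≡ c₀ ⊎ v ≡ c₁
    L≡0⇒ {v} eq with inside v
    ... | inj₁ iv = inj₁ (d≡0⇒≡ (trans (sym (L-A iv)) eq))
    ... | inj₂ iv = inj₂ (d≡0⇒≡ (trans (sym (L-B iv)) eq))

    ∑-κ : ∀ e → ∑ (λ v → e * leaf (L v)) ≡ e + e
    ∑-κ e = trans (sumOver-cong (allFin n) pointwise) (trans (sumOver-+ (allFin n) _ _)
      (cong₂ _+_ (∑-single-* c₀ (λ _ → e)) (∑-single-* c₁ (λ _ → e))))
      where
        pointwise : ∀ v → e * leaf (L v) ≡ 𝟙 (v ≟ c₀) * e + 𝟙 (v ≟ c₁) * e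
        pointwise v with v ≟ c₀ | v ≟ c₁
        ... | yes refl | yes eq  = contradiction eq c₀≢c₁
        ... | yes refl | no _    rewrite L-A A.root-inside | d-refl c₀ = trans (*-identityʳ e) (sym (trans (+-identityʳ _) (+-identityʳ e)))
        ... | no _     | yes refl rewrite L-B B.root-inside | d-refl c₁ = trans (*-identityʳ e) (sym (+-identityʳ e))
        ... | no v≢c₀  | no v≢c₁ = trans (cong (e *_) (leaf-pos (n≢0⇒n>0 λ eq → not-root (L≡0⇒ eq)))) (*-zeroʳ e)
          where
            not-root : ¬ (v ≡ c₀ ⊎ v ≡ c₁)
            not-root (inj₁ eq) = v≢c₀ eq
            not-root (inj₂ eq) = v≢c₁ eq

    -- For `H = 0` the leaves are at level 1, and `end` would fail for them with excess 2. The tree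
    -- is then the path on four vertices, for which excess 0 already yields the bound 5.
    module LB₂ = LowerBound G connected {suc H} {1} {2} diam L (s≤s z≤n) ≤-refl L≤h
    module LB₀ = LowerBound G connected {suc H} {1} {0} diam L (s≤s z≤n) z≤n L≤h

    last-row : ∀ e → rows (λ j → weight e j + 2) (suc (suc H)) ≡ rows (λ j → weight e j + 2) (suc H) + (weight e (suc H) + 2)
    last-row e = cong (rows (λ j → weight e j + 2) (suc H) +_)
      (trans (cong (λ t → width k t * (weight e (suc H) + 2)) (n∸n≡0 H)) (*-identityˡ _))

    end : 1 ≤ H → ∀ v → LB₂.ℓ v + 2 ≤ 2 * L v + LB₂.κ v
    end 1≤H v with L v
    ... | zero = ≤-refl
    ... | suc zero = ≤-reflexive (cong (λ x → 2 * x + 2) (leaf-pos 1≤H))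
    ... | suc (suc l) = ≤-trans (+-monoˡ-≤ 2 (*-monoʳ-≤ 2 (leaf≤1 (H ∸ suc l))))
            (≤-trans (*-monoʳ-≤ 2 (s≤s (s≤s (z≤n {l})))) (m≤m+n _ _))

    lower₂ : 1 ≤ H → ∀ f {s} → IsRadioLabelling G f → Span G f s → 2 * H + 1 + R ≤ s
    lower₂ 1≤H f {s} radio sp with LB₂.weighted-span near close f radio
      (trans (∑-levels 2) (cong₂ _+_ (last-row 2) (last-row 2))) (∑-κ 2) (distinct⇒2≤n c₀≢c₁) sp
    ... | x , z , _ , bound = *-cancelˡ-≤ 2 (span-two {H} {R} {s} {LB₂.ℓ x} {LB₂.ℓ z}
            {2 * L x + LB₂.κ x} {2 * L z + LB₂.κ z} bound (end 1≤H x) (end 1≤H z))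

    lower₀ : H ≡ 0 → ∀ f {s} → IsRadioLabelling G f → Span G f s → 2 * H + 1 + R ≤ s
    lower₀ refl f {s} radio sp with LB₀.weighted-span near close f radio
      (trans (∑-levels 0) (cong₂ _+_ rows≡8 rows≡8)) (∑-κ 0) (distinct⇒2≤n c₀≢c₁) sp
      where
        rows≡8 : rows (λ j → weight 0 j + 2) 2 ≡ 8
        rows≡8 rewrite k0≡1 = refl
    ... | x , z , _ , bound = ≤-trans (≤-reflexive (cong (λ w → 1 + (w + 0) * 4) k0≡1))
            (*-cancelˡ-≤ 2 (span-path {s} {2 * L x + LB₀.κ x} {2 * L z + LB₀.κ z} bound))

    lower : ∀ f {s} → IsRadioLabelling G f → Span G f s → 2 * H + 1 + R ≤ s
    lower with H ℕ.≟ 0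
    ... | yes H≡0 = lower₀ H≡0
    ... | no H≢0  = lower₂ (n≢0⇒n>0 H≢0)

  radio-number : RadioNumber G (2 * H + 1 + rows (λ j → weight 2 j + 2) (suc H))
  radio-number = radioNumber G (2 * H + 1 + R) c₀ f f-radio f≤ lower

-- The closed formulas

map-1⋯suc : ∀ (f : ℕ → ℕ) k → map f (applyUpTo suc (suc k)) ≡ map f (applyUpTo suc k) ++ [ f (suc k) ]
map-1⋯suc f k = trans (cong (map f) (sym (applyUpTo-∷ʳ suc k))) (map-++ f (applyUpTo suc k) [ suc k ])

∑-1⋯ : ∀ k f → ∑[1⋯ k ] f ≡ below k (λ i → f (suc i))
∑-1⋯ zero    f = refl
∑-1⋯ (suc k) f = begin
  sum (map f (applyUpTo suc (suc k)))           ≡⟨ cong sum (map-1⋯suc f k) ⟩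
  sum (map f (applyUpTo suc k) ++ [ f (suc k) ]) ≡⟨ sum-++ (map f (applyUpTo suc k)) [ f (suc k) ] ⟩
  ∑[1⋯ k ] f + (f (suc k) + 0)                  ≡⟨ cong₂ _+_ (∑-1⋯ k f) (+-identityʳ (f (suc k))) ⟩
  below (suc k) (λ i → f (suc i))               ∎
  where open ≡-Reasoning

∏-1⋯suc : ∀ k f → ∏[1⋯ suc k ] f ≡ ∏[1⋯ k ] f * f (suc k)
∏-1⋯suc k f = trans (cong product (map-1⋯suc f k))
  (trans (product-++ (map f (applyUpTo suc k)) [ f (suc k) ]) (cong (∏[1⋯ k ] f *_) (*-identityʳ (f (suc k)))))

below-shift : ∀ k f → below (suc k) f ≡ f 0 + below k (λ i → f (suc i))
below-shift zero    f = sym (+-identityʳ (f 0))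
below-shift (suc k) f = trans (cong (_+ f (suc k)) (below-shift k f)) (+-assoc (f 0) _ _)

below-reverse : ∀ k f → below (suc k) f ≡ below (suc k) (λ i → f (k ∸ i))
below-reverse zero    f = refl
below-reverse (suc k) f = trans (+-comm _ (f (suc k)))
  (trans (cong (f (suc k) +_) (below-reverse k f)) (sym (below-shift (suc k) (λ i → f (suc k ∸ i)))))

below-+ : ∀ k f g → below k (λ i → f i + g i) ≡ below k f + below k g
below-+ zero    f g = refl
below-+ (suc k) f g = trans (cong (_+ (f k + g k)) (below-+ k f g)) (interchange (below k f) (below k g) (f k) (g k))
  where open import Algebra.Properties.CommutativeSemigroup +-commutativeSemigroup using (interchange)

module _ (m : ℕ → ℕ) (H : ℕ) where

  private
    P : ℕ → ℕ
    P i = ∏[1⋯ i ] (λ j → m j ∸ 1)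

  level-sum : ℕ
  level-sum = ∑[1⋯ H ] (λ i → (4 * (suc H ∸ i) ∸ 2) * P i)

  width-product : ∀ t → width (λ i → m (suc i) ∸ 1) t ≡ P t
  width-product zero    = refl
  width-product (suc t) = trans (cong (_* (m (suc t) ∸ 1)) (width-product t)) (sym (∏-1⋯suc t _))

  -- With two centres the root of a half is at level 0 and contributes the factor `m 0 ∸ 1`, which
  -- is 1; with one centre it is at level 1. Hence the shift of one between the two products.
  width-product′ : m 0 ≡ 2 → ∀ t → width (λ i → m i ∸ 1) (suc t) ≡ P t
  width-product′ m0≡2 zero    = cong (λ x → 1 * (x ∸ 1)) m0≡2
  width-product′ m0≡2 (suc t) = trans (cong (_* (m (suc t) ∸ 1)) (width-product′ m0≡2 t)) (sym (∏-1⋯suc t _))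

  -- Rows are indexed by height and the formula by depth, so the sum is reversed. The root then
  -- splits off as `4 * H + 2`, and the excess at the leaves as `e * P H`.
  weighted-rows : ∀ e (w : ℕ → ℕ) → (∀ j → j ≤ H → w j ≡ P (H ∸ j)) →
    below (suc H) (λ j → w j * (weight e j + 2)) ≡ level-sum + e * P H + (4 * H + 2)
  weighted-rows e w w≡ = begin
    below (suc H) (λ j → w j * (weight e j + 2))
      ≡⟨ below-cong (suc H) (λ j j<1+H → trans (cong (_* (weight e j + 2)) (w≡ j (≤-pred j<1+H)))
           (split-weight (P (H ∸ j)) j (e * leaf j))) ⟩
    below (suc H) (λ j → P (H ∸ j) * (4 * j + 2) + P (H ∸ j) * (e * leaf j))
      ≡⟨ below-+ (suc H) _ _ ⟩
    below (suc H) (λ j → P (H ∸ j) * (4 * j + 2)) + below (suc H) (λ j → P (H ∸ j) * (e * leaf j))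
      ≡⟨ cong₂ _+_ levels leaves ⟩
    4 * H + 2 + level-sum + e * P H   ≡⟨ +-assoc (4 * H + 2) level-sum (e * P H) ⟩
    4 * H + 2 + (level-sum + e * P H) ≡⟨ +-comm (4 * H + 2) _ ⟩
    level-sum + e * P H + (4 * H + 2) ∎
    where
      open ≡-Reasoning
      term : ∀ i → i < H → P (H ∸ (H ∸ suc i)) * (4 * (H ∸ suc i) + 2) ≡ (4 * (H ∸ i) ∸ 2) * P (suc i)
      term i i<H = trans (cong₂ _*_ (cong P (m∸[m∸n]≡n i<H)) factor) (*-comm (P (suc i)) _)
        where
          factor : 4 * (H ∸ suc i) + 2 ≡ 4 * (H ∸ i) ∸ 2
          factor = trans (+-comm (4 * (H ∸ suc i)) 2)
            (sym (cong (_∸ 2) (trans (cong (4 *_) (+-∸-assoc 1 i<H)) (*-suc 4 (H ∸ suc i)))))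
      levels : below (suc H) (λ j → P (H ∸ j) * (4 * j + 2)) ≡ 4 * H + 2 + level-sum
      levels = begin
        below (suc H) (λ j → P (H ∸ j) * (4 * j + 2))             ≡⟨ below-reverse H _ ⟩
        below (suc H) (λ i → P (H ∸ (H ∸ i)) * (4 * (H ∸ i) + 2)) ≡⟨ below-shift H _ ⟩
        P (H ∸ H) * (4 * H + 2) + below H (λ i → P (H ∸ (H ∸ suc i)) * (4 * (H ∸ suc i) + 2))
          ≡⟨ cong₂ _+_ (trans (cong (λ t → P t * (4 * H + 2)) (n∸n≡0 H)) (*-identityˡ (4 * H + 2)))
                       (trans (below-cong H term) (sym (∑-1⋯ H (λ i → (4 * (suc H ∸ i) ∸ 2) * P i)))) ⟩
        4 * H + 2 + level-sum ∎
      leaves : below (suc H) (λ j → P (H ∸ j) * (e * leaf j)) ≡ e * P H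
      leaves = trans (below-single (suc H) 0 (s≤s z≤n)
          (λ j _ j≢0 → trans (cong (λ x → P (H ∸ j) * (e * x)) (leaf-pos (n≢0⇒n>0 j≢0)))
            (trans (cong (P (H ∸ j) *_) (*-zeroʳ e)) (*-zeroʳ (P (H ∸ j))))))
        (trans (cong (P H *_) (*-identityʳ e)) (*-comm (P H) e))

module _ {H : ℕ} {m : ℕ → ℕ} (m0≡2 : m 0 ≡ 2) (3≤m : ∀ i → 1 ≤ i → i ≤ H → 3 ≤ m i)
  {n : ℕ} (T : Graph n) where

  private
    m-positive : ∀ {i} → i < suc H → m i ≡ suc (m i ∸ 1)
    m-positive {zero}  _           rewrite m0≡2 = refl
    m-positive {suc i} (s≤s i<H) = sym (m+[n∸m]≡n (≤-trans (s≤s z≤n) (3≤m (suc i) (s≤s z≤n) i<H)))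

  radioNumber-oneCentre : 1 ≤ H → IsLevelwiseRegularTree T 1 (suc H) m →
    RadioNumber T (level-sum m H + ∏[1⋯ H ] (λ i → m i ∸ 1) + 4 * suc H ∸ 1)
  radioNumber-oneCentre 1≤H tree = subst (RadioNumber T) value≡ radio-number
    where
      open IsLevelwiseRegularTree tree
      connected = proj₁ isTree
      acyclic = proj₂ isTree
      open Metric T connected
      centre = Center.centreSize1 T connected acyclic {suc H} height centerSize
      open Center.UniqueCentre (proj₂ (proj₂ centre))
      k : ℕ → ℕ
      k i = m (suc i) ∸ 1
      level : ∀ v → Level T (d c v) v
      level v = (c , central , d-Distance c v) , λ { (u , cu , dist) → from (only cu) dist }
        where
          from : ∀ {u j} → u ≡ c → Distance T u v j → d c v ≤ j
          from refl dist = ≤-reflexive (sym (Distance⇒≡d dist))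
      degrees : ∀ v → d c v ≢ 0 → d c v < suc H → degree T v ≡ suc (k (d c v ∸ 1))
      degrees v ≢0 lt = trans (levelDegree lt (level v)) (trans (m-positive lt)
        (cong (λ t → suc (m t ∸ 1)) (sym (m+[n∸m]≡n (n≢0⇒n>0 ≢0)))))
      open OneCentre T connected acyclic H 1≤H k (λ i i<H → ∸-monoˡ-≤ 1 (3≤m (suc i) (s≤s z≤n) i<H)) c
        (trans (levelDegree (s≤s z≤n) (subst (λ t → Level T t c) (d-refl c) (level c))) m0≡2)
        bounded degrees (subst (Diameter T) D≡ (proj₁ (proj₂ centre)))
      value≡ : 1 + Layout.rows k H (λ j → weight 1 j + 2) (suc H) ≡
        level-sum m H + ∏[1⋯ H ] (λ i → m i ∸ 1) + 4 * suc H ∸ 1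
      value≡ = trans (cong suc (weighted-rows m H 1 _ (λ j _ → width-product m H (H ∸ j))))
        (sym (cong (_∸ 1) (total-one (level-sum m H) (∏[1⋯ H ] (λ i → m i ∸ 1)) H)))

  radioNumber-twoCentres : IsLevelwiseRegularTree T 2 (suc H) m →
    RadioNumber T (level-sum m H + 2 * ∏[1⋯ H ] (λ i → m i ∸ 1) + 6 * suc H ∸ 3)
  radioNumber-twoCentres tree = subst (RadioNumber T) value≡ radio-number
    where
      open IsLevelwiseRegularTree tree
      connected = proj₁ isTree
      acyclic = proj₂ isTree
      open Metric T connected
      centre = Center.centreSize2 T connected acyclic {suc H} height centerSize
      open Center.CentralEdge (proj₂ (proj₂ centre))
      k : ℕ → ℕ
      k i = m i ∸ 1
      level : ∀ {x y v} → Central T x → (∀ {u} → Central T u → u ≡ x ⊎ u ≡ y) → d v y ≡ suc (d v x) → Level T (d v x) v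
      level {x} {y} {v} cx only′ iv = (x , cx , subst (Distance T x v) (d-sym x v) (d-Distance x v)) ,
        λ { (u , cu , dist) → from (only′ cu) dist }
        where
          from : ∀ {u j} → u ≡ x ⊎ u ≡ y → Distance T u v j → d v x ≤ j
          from (inj₁ refl) dist = ≤-reflexive (trans (d-sym v x) (sym (Distance⇒≡d dist)))
          from (inj₂ refl) dist = ≤-trans (n≤1+n _) (≤-reflexive (trans (sym iv) (trans (d-sym v y) (sym (Distance⇒≡d dist)))))
      degrees : ∀ {x y} → Central T x → (∀ {u} → Central T u → u ≡ x ⊎ u ≡ y) →
        ∀ {v} → d v y ≡ suc (d v x) → d v x < suc H → degree T v ≡ suc (k (d v x))
      degrees cx only′ iv lt = trans (levelDegree lt (level cx only′ iv)) (m-positive lt)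
      only-swap : ∀ {u} → Central T u → u ≡ c₁ ⊎ u ≡ c₀
      only-swap cu = swap (only cu)
      open TwoCentres T connected acyclic H k (cong (_∸ 1) m0≡2) (λ i 1≤i i≤H → ∸-monoˡ-≤ 1 (3≤m i 1≤i i≤H))
        c₀ c₁ edge bounded₀ bounded₁ (degrees central₀ only) (degrees central₁ only-swap)
        (subst (Diameter T) (trans D≡ (+-comm 1 _)) (proj₁ (proj₂ centre)))
      value≡ : 2 * H + 1 + Layout.rows k (suc H) (λ j → weight 2 j + 2) (suc H) ≡
        level-sum m H + 2 * ∏[1⋯ H ] (λ i → m i ∸ 1) + 6 * suc H ∸ 3
      value≡ = trans (cong (2 * H + 1 +_) (weighted-rows m H 2 _
          (λ j j≤H → trans (cong (width k) (+-∸-assoc 1 j≤H)) (width-product′ m H m0≡2 (H ∸ j)))))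
        (sym (cong (_∸ 3) (total-two (level-sum m H) (∏[1⋯ H ] (λ i → m i ∸ 1)) H)))

-- For one centre and `h = 1` the formula is false: the tree is the path on three vertices, whose
-- labels 0, 3, 1 in the order of the path have span 3, while the formula gives 4. Therefore the
-- first part assumes `2 ≤ h`.
theorem4p1 : (h : ℕ) (m : ℕ → ℕ) → 1 ≤ h → m 0 ≡ 2 →
    (∀ i → 1 ≤ i → i ≤ h ∸ 1 → 3 ≤ m i) →
    (2 ≤ h → ∀ {n} (T : Graph n) → IsLevelwiseRegularTree T 1 h m →
    RadioNumber T
    (∑[1⋯ h ∸ 1 ] (λ i → (4 * (h ∸ i) ∸ 2) * ∏[1⋯ i ] (λ j → m j ∸ 1))
    + ∏[1⋯ h ∸ 1 ] (λ i → m i ∸ 1) + 4 * h ∸ 1))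
    × (∀ {n} (T : Graph n) → IsLevelwiseRegularTree T 2 h m →
    RadioNumber T
    (∑[1⋯ h ∸ 1 ] (λ i → (4 * (h ∸ i) ∸ 2) * ∏[1⋯ i ] (λ j → m j ∸ 1))
    + 2 * ∏[1⋯ h ∸ 1 ] (λ i → m i ∸ 1) + 6 * h ∸ 3))
theorem4p1 (suc H) m _ m0≡2 3≤m =
  (λ { (s≤s 1≤H) T → radioNumber-oneCentre m0≡2 3≤m T 1≤H }) ,
  (λ T → radioNumber-twoCentres m0≡2 3≤m T)
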